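{- $\mathrm{Fin}(11)=\mathrm{Adm}(11)\setminus\{(3,0),(4,0),(4,6),(5,0),(5,1),(5,2),(6,0),(6,1),(6,3),(6,4)\}$.
   Context: $K_4-e$ is the graph on four vertices $a,b,c,d$ with edges $ab,ac,ad,bc,bd$; it is denoted $[a,b,c-d]$. A $(K_4-e)$-design of order $v$ is a pair $(X,\mathcal B)$ where $X$ is a set of $v$ vertices and $\mathcal B$ is a collection of copies of $K_4-e$ (blocks) with vertices in $X$ whose edge sets partition the edges of $K_v$ on $X$; it has $b_v=v(v-1)/10$ blocks. For a graph $B$, $T(B)$ is the set of its triangles (3-vertex subsets inducing a triangle); e.g. $T([a,b,c-d])=\{\{a,b,c\},\{a,b,d\}\}$, and $T(\mathcal B)=\bigcup_{B\in\mathcal B}T(B)$. Two designs $(X,\mathcal B_1),(X,\mathcal B_2)$ on the same vertex set intersect in $s$ blocks if $|\mathcal B_1\cap\mathcal B_2|=s$, and in $t$ triangles if $|T(\mathcal B_1)\cap T(\mathcal B_2)|=t$. Define $\mathrm{Fin}(v)=\{(s,t):$ there exists a pair of $(K_4-e)$-designs of order $v$ on the same vertex set intersecting in $s$ blocks and $t+2s$ triangles$\}$; $J(v)=\{s:$ there is a pair of $(K_4-e)$-designs of order $v$ intersecting in $s$ blocks$\}$; $J_T(v)=\{t:$ there is a pair of $(K_4-e)$-designs of order $v$ intersecting in $t$ triangles$\}$; and $\mathrm{Adm}(v)=\{(s,t): s,t\ge 0,\ s+t\le b_v,\ s\in J(v),\ t+2s\in J_T(v)\}$. (Known from the literature: $J(11)=\{0,1,\dots,6,11\}$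 and $J_T(11)=\{0,1,\dots,16,22\}$.) -}

module Defs where

open import Data.Bool.Base using (_∨_)
open import Data.Fin.Base using (Fin)
open import Data.Fin.Properties using (_≟_)
open import Data.Fin.Subset using (Subset; ∣_∣)
import Data.Fin.Subset as Subset
open import Data.List.Base using (List; []; _∷_; length)
open import Data.List.Membership.Propositional using (_∈_)
import Data.List.Membership.DecPropositional as DecMembership
open import Data.List.Relation.Unary.All using (All)
open import Data.List.Relation.Unary.Unique.Propositional using (Unique)
open import Data.Nat.Base using (ℕ; _+_; _*_; _∸_; _≤_; _/_)
open import Data.Product.Base using (_×_; _,_; ∃; ∃₂)
open import Data.Product using (∃!)
open import Data.Product.Properties using (≡-dec)
open import Data.Vec.Base using (Vec; tabulate; lookup)
open import Function.Bundles using (_⇔_)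
open import Level using (0ℓ)
open import Relation.Binary.PropositionalEquality using (_≡_; _≢_)
open import Relation.Nullary.Decidable using (does)
open import Relation.Unary using (Pred)
import Relation.Unary as Pred

HasCardinality : {A : Set} → Pred A 0ℓ → ℕ → Set
HasCardinality P n = ∃ λ xs → Unique xs × (∀ x → x ∈ xs ⇔ Pred._∈_ x P) × length xs ≡ n

-- Row x is the neighbourhood of x.  Adjacency matrices, rather than labelled
-- tuples, make _≡_ the equality of graphs: [ a , b , c - d ] and
-- [ b , a , d - c ] are the same block.  Vertices outside a block are
-- isolated in its matrix.
Graph : ℕ → Set
Graph v = Vec (Subset v) v

Adjacent : ∀ {v} → Graph v → Fin v → Fin v → Set
Adjacent G x y = y Subset.∈ lookup G x

fromEdges : ∀ {v} → List (Fin v × Fin v) → Graph v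
fromEdges es = tabulate λ x → tabulate λ y →
  does ((x , y) ∈? es) ∨ does ((y , x) ∈? es)
  where open DecMembership (≡-dec _≟_ _≟_) using (_∈?_)

[_,_,_-_] : ∀ {v} → (a b c d : Fin v) → Graph v
[ a , b , c - d ] =
  fromEdges ((a , b) ∷ (a , c) ∷ (a , d) ∷ (b , c) ∷ (b , d) ∷ [])

IsK₄-e : ∀ {v} → Pred (Graph v) 0ℓ
IsK₄-e G = ∃₂ λ a b → ∃₂ λ c d →
  Unique (a ∷ b ∷ c ∷ d ∷ []) × G ≡ [ a , b , c - d ]

record Design (v : ℕ) : Set where
  field
    blocks    : List (Graph v)
    distinct  : Unique blocks
    copies    : All IsK₄-e blocks
    partition : ∀ {x y} → x ≢ y → ∃! _≡_ λ G → G ∈ blocks × Adjacent G x y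

open Design public

IsTriangle : ∀ {v} → Graph v → Pred (Subset v) 0ℓ
IsTriangle G S =
  ∣ S ∣ ≡ 3 × (∀ {x y} → x Subset.∈ S → y Subset.∈ S → x ≢ y → Adjacent G x y)

Triangles : ∀ {v} → Design v → Pred (Subset v) 0ℓ
Triangles D S = ∃ λ B → B ∈ blocks D × IsTriangle B S

IntersectInBlocks : ∀ {v} → Design v → Design v → ℕ → Set
IntersectInBlocks D₁ D₂ =
  HasCardinality (Pred._∩_ (_∈ blocks D₁) (_∈ blocks D₂))

IntersectInTriangles : ∀ {v} → Design v → Design v → ℕ → Set
IntersectInTriangles D₁ D₂ =
  HasCardinality (Pred._∩_ (Triangles D₁) (Triangles D₂))

-- The set usually written Fin(v), renamed to avoid a clash with Data.Fin.
Fine : ℕ → Pred (ℕ × ℕ) 0ℓ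
Fine v (s , t) = ∃₂ λ (D₁ D₂ : Design v) →
  IntersectInBlocks D₁ D₂ s × IntersectInTriangles D₁ D₂ (t + 2 * s)

J : ℕ → Pred ℕ 0ℓ
J v s = ∃₂ λ (D₁ D₂ : Design v) → IntersectInBlocks D₁ D₂ s

J-T : ℕ → Pred ℕ 0ℓ
J-T v t = ∃₂ λ (D₁ D₂ : Design v) → IntersectInTriangles D₁ D₂ t

-- The number of blocks of a design of order v.  The division is exact whenever
-- a design exists, since its blocks partition the v(v-1)/2 edges of K_v into
-- classes of size 5.
b : ℕ → ℕ
b v = v * (v ∸ 1) / 10

Adm : ℕ → Pred (ℕ × ℕ) 0ℓ
Adm v (s , t) = s + t ≤ b v × Pred._∈_ s (J v) × Pred._∈_ (t + 2 * s) (J-T v)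

{-# OPTIONS --safe #-}
-- In a design of order 11 every vertex is a centre (a or b) of two blocks [ a , b , c - d ] and an end
-- (c or d) of two, by counting degrees.  Naming the vertices after the four blocks at one vertex reduces
-- the classification of the designs to an exact-cover search, whose solutions are all isomorphic to
-- { [ i , i + 1 , i + 3 - i + k ] : i ∈ ℤ₁₁ } with k = 5 or k = 7.
--
-- If two designs share a block, then, both being cyclic, they may be identified with these in such a way
-- that the shared block is the one at i = 0 in both.  The bijections of the vertices which fix that block
-- and leave at least three shared blocks are few enough to be enumerated.  If at most two blocks are
-- shared, the only constraint is s + t ≤ 11: both triangles of a block contain its central edge, so a
-- block with both triangles in the other design is itself in the other design.  Explicit pairs of
-- designs attain every remaining (s , t).
module Submission where

open import Data.Bool.Base using (Bool; true; false; T; _∧_; _∨_; not; if_then_else_)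
open import Data.Bool.ListAction using (all; any)
open import Data.Bool.Properties using (T-≡; T-∨; T-∧; T?)
open import Data.Fin.Base using (Fin; toℕ; fromℕ<; punchOut)
open import Data.Fin.Properties as Fin using (toℕ-injective; toℕ<n; toℕ-fromℕ<; injective⇒≤; punchOut-injective)
open import Data.Fin.Subset using (Subset; _⊆_; _∪_; ⁅_⁆; ∣_∣)
import Data.Fin.Subset as Subset
open import Data.Fin.Subset.Properties using (⊆-antisym)
import Data.Fin.Subset.Properties as Subsetₚ
open import Data.List.Base using (List; []; _∷_; map; length; upTo; filterᵇ; concatMap; _++_; cartesianProduct; applyUpTo; _∷ʳ_; null)
import Data.List.Membership.DecPropositional as DecMembership
open import Data.List.Membership.Propositional using (_∈_; find; lose)
open import Data.List.Membership.Propositional.Properties using (∈-map⁺; ∈-map⁻; ∈-upTo⁺; ∈-filter⁺; ∈-filter⁻; ∈-concatMap⁺; ∈-concatMap⁻; ∈-upTo⁻; ∈-cartesianProduct⁺; ∈-++⁺ʳ; ∈-++⁺ˡ; ∈-++⁻; ∈-∃++; ∈-cartesianProduct⁻; ∈-applyUpTo⁻)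
open import Data.List.Membership.Propositional.Properties.WithK using (unique∧set⇒bag)
open import Data.List.Properties using (length-map; length-++; filter-++; applyUpTo-∷ʳ; map-cong-local; map-id)
open import Data.List.Relation.Binary.BagAndSetEquality using (∼bag⇒↭)
open import Data.List.Relation.Binary.Permutation.Propositional using (_↭_; ↭-sym; ↭-trans; ↭-refl; ↭⇒↭ₛ)
open import Data.List.Relation.Binary.Permutation.Propositional.Properties using (↭-length; shift; filter-↭; ∈-resp-↭; ++⁺ˡ)
import Data.List.Relation.Binary.Permutation.Setoid.Properties as SetoidPerm
open import Data.List.Relation.Unary.All as All using (All; []; _∷_)
open import Data.List.Relation.Unary.All.Properties as Allₚ using (all⁺)
open import Data.List.Relation.Unary.AllPairs as AllPairs using (AllPairs; []; _∷_)
import Data.List.Relation.Unary.AllPairs.Properties as AllPairsₚ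
open import Data.List.Relation.Unary.Any as Any using (Any; here; there)
open import Data.List.Relation.Unary.Any.Properties as Anyₚ using (any⁺; any⁻)
open import Data.List.Relation.Unary.Unique.Propositional using (Unique)
import Data.List.Relation.Unary.Unique.Propositional.Properties as Uniqueₚ
open import Data.Nat.Base
open import Data.Nat.DivMod using (_mod_; m%n<n; m<n⇒m%n≡m; _%_)
open import Data.Nat.ListAction using (sum)
open import Data.Nat.Properties
open import Data.Nat.Solver using (module +-*-Solver)
open import Data.Product.Base using (_×_; _,_; ∃; proj₁; proj₂; ∃₂)
open import Data.Product.Properties using (≡-dec)
open import Data.Sum.Base as Sum using (_⊎_; inj₁; inj₂; [_,_]′)
open import Data.Unit.Base using (tt)
open import Data.Vec.Base using (lookup; tabulate)
open import Data.Vec.Properties using (lookup∘tabulate; lookup⇒[]=; []=⇒lookup)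
import Data.Vec.Relation.Binary.Pointwise.Extensional as Vec
open import Function.Base using (_∘_; id)
open import Function.Bundles using (_⇔_; mk⇔; Equivalence)
open import Level using (0ℓ)
open import Relation.Binary.Definitions using (tri<; tri≈; tri>)
open import Relation.Binary.PropositionalEquality hiding (J)
open import Relation.Nullary using (¬_; contradiction; does; Dec; yes; no; ¬?; _×-dec_)
open import Relation.Unary using (Pred; _≐_; _∖_)
open import Defs

-- Blocks as quadruples of numbers

-- Both searches are settled by evaluation, so whatever they inspect is a Boolean test on plain
-- numbers. The price is that a block has four names as a quadruple; `role` is the invariant through
-- which names are compared. The count of degrees: a vertex that is a centre of p blocks and an end
-- of r has 3 p + 2 r = 10, so (p , r) is (0 , 5) or (2 , 2), and p is 2 on average. Three shared
-- blocks is where exceptions begin: for s ≤ 2 every pair with s + t ≤ 11 is attained, while for s ≥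
-- 3 that bound is no longer sharp enough. The block at which the classification starts is
-- arbitrary, and the isomorphism found takes the block at i = 0 to it. This is how a shared block
-- comes to sit at i = 0 in both designs. The same dichotomy, applied to all intersection numbers of
-- a pair of designs, bounds the sets `J 11` and `J-T 11` which enter through `Adm 11`.

data ≡ᵇ-View (m n : ℕ) : Bool → Set where
  equal    : m ≡ n → ≡ᵇ-View m n true
  unequal  : m ≢ n → ≡ᵇ-View m n false

≡ᵇ-view : ∀ m n → ≡ᵇ-View m n (m ≡ᵇ n)
≡ᵇ-view zero    zero    = equal refl
≡ᵇ-view zero    (suc n) = unequal λ ()
≡ᵇ-view (suc m) zero    = unequal λ ()
≡ᵇ-view (suc m) (suc n) with m ≡ᵇ n | ≡ᵇ-view m n
... | true  | equal m≡n    = equal (cong suc m≡n)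
... | false | unequal m≢n = unequal (m≢n ∘ suc-injective)

≡ᵇ-cong : ∀ {m n m′ n′} → (m ≡ n → m′ ≡ n′) → (m′ ≡ n′ → m ≡ n) → (m ≡ᵇ n) ≡ (m′ ≡ᵇ n′)
≡ᵇ-cong {m} {n} {m′} {n′} f g with m ≡ᵇ n | ≡ᵇ-view m n | m′ ≡ᵇ n′ | ≡ᵇ-view m′ n′
... | true  | _              | true  | _              = refl
... | false | _              | false | _              = refl
... | true  | equal m≡n      | false | unequal m′≢n′ = contradiction (f m≡n) m′≢n′
... | false | unequal m≢n   | true  | equal m′≡n′    = contradiction (g m′≡n′) m≢n

data Quad : Set where
  quad : (a b c d : ℕ) → Quad

corners : Quad → List ℕ
corners (quad a b c d) = a ∷ b ∷ c ∷ d ∷ []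

Proper : Quad → Set
Proper q = All (_< 11) (corners q) × Unique (corners q)

-- Centres play role 2, ends role 1; distinct vertices are adjacent when their roles sum to at least 3.
role : Quad → ℕ → ℕ
role (quad a b c d) x =
  if (x ≡ᵇ a) ∨ (x ≡ᵇ b) then 2 else if (x ≡ᵇ c) ∨ (x ≡ᵇ d) then 1 else 0

data Role (a b c d x : ℕ) : ℕ → Set where
  centre₁ : x ≡ a → Role a b c d x 2
  centre₂ : x ≡ b → Role a b c d x 2
  end₁    : x ≡ c → Role a b c d x 1
  end₂    : x ≡ d → Role a b c d x 1
  outside : x ≢ a → x ≢ b → x ≢ c → x ≢ d → Role a b c d x 0

role-view : ∀ a b c d x → Role a b c d x (role (quad a b c d) x)
role-view a b c d x with x ≡ᵇ a | ≡ᵇ-view x a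
... | true | equal x≡a = centre₁ x≡a
... | false | unequal x≢a with x ≡ᵇ b | ≡ᵇ-view x b
...   | true | equal x≡b = centre₂ x≡b
...   | false | unequal x≢b with x ≡ᵇ c | ≡ᵇ-view x c
...     | true | equal x≡c = end₁ x≡c
...     | false | unequal x≢c with x ≡ᵇ d | ≡ᵇ-view x d
...       | true | equal x≡d = end₂ x≡d
...       | false | unequal x≢d = outside x≢a x≢b x≢c x≢d

role≤2 : ∀ q x → role q x ≤ 2
role≤2 (quad a b c d) x with role (quad a b c d) x | role-view a b c d x
... | _ | centre₁ _ = s≤s (s≤s z≤n)
... | _ | centre₂ _ = s≤s (s≤s z≤n)
... | _ | end₁ _ = s≤s z≤n
... | _ | end₂ _ = s≤s z≤n
... | _ | outside _ _ _ _ = z≤n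

module _ {a b c d : ℕ} where
  a≢b : Proper (quad a b c d) → a ≢ b
  a≢b (_ , (h ∷ _) ∷ _) = h

  a≢c : Proper (quad a b c d) → a ≢ c
  a≢c (_ , (_ ∷ h ∷ _) ∷ _) = h

  a≢d : Proper (quad a b c d) → a ≢ d
  a≢d (_ , (_ ∷ _ ∷ h ∷ _) ∷ _) = h

  b≢c : Proper (quad a b c d) → b ≢ c
  b≢c (_ , _ ∷ (h ∷ _) ∷ _) = h

  b≢d : Proper (quad a b c d) → b ≢ d
  b≢d (_ , _ ∷ (_ ∷ h ∷ _) ∷ _) = h

  c≢d : Proper (quad a b c d) → c ≢ d
  c≢d (_ , _ ∷ _ ∷ (h ∷ _) ∷ _) = h

module _ {a b c d} (p : Proper (quad a b c d)) where
  private
    q = quad a b c d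

  role-centre₁ : role q a ≡ 2
  role-centre₁ with role q a | role-view a b c d a
  ... | _ | centre₁ _ = refl
  ... | _ | centre₂ _ = refl
  ... | _ | end₁ a≡c = contradiction a≡c (a≢c p)
  ... | _ | end₂ a≡d = contradiction a≡d (a≢d p)
  ... | _ | outside a≢a _ _ _ = contradiction refl a≢a

  role-centre₂ : role q b ≡ 2
  role-centre₂ with role q b | role-view a b c d b
  ... | _ | centre₁ _ = refl
  ... | _ | centre₂ _ = refl
  ... | _ | end₁ b≡c = contradiction b≡c (b≢c p)
  ... | _ | end₂ b≡d = contradiction b≡d (b≢d p)
  ... | _ | outside _ b≢b _ _ = contradiction refl b≢b

  role-end₁ : role q c ≡ 1
  role-end₁ with role q c | role-view a b c d c
  ... | _ | centre₁ c≡a = contradiction (sym c≡a) (a≢c p)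
  ... | _ | centre₂ c≡b = contradiction (sym c≡b) (b≢c p)
  ... | _ | end₁ _ = refl
  ... | _ | end₂ _ = refl
  ... | _ | outside _ _ c≢c _ = contradiction refl c≢c

  role-end₂ : role q d ≡ 1
  role-end₂ with role q d | role-view a b c d d
  ... | _ | centre₁ d≡a = contradiction (sym d≡a) (a≢d p)
  ... | _ | centre₂ d≡b = contradiction (sym d≡b) (b≢d p)
  ... | _ | end₁ _ = refl
  ... | _ | end₂ _ = refl
  ... | _ | outside _ _ _ d≢d = contradiction refl d≢d

Adj : Quad → ℕ → ℕ → Set
Adj q x y = x ≢ y × 3 ≤ role q x + role q y

Adj-sym : ∀ q {x y} → Adj q x y → Adj q y x
Adj-sym q {x} {y} (x≢y , 3≤) = x≢y ∘ sym , subst (3 ≤_) (+-comm (role q x) (role q y)) 3≤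

-- Equality of blocks up to the four names, once the second quadruple is proper: two distinct
-- centres and two distinct ends of `q` exhaust those of `q`.
same : Quad → Quad → Bool
same q (quad a b c d) =
  (role q a ≡ᵇ 2) ∧ (role q b ≡ᵇ 2) ∧ (role q c ≡ᵇ 1) ∧ (role q d ≡ᵇ 1)

record Same (q : Quad) (a b c d : ℕ) : Set where
  constructor mkSame
  field
    ca : role q a ≡ 2
    cb : role q b ≡ 2
    ec : role q c ≡ 1
    ed : role q d ≡ 1

same⁻ : ∀ q {a b c d} → T (same q (quad a b c d)) → Same q a b c d
same⁻ q {a} {b} {c} {d} t
  with role q a ≡ᵇ 2 | ≡ᵇ-view (role q a) 2 | role q b ≡ᵇ 2 | ≡ᵇ-view (role q b) 2
     | role q c ≡ᵇ 1 | ≡ᵇ-view (role q c) 1 | role q d ≡ᵇ 1 | ≡ᵇ-view (role q d) 1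
... | true | equal p | true | equal p′ | true | equal p″ | true | equal p‴ = mkSame p p′ p″ p‴

same⁺ : ∀ q {a b c d} → Same q a b c d → T (same q (quad a b c d))
same⁺ q (mkSame p p′ p″ p‴) rewrite p | p′ | p″ | p‴ = _

centre-injective : ∀ {a b c d x y} → x ≢ y → Role a b c d x 2 → Role a b c d y 2 →
                   (a ≡ x × b ≡ y) ⊎ (a ≡ y × b ≡ x)
centre-injective x≢y (centre₁ p) (centre₁ p′) = contradiction (trans p (sym p′)) x≢y
centre-injective x≢y (centre₁ p) (centre₂ p′) = inj₁ (sym p , sym p′)
centre-injective x≢y (centre₂ p) (centre₁ p′) = inj₂ (sym p′ , sym p)
centre-injective x≢y (centre₂ p) (centre₂ p′) = contradiction (trans p (sym p′)) x≢y

end-injective : ∀ {a b c d x y} → x ≢ y → Role a b c d x 1 → Role a b c d y 1 →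
                (c ≡ x × d ≡ y) ⊎ (c ≡ y × d ≡ x)
end-injective x≢y (end₁ p) (end₁ p′) = contradiction (trans p (sym p′)) x≢y
end-injective x≢y (end₁ p) (end₂ p′) = inj₁ (sym p , sym p′)
end-injective x≢y (end₂ p) (end₁ p′) = inj₂ (sym p′ , sym p)
end-injective x≢y (end₂ p) (end₂ p′) = contradiction (trans p (sym p′)) x≢y

viewAs : ∀ {a b c d x k} → role (quad a b c d) x ≡ k → Role a b c d x k
viewAs {a} {b} {c} {d} {x} refl = role-view a b c d x

if-∨-comm : ∀ x y {A : Set} {s t : A} → (if x ∨ y then s else t) ≡ (if y ∨ x then s else t)
if-∨-comm false false = refl
if-∨-comm false true = refl
if-∨-comm true false = refl
if-∨-comm true true = refl

role-swap-centres : ∀ a b c d x → role (quad a b c d) x ≡ role (quad b a c d) x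
role-swap-centres a b c d x = if-∨-comm (x ≡ᵇ a) (x ≡ᵇ b)

role-swap-ends : ∀ a b c d x → role (quad a b c d) x ≡ role (quad a b d c) x
role-swap-ends a b c d x rewrite if-∨-comm (x ≡ᵇ c) (x ≡ᵇ d) {s = 1} {t = 0} = refl

same⇒role : ∀ q r → Proper r → T (same q r) → ∀ x → role q x ≡ role r x
same⇒role q@(quad a b c d) r@(quad a′ b′ c′ d′) (_ , ((a′≢b′ ∷ _) ∷ _ ∷ (c′≢d′ ∷ _) ∷ _)) t x
  with mkSame p p′ p″ p‴ ← same⁻ q {a′} {b′} {c′} {d′} t
  with centre-injective a′≢b′ (viewAs {a} {b} {c} {d} p) (viewAs p′) | end-injective c′≢d′ (viewAs {a} {b} {c} {d} p″) (viewAs p‴)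
... | inj₁ (refl , refl) | inj₁ (refl , refl) = refl
... | inj₁ (refl , refl) | inj₂ (refl , refl) = role-swap-ends a b c d x
... | inj₂ (refl , refl) | inj₁ (refl , refl) = role-swap-centres a b c d x
... | inj₂ (refl , refl) | inj₂ (refl , refl) =
  trans (role-swap-centres a b c d x) (role-swap-ends b a c d x)

role⇒same : ∀ q r → Proper r → (∀ x → role q x ≡ role r x) → T (same q r)
role⇒same q (quad a b c d) p eq = same⁺ q (mkSame
  (trans (eq a) (role-centre₁ p)) (trans (eq b) (role-centre₂ p))
  (trans (eq c) (role-end₁ p)) (trans (eq d) (role-end₂ p)))

Adj-cong : ∀ q r {x y} → (∀ z → role q z ≡ role r z) → Adj q x y → Adj r x y
Adj-cong q r {x} {y} eq (x≢y , 3≤) = x≢y , subst₂ (λ m n → 3 ≤ m + n) (eq x) (eq y) 3≤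

-- As k and l are at most 2, m and n are at least 1; the missing edge then makes both equal to 1,
-- which forces k and l up to 2.
roles-from-adjacency : ∀ {k l m n} → k ≤ 2 → l ≤ 2 → m ≤ 2 → n ≤ 2 →
  3 ≤ k + m → 3 ≤ k + n → 3 ≤ l + m → 3 ≤ l + n → ¬ (3 ≤ m + n) →
  k ≡ 2 × l ≡ 2 × m ≡ 1 × n ≡ 1
roles-from-adjacency {2} {2} {1} {1} _ _ _ _ _ _ _ _ _ = refl , refl , refl , refl
roles-from-adjacency {m = 1} {2} _ _ _ _ _ _ _ _ ¬p = contradiction (s≤s (s≤s (s≤s z≤n))) ¬p
roles-from-adjacency {m = 2} {1} _ _ _ _ _ _ _ _ ¬p = contradiction (s≤s (s≤s (s≤s z≤n))) ¬p
roles-from-adjacency {m = 2} {2} _ _ _ _ _ _ _ _ ¬p = contradiction (s≤s (s≤s (s≤s z≤n))) ¬p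
roles-from-adjacency {0} {m = 1} _ _ _ _ (s≤s ()) _ _ _ _
roles-from-adjacency {0} {m = 0} _ _ _ _ () _ _ _ _
roles-from-adjacency {0} {m = 2} _ _ _ _ (s≤s (s≤s ())) _ _ _ _
roles-from-adjacency {1} {m = 1} _ _ _ _ (s≤s (s≤s ())) _ _ _ _
roles-from-adjacency {1} {m = 0} _ _ _ _ (s≤s ()) _ _ _ _
roles-from-adjacency {2} {m = 0} _ _ _ _ (s≤s (s≤s ())) _ _ _ _
roles-from-adjacency {2} {0} {m = 1} _ _ _ _ _ _ (s≤s ()) _ _
roles-from-adjacency {2} {1} {m = 1} _ _ _ _ _ _ (s≤s (s≤s ())) _ _
roles-from-adjacency {2} {2} {m = 1} {0} _ _ _ _ _ (s≤s (s≤s ())) _ _ _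
roles-from-adjacency {2} {m = 2} {0} _ _ _ _ _ (s≤s (s≤s ())) _ _ _
roles-from-adjacency {1} {m = 2} {0} _ _ _ _ _ (s≤s ()) _ _ _
roles-from-adjacency {suc (suc (suc _))} (s≤s (s≤s ())) _ _ _ _ _ _ _ _
roles-from-adjacency {l = suc (suc (suc _))} _ (s≤s (s≤s ())) _ _ _ _ _ _ _
roles-from-adjacency {m = suc (suc (suc _))} _ _ (s≤s (s≤s ())) _ _ _ _ _ _
roles-from-adjacency {n = suc (suc (suc _))} _ _ _ (s≤s (s≤s ())) _ _ _ _ _

module _ {a b c d} (p : Proper (quad a b c d)) where
  private
    q = quad a b c d

  a-b : Adj q a b
  a-b = a≢b p , subst₂ (λ m n → 3 ≤ m + n) (sym (role-centre₁ p)) (sym (role-centre₂ p)) (s≤s (s≤s (s≤s z≤n)))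

  a-c : Adj q a c
  a-c = a≢c p , subst₂ (λ m n → 3 ≤ m + n) (sym (role-centre₁ p)) (sym (role-end₁ p)) ≤-refl

  a-d : Adj q a d
  a-d = a≢d p , subst₂ (λ m n → 3 ≤ m + n) (sym (role-centre₁ p)) (sym (role-end₂ p)) ≤-refl

  b-c : Adj q b c
  b-c = b≢c p , subst₂ (λ m n → 3 ≤ m + n) (sym (role-centre₂ p)) (sym (role-end₁ p)) ≤-refl

  b-d : Adj q b d
  b-d = b≢d p , subst₂ (λ m n → 3 ≤ m + n) (sym (role-centre₂ p)) (sym (role-end₂ p)) ≤-refl

  ¬c-d : ¬ Adj q c d
  ¬c-d (_ , 3≤) with s≤s (s≤s ()) ← subst₂ (λ m n → 3 ≤ m + n) (role-end₁ p) (role-end₂ p) 3≤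

-- The ends are the only nonadjacent pair of corners, so the four edges from centres to ends
-- together with this one non-edge fix all the roles.
adjacency⇒same : ∀ q r → Proper r → (∀ {x y} → Adj q x y → Adj r x y) →
                 (∀ {x y} → Adj r x y → Adj q x y) → T (same q r)
adjacency⇒same q (quad a b c d) p@(_ , (_ ∷ _ ∷ (c≢d ∷ _) ∷ _)) f g
  with ra , rb , rc , rd ← roles-from-adjacency (role≤2 q a) (role≤2 q b) (role≤2 q c) (role≤2 q d)
         (proj₂ (g (a-c p))) (proj₂ (g (a-d p))) (proj₂ (g (b-c p))) (proj₂ (g (b-d p)))
         (λ 3≤ → ¬c-d p (f (c≢d , 3≤)))
  = same⁺ q (mkSame ra rb rc rd)

data Edge (a b c d : ℕ) : ℕ → ℕ → Set where
  ab : Edge a b c d a b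
  ac : Edge a b c d a c
  ad : Edge a b c d a d
  bc : Edge a b c d b c
  bd : Edge a b c d b d

Adj⇒Edge : ∀ {a b c d x y} → Adj (quad a b c d) x y → Edge a b c d x y ⊎ Edge a b c d y x
Adj⇒Edge {a} {b} {c} {d} {x} {y} (x≢y , 3≤)
  with role (quad a b c d) x | role-view a b c d x | role (quad a b c d) y | role-view a b c d y | 3≤
... | _ | centre₁ refl | _ | centre₁ refl | _ = contradiction refl x≢y
... | _ | centre₁ refl | _ | centre₂ refl | _ = inj₁ ab
... | _ | centre₁ refl | _ | end₁ refl | _ = inj₁ ac
... | _ | centre₁ refl | _ | end₂ refl | _ = inj₁ ad
... | _ | centre₂ refl | _ | centre₁ refl | _ = inj₂ ab
... | _ | centre₂ refl | _ | centre₂ refl | _ = contradiction refl x≢y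
... | _ | centre₂ refl | _ | end₁ refl | _ = inj₁ bc
... | _ | centre₂ refl | _ | end₂ refl | _ = inj₁ bd
... | _ | end₁ refl | _ | centre₁ refl | _ = inj₂ ac
... | _ | end₁ refl | _ | centre₂ refl | _ = inj₂ bc
... | _ | end₂ refl | _ | centre₁ refl | _ = inj₂ ad
... | _ | end₂ refl | _ | centre₂ refl | _ = inj₂ bd
... | _ | centre₁ _ | _ | outside _ _ _ _ | s≤s (s≤s ())
... | _ | centre₂ _ | _ | outside _ _ _ _ | s≤s (s≤s ())
... | _ | end₁ _ | _ | end₁ _ | s≤s (s≤s ())
... | _ | end₁ _ | _ | end₂ _ | s≤s (s≤s ())
... | _ | end₂ _ | _ | end₁ _ | s≤s (s≤s ())
... | _ | end₂ _ | _ | end₂ _ | s≤s (s≤s ())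
... | _ | end₁ _ | _ | outside _ _ _ _ | s≤s ()
... | _ | end₂ _ | _ | outside _ _ _ _ | s≤s ()
... | _ | outside _ _ _ _ | _ | centre₁ _ | s≤s (s≤s ())
... | _ | outside _ _ _ _ | _ | centre₂ _ | s≤s (s≤s ())
... | _ | outside _ _ _ _ | _ | end₁ _ | s≤s ()
... | _ | outside _ _ _ _ | _ | end₂ _ | s≤s ()
... | _ | outside _ _ _ _ | _ | outside _ _ _ _ | ()

-- Designs as lists of quadruples

module _ {v} (es : List (Fin v × Fin v)) where
  open DecMembership {A = Fin v × Fin v} (≡-dec Fin._≟_ Fin._≟_) using (_∈?_)

  private
    lookup-fromEdges : ∀ x y → lookup (lookup (fromEdges es) x) y ≡ does ((x , y) ∈? es) ∨ does ((y , x) ∈? es)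
    lookup-fromEdges x y = trans (cong (λ r → lookup r y) (lookup∘tabulate _ x)) (lookup∘tabulate _ y)

  fromEdges⁻ : ∀ {x y} → Adjacent (fromEdges es) x y → (x , y) ∈ es ⊎ (y , x) ∈ es
  fromEdges⁻ {x} {y} adj with (x , y) ∈? es | (y , x) ∈? es | trans (sym (lookup-fromEdges x y)) ([]=⇒lookup adj)
  ... | yes xy | _      | _ = inj₁ xy
  ... | no _   | yes yx | _ = inj₂ yx

  fromEdges⁺ : ∀ {x y} → (x , y) ∈ es ⊎ (y , x) ∈ es → Adjacent (fromEdges es) x y
  fromEdges⁺ {x} {y} xy∈ = lookup⇒[]= y _ (trans (lookup-fromEdges x y) (lemma xy∈))
    where
    lemma : (x , y) ∈ es ⊎ (y , x) ∈ es → does ((x , y) ∈? es) ∨ does ((y , x) ∈? es) ≡ true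
    lemma s with (x , y) ∈? es | (y , x) ∈? es | s
    ... | yes _ | _     | _ = refl
    ... | no _  | yes _ | _ = refl
    ... | no ¬p | no _  | inj₁ p = contradiction p ¬p
    ... | no _  | no ¬p | inj₂ p = contradiction p ¬p

graph-ext : ∀ {v} {G H : Graph v} → (∀ {x y} → Adjacent G x y → Adjacent H x y) →
            (∀ {x y} → Adjacent H x y → Adjacent G x y) → G ≡ H
graph-ext f g = Vec.Pointwise-≡⇒≡ (Vec.ext λ _ → ⊆-antisym f g)

-- Reduction modulo 11 serves to make the map total; the corners of a proper quadruple are below 11
-- already.
vertex : ℕ → Fin 11
vertex n = n mod 11

toℕ-vertex : ∀ {n} → n < 11 → toℕ (vertex n) ≡ n
toℕ-vertex {n} n<11 = trans (toℕ-fromℕ< (m%n<n n 11)) (m<n⇒m%n≡m n<11)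

vertex-toℕ : ∀ i → vertex (toℕ i) ≡ i
vertex-toℕ i = toℕ-injective (toℕ-vertex (toℕ<n i))

edges : Quad → List (Fin 11 × Fin 11)
edges (quad a b c d) =
  (vertex a , vertex b) ∷ (vertex a , vertex c) ∷ (vertex a , vertex d) ∷
  (vertex b , vertex c) ∷ (vertex b , vertex d) ∷ []

block : Quad → Graph 11
block (quad a b c d) = [ vertex a , vertex b , vertex c - vertex d ]

block⁻ : ∀ q {x y} → Proper q → Adjacent (block q) x y → Adj q (toℕ x) (toℕ y)
block⁻ q@(quad a b c d) p@((a< ∷ b< ∷ c< ∷ d< ∷ []) , _) adj =
  [ edge , Adj-sym q ∘ edge ]′ (fromEdges⁻ (edges q) adj)
  where
  edge : ∀ {x y} → (x , y) ∈ edges q → Adj q (toℕ x) (toℕ y)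
  edge (here refl) = subst₂ (Adj q) (sym (toℕ-vertex a<)) (sym (toℕ-vertex b<)) (a-b p)
  edge (there (here refl)) = subst₂ (Adj q) (sym (toℕ-vertex a<)) (sym (toℕ-vertex c<)) (a-c p)
  edge (there (there (here refl))) = subst₂ (Adj q) (sym (toℕ-vertex a<)) (sym (toℕ-vertex d<)) (a-d p)
  edge (there (there (there (here refl)))) = subst₂ (Adj q) (sym (toℕ-vertex b<)) (sym (toℕ-vertex c<)) (b-c p)
  edge (there (there (there (there (here refl))))) = subst₂ (Adj q) (sym (toℕ-vertex b<)) (sym (toℕ-vertex d<)) (b-d p)

block⁺ : ∀ q {x y} → Adj q (toℕ x) (toℕ y) → Adjacent (block q) x y
block⁺ q@(quad a b c d) adj = fromEdges⁺ (edges q) (Sum.map edge edge (Adj⇒Edge adj))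
  where
  edge : ∀ {x y} → Edge a b c d (toℕ x) (toℕ y) → (x , y) ∈ edges q
  edge {x} {y} e = subst₂ (λ x y → (x , y) ∈ edges q) (vertex-toℕ x) (vertex-toℕ y) (go e)
    where
    go : ∀ {m n} → Edge a b c d m n → (vertex m , vertex n) ∈ edges q
    go ab = here refl
    go ac = there (here refl)
    go ad = there (there (here refl))
    go bc = there (there (there (here refl)))
    go bd = there (there (there (there (here refl))))

Adj< : ∀ q {x y} → Proper q → Adj q x y → x < 11 × y < 11
Adj< (quad a b c d) ((a< ∷ b< ∷ c< ∷ d< ∷ []) , _) adj with Adj⇒Edge adj
... | inj₁ ab = a< , b<
... | inj₁ ac = a< , c<
... | inj₁ ad = a< , d<
... | inj₁ bc = b< , c<
... | inj₁ bd = b< , d<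
... | inj₂ ab = b< , a<
... | inj₂ ac = c< , a<
... | inj₂ ad = d< , a<
... | inj₂ bc = c< , b<
... | inj₂ bd = d< , b<

block⁺′ : ∀ q {x y} → Proper q → Adj q x y → Adjacent (block q) (vertex x) (vertex y)
block⁺′ q p adj with x< , y< ← Adj< q p adj =
  block⁺ q (subst₂ (Adj q) (sym (toℕ-vertex x<)) (sym (toℕ-vertex y<)) adj)

same⇒block≡ : ∀ {q r} → Proper q → Proper r → T (same q r) → block q ≡ block r
same⇒block≡ {q} {r} pq pr s = graph-ext
  (λ adj → block⁺ r (Adj-cong q r eq (block⁻ q pq adj)))
  (λ adj → block⁺ q (Adj-cong r q (sym ∘ eq) (block⁻ r pr adj)))
  where eq = same⇒role q r pr s

block≡⇒same : ∀ {q r} → Proper q → Proper r → block q ≡ block r → T (same q r)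
block≡⇒same {q} {r} pq pr eq = adjacency⇒same q r pr (transfer pq pr eq) (transfer pr pq (sym eq))
  where
  transfer : ∀ {q r} → Proper q → Proper r → block q ≡ block r → ∀ {x y} → Adj q x y → Adj r x y
  transfer {q} {r} pq pr eq adj with x< , y< ← Adj< q pq adj =
    subst₂ (Adj r) (toℕ-vertex x<) (toℕ-vertex y<)
      (block⁻ r pr (subst (λ G → Adjacent G _ _) eq (block⁺′ q pq adj)))

Disjoint : Quad → Quad → Set
Disjoint q r = ∀ x y → Adj q x y → ¬ Adj r x y

record Decomposition (qs : List Quad) : Set where
  field
    proper   : All Proper qs
    disjoint : AllPairs Disjoint qs
    covers   : ∀ {x y} → x < 11 → y < 11 → x ≢ y → Any (λ q → Adj q x y) qs

module _ {qs} (D : Decomposition qs) where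
  open Decomposition D

  unique-cover : ∀ {q r x y} → q ∈ qs → r ∈ qs → Adj q x y → Adj r x y → q ≡ r
  unique-cover = go disjoint
    where
    go : ∀ {qs} → AllPairs Disjoint qs → ∀ {q r x y} → q ∈ qs → r ∈ qs → Adj q x y → Adj r x y → q ≡ r
    go (_ ∷ _)   (here refl) (here refl) _ _ = refl
    go (dis ∷ _) (here refl) (there r∈) aq ar = contradiction ar (All.lookup dis r∈ _ _ aq)
    go (dis ∷ _) (there q∈) (here refl) aq ar = contradiction aq (All.lookup dis q∈ _ _ ar)
    go (_ ∷ ps)  (there q∈) (there r∈) aq ar = go ps q∈ r∈ aq ar

  design : Design 11
  design .blocks = map block qs
  design .distinct = AllPairsₚ.map⁺ (go proper disjoint)
    where
    go : ∀ {qs} → All Proper qs → AllPairs Disjoint qs → AllPairs (λ q r → block q ≢ block r) qs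
    go [] [] = []
    go {q@(quad _ _ _ _) ∷ _} (p ∷ ps) (dis ∷ diss) =
      -- Equal blocks would share the edge between the centres of `q`.
      All.zipWith (λ {r} (pr , dis) eq → dis _ _ (a-b p)
        (Adj-cong q r (same⇒role q r pr (block≡⇒same p pr eq)) (a-b p))) (ps , dis) ∷ go ps diss
  design .copies = Allₚ.map⁺ (All.map isK proper)
    where
    isK : ∀ {q} → Proper q → IsK₄-e (block q)
    isK {quad a b c d} p@((a< ∷ b< ∷ c< ∷ d< ∷ []) , _) =
      vertex a , vertex b , vertex c , vertex d ,
      ((v≢ a< b< (a≢b p) ∷ v≢ a< c< (a≢c p) ∷ v≢ a< d< (a≢d p) ∷ [])
        ∷ (v≢ b< c< (b≢c p) ∷ v≢ b< d< (b≢d p) ∷ []) ∷ (v≢ c< d< (c≢d p) ∷ []) ∷ [] ∷ []) , refl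
      where
      v≢ : ∀ {m n} → m < 11 → n < 11 → m ≢ n → vertex m ≢ vertex n
      v≢ m< n< m≢n eq = m≢n (trans (sym (toℕ-vertex m<)) (trans (cong toℕ eq) (toℕ-vertex n<)))
  design .partition {x} {y} x≢y
    with q , q∈ , adj ← find (covers (toℕ<n x) (toℕ<n y) (x≢y ∘ toℕ-injective)) =
    block q , (∈-map⁺ block q∈ , block⁺ q adj) , λ (G∈ , adj′) → unique adj q∈ G∈ adj′
    where
    unique : ∀ {q G} → Adj q (toℕ x) (toℕ y) → q ∈ qs → G ∈ map block qs → Adjacent G x y → block q ≡ G
    unique adj q∈ G∈ adj′ with r , r∈ , refl ← ∈-map⁻ block G∈ =
      cong block (unique-cover q∈ r∈ adj (block⁻ r (All.lookup proper r∈) adj′))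

-- Only the set of blocks is compared: a list may present it in another order and under other names,
-- as the renamed cyclic lists do.
Represents : List Quad → Design 11 → Set
Represents qs D = ∀ {G} → G ∈ map block qs ⇔ G ∈ blocks D

-- Chooses one of the four names of a block, so that every block is found in the finite list
-- `quads`.
canonical : Quad → Quad
canonical (quad a b c d) = quad (a ⊓ b) (a ⊔ b) (c ⊓ d) (c ⊔ d)

data Swapped : Quad → Quad → Set where
  neither : ∀ {a b c d} → Swapped (quad a b c d) (quad a b c d)
  centres : ∀ {a b c d} → Swapped (quad a b c d) (quad b a c d)
  ends    : ∀ {a b c d} → Swapped (quad a b c d) (quad a b d c)
  both    : ∀ {a b c d} → Swapped (quad a b c d) (quad b a d c)

swapped : ∀ q → Swapped q (canonical q)
swapped (quad a b c d) with ≤-total a b | ≤-total c d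
... | inj₁ a≤b | inj₁ c≤d rewrite m≤n⇒m⊓n≡m a≤b | m≤n⇒m⊔n≡n a≤b | m≤n⇒m⊓n≡m c≤d | m≤n⇒m⊔n≡n c≤d = neither
... | inj₁ a≤b | inj₂ d≤c rewrite m≤n⇒m⊓n≡m a≤b | m≤n⇒m⊔n≡n a≤b | m≥n⇒m⊓n≡n d≤c | m≥n⇒m⊔n≡m d≤c = ends
... | inj₂ b≤a | inj₁ c≤d rewrite m≥n⇒m⊓n≡n b≤a | m≥n⇒m⊔n≡m b≤a | m≤n⇒m⊓n≡m c≤d | m≤n⇒m⊔n≡n c≤d = centres
... | inj₂ b≤a | inj₂ d≤c rewrite m≥n⇒m⊓n≡n b≤a | m≥n⇒m⊔n≡m b≤a | m≥n⇒m⊓n≡n d≤c | m≥n⇒m⊔n≡m d≤c = both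

canonical-role : ∀ q x → role (canonical q) x ≡ role q x
canonical-role q x with canonical q | swapped q
... | _ | neither = refl
canonical-role (quad a b c d) x | _ | centres = role-swap-centres b a c d x
canonical-role (quad a b c d) x | _ | ends    = role-swap-ends a b d c x
canonical-role (quad a b c d) x | _ | both    = trans (role-swap-centres b a d c x) (role-swap-ends a b d c x)

canonical-proper : ∀ q → Proper q → Proper (canonical q)
canonical-proper q p with canonical q | swapped q
... | _ | neither = p
canonical-proper (quad a b c d) p@((a< ∷ b< ∷ c< ∷ d< ∷ []) , _) | _ | centres =
  (b< ∷ a< ∷ c< ∷ d< ∷ []) ,
  ((a≢b p ∘ sym ∷ b≢c p ∷ b≢d p ∷ []) ∷ (a≢c p ∷ a≢d p ∷ []) ∷ (c≢d p ∷ []) ∷ [] ∷ [])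
canonical-proper (quad a b c d) p@((a< ∷ b< ∷ c< ∷ d< ∷ []) , _) | _ | ends =
  (a< ∷ b< ∷ d< ∷ c< ∷ []) ,
  ((a≢b p ∷ a≢d p ∷ a≢c p ∷ []) ∷ (b≢d p ∷ b≢c p ∷ []) ∷ (c≢d p ∘ sym ∷ []) ∷ [] ∷ [])
canonical-proper (quad a b c d) p@((a< ∷ b< ∷ c< ∷ d< ∷ []) , _) | _ | both =
  (b< ∷ a< ∷ d< ∷ c< ∷ []) ,
  ((a≢b p ∘ sym ∷ b≢d p ∷ b≢c p ∷ []) ∷ (a≢d p ∷ a≢c p ∷ []) ∷ (c≢d p ∘ sym ∷ []) ∷ [] ∷ [])

toQuads : ∀ {Gs : List (Graph 11)} → All IsK₄-e Gs → List Quad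
toQuads [] = []
toQuads ((a , b , c , d , _) ∷ ps) = quad (toℕ a) (toℕ b) (toℕ c) (toℕ d) ∷ toQuads ps

block-toℕ : ∀ a b c d → block (quad (toℕ a) (toℕ b) (toℕ c) (toℕ d)) ≡ [ a , b , c - d ]
block-toℕ a b c d = trans
  (cong₂ (λ a b → [ a , b , vertex (toℕ c) - vertex (toℕ d) ]) (vertex-toℕ a) (vertex-toℕ b))
  (cong₂ (λ c d → [ a , b , c - d ]) (vertex-toℕ c) (vertex-toℕ d))

toQuads-blocks : ∀ {Gs : List (Graph 11)} (ps : All IsK₄-e Gs) → map block (toQuads ps) ≡ Gs
toQuads-blocks [] = refl
toQuads-blocks ((a , b , c , d , _ , eq) ∷ ps) =
  cong₂ _∷_ (trans (block-toℕ a b c d) (sym eq)) (toQuads-blocks ps)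

toQuads-proper : ∀ {Gs : List (Graph 11)} (ps : All IsK₄-e Gs) → All Proper (toQuads ps)
toQuads-proper [] = []
toQuads-proper ((a , b , c , d , u , _) ∷ ps) =
  ((toℕ<n a ∷ toℕ<n b ∷ toℕ<n c ∷ toℕ<n d ∷ []) ,
   AllPairsₚ.map⁺ {f = toℕ} (AllPairs.map (_∘ toℕ-injective) u)) ∷ toQuads-proper ps

module _ (D : Design 11) where
  private
    qs = toQuads (copies D)
    qs≡ : map block qs ≡ blocks D
    qs≡ = toQuads-blocks (copies D)

  quads-of-design : ∃ λ qs → Decomposition qs × Represents qs D
  quads-of-design = qs , record
    { proper   = toQuads-proper (copies D)
    ; disjoint = go (toQuads-proper (copies D))
                    (AllPairsₚ.map⁻ (subst Unique (sym qs≡) (distinct D)))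
                    λ q∈ → subst (_ ∈_) qs≡ (∈-map⁺ block q∈)
    ; covers   = cover
    } , mk⇔ (subst (_ ∈_) qs≡) (subst (_ ∈_) (sym qs≡))
    where
    go : ∀ {qs} → All Proper qs → AllPairs (λ q r → block q ≢ block r) qs →
         (∀ {q} → q ∈ qs → block q ∈ blocks D) → AllPairs Disjoint qs
    go [] [] _ = []
    go {q ∷ _} (p ∷ ps) (≢s ∷ ≢ss) ⊆D =
      -- A common edge makes the two blocks equal by the uniqueness in `partition`.
      All.tabulate (λ {r} r∈ x y aq ar → All.lookup ≢s r∈
        (let x< , y< = Adj< q p aq
             _ , _ , unique = partition D {vertex x} {vertex y}
               (λ eq → proj₁ aq (trans (sym (toℕ-vertex x<)) (trans (cong toℕ eq) (toℕ-vertex y<))))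
         in trans (sym (unique (⊆D (here refl) , block⁺′ q p aq)))
                  (unique (⊆D (there r∈) , block⁺′ r (All.lookup ps r∈) ar))))
      ∷ go ps ≢ss (⊆D ∘ there)

    cover : ∀ {x y} → x < 11 → y < 11 → x ≢ y → Any (λ q → Adj q x y) qs
    cover {x} {y} x< y< x≢y
      with G , (G∈ , adj) , _ ← partition D {vertex x} {vertex y}
             (λ eq → x≢y (trans (sym (toℕ-vertex x<)) (trans (cong toℕ eq) (toℕ-vertex y<))))
      with q , q∈ , refl ← ∈-map⁻ block (subst (G ∈_) (sym qs≡) G∈) =
      lose q∈ (subst₂ (Adj q) (toℕ-vertex x<) (toℕ-vertex y<)
        (block⁻ q (All.lookup (toQuads-proper (copies D)) q∈) adj))

-- Relabelling the vertices

-- Functions on all of ℕ, so that renamed quadruples evaluate without proofs of bounds; only the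
-- values below 11 are constrained.
record Perm : Set where
  field
    to from : ℕ → ℕ
    to<     : ∀ {n} → n < 11 → to n < 11
    from<   : ∀ {n} → n < 11 → from n < 11
    to-from : ∀ {n} → n < 11 → to (from n) ≡ n
    from-to : ∀ {n} → n < 11 → from (to n) ≡ n

open Perm

inverse : Perm → Perm
inverse σ = record
  { to = σ .from ; from = σ .to ; to< = σ .from< ; from< = σ .to<
  ; to-from = σ .from-to ; from-to = σ .to-from }

infixr 9 _⊙_
_⊙_ : Perm → Perm → Perm
σ ⊙ τ = record
  { to = σ .to ∘ τ .to ; from = τ .from ∘ σ .from
  ; to< = σ .to< ∘ τ .to< ; from< = τ .from< ∘ σ .from<
  ; to-from = λ n< → trans (cong (σ .to) (τ .to-from (σ .from< n<))) (σ .to-from n<)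
  ; from-to = λ n< → trans (cong (τ .from) (σ .from-to (τ .to< n<))) (τ .from-to n<) }

to-injective : ∀ σ {m n} → m < 11 → n < 11 → σ .to m ≡ σ .to n → m ≡ n
to-injective σ m< n< eq = trans (sym (σ .from-to m<)) (trans (cong (σ .from) eq) (σ .from-to n<))

rename : (ℕ → ℕ) → Quad → Quad
rename f (quad a b c d) = quad (f a) (f b) (f c) (f d)

rename-role : ∀ σ {q x} → Proper q → x < 11 → role (rename (σ .to) q) (σ .to x) ≡ role q x
rename-role σ {quad a b c d} {x} ((a< ∷ b< ∷ c< ∷ d< ∷ []) , _) x<
  rewrite ≡ᵇ-cong (to-injective σ x< a<) (cong (σ .to)) | ≡ᵇ-cong (to-injective σ x< b<) (cong (σ .to))
        | ≡ᵇ-cong (to-injective σ x< c<) (cong (σ .to)) | ≡ᵇ-cong (to-injective σ x< d<) (cong (σ .to)) = refl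

rename-role′ : ∀ σ {q x} → Proper q → x < 11 → role (rename (σ .to) q) x ≡ role q (σ .from x)
rename-role′ σ {q} p x< = trans (cong (role (rename (σ .to) q)) (sym (σ .to-from x<))) (rename-role σ p (σ .from< x<))

rename-proper : ∀ σ {q} → Proper q → Proper (rename (σ .to) q)
rename-proper σ {quad a b c d} p@((a< ∷ b< ∷ c< ∷ d< ∷ []) , _) =
  (σ .to< a< ∷ σ .to< b< ∷ σ .to< c< ∷ σ .to< d< ∷ []) ,
  ((≢ a< b< (a≢b p) ∷ ≢ a< c< (a≢c p) ∷ ≢ a< d< (a≢d p) ∷ []) ∷
   (≢ b< c< (b≢c p) ∷ ≢ b< d< (b≢d p) ∷ []) ∷ (≢ c< d< (c≢d p) ∷ []) ∷ [] ∷ [])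
  where
  ≢ : ∀ {m n} → m < 11 → n < 11 → m ≢ n → σ .to m ≢ σ .to n
  ≢ m< n< m≢n = m≢n ∘ to-injective σ m< n<

rename-Adj⁺ : ∀ σ {q x y} → Proper q → Adj q x y → Adj (rename (σ .to) q) (σ .to x) (σ .to y)
rename-Adj⁺ σ {q} p adj@(x≢y , 3≤) with x< , y< ← Adj< q p adj =
  x≢y ∘ to-injective σ x< y< ,
  subst₂ (λ m n → 3 ≤ m + n) (sym (rename-role σ p x<)) (sym (rename-role σ p y<)) 3≤

rename-Adj⁻ : ∀ σ {q x y} → Proper q → Adj (rename (σ .to) q) x y → Adj q (σ .from x) (σ .from y)
rename-Adj⁻ σ {q} p adj@(x≢y , 3≤) with x< , y< ← Adj< (rename (σ .to) q) (rename-proper σ p) adj =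
  x≢y ∘ to-injective (inverse σ) x< y< ,
  subst₂ (λ m n → 3 ≤ m + n) (rename-role′ σ p x<) (rename-role′ σ p y<) 3≤

AllPairs-map : ∀ {P : Quad → Set} {R S : Quad → Quad → Set} → (∀ {q r} → P q → P r → R q r → S q r) →
               ∀ {qs} → All P qs → AllPairs R qs → AllPairs S qs
AllPairs-map f [] [] = []
AllPairs-map f (p ∷ ps) (r ∷ rs) = All.zipWith (λ (pr , x) → f p pr x) (ps , r) ∷ AllPairs-map f ps rs

rename-decomposition : ∀ σ {qs} → Decomposition qs → Decomposition (map (rename (σ .to)) qs)
rename-decomposition σ {qs} D = record
  { proper   = Allₚ.map⁺ (All.map (rename-proper σ) proper)
  ; disjoint = AllPairsₚ.map⁺ (AllPairs-map (λ {q} {r} p p′ dis x y aq ar →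
      dis _ _ (rename-Adj⁻ σ {q} p aq) (rename-Adj⁻ σ {r} p′ ar)) proper disjoint)
  ; covers   = λ {x} {y} x< y< x≢y →
      let q , q∈ , adj = find (covers (σ .from< x<) (σ .from< y<) (x≢y ∘ to-injective (inverse σ) x< y<))
      in lose (∈-map⁺ _ q∈) (subst₂ (Adj (rename (σ .to) q)) (σ .to-from x<) (σ .to-from y<)
           (rename-Adj⁺ σ {q} (All.lookup proper q∈) adj))
  }
  where open Decomposition D

canonical-decomposition : ∀ {qs} → Decomposition qs → Decomposition (map canonical qs)
canonical-decomposition {qs} D = record
  { proper   = Allₚ.map⁺ (All.map (canonical-proper _) proper)
  ; disjoint = AllPairsₚ.map⁺ (AllPairs.map (λ {q} {r} dis x y aq ar →
      dis x y (Adj-cong (canonical q) q (canonical-role q) aq) (Adj-cong (canonical r) r (canonical-role r) ar)) disjoint)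
  ; covers   = λ x< y< x≢y → Anyₚ.map⁺ (Any.map (λ {q} →
      Adj-cong q (canonical q) (sym ∘ canonical-role q)) (covers x< y< x≢y))
  }
  where open Decomposition D

-- Bijections given by their lists of values

nth : List ℕ → ℕ → ℕ
nth []       _       = 0
nth (v ∷ vs) zero    = v
nth (v ∷ vs) (suc n) = nth vs n

index : List ℕ → ℕ → ℕ
index []       x = 0
index (v ∷ vs) x = if x ≡ᵇ v then 0 else suc (index vs x)

nth∈ : ∀ vs {n} → n < length vs → nth vs n ∈ vs
nth∈ (v ∷ vs) {zero}  _         = here refl
nth∈ (v ∷ vs) {suc n} (s≤s n<) = there (nth∈ vs n<)

nth-index : ∀ vs {x} → x ∈ vs → nth vs (index vs x) ≡ x
nth-index (v ∷ vs) {x} x∈ with x ≡ᵇ v | ≡ᵇ-view x v | x∈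
... | true  | equal x≡v  | _         = sym x≡v
... | false | unequal _  | there x∈′ = nth-index vs x∈′
... | false | unequal x≢ | here x≡   = contradiction x≡ x≢

index< : ∀ vs {x} → x ∈ vs → index vs x < length vs
index< (v ∷ vs) {x} x∈ with x ≡ᵇ v | ≡ᵇ-view x v | x∈
... | true  | equal _    | _         = s≤s z≤n
... | false | unequal _  | there x∈′ = s≤s (index< vs x∈′)
... | false | unequal x≢ | here x≡   = contradiction x≡ x≢

-- An injection of {0,…,10} into itself cannot miss n, by the pigeonhole principle.
section⇒retraction : ∀ (f g : ℕ → ℕ) → (∀ {n} → n < 11 → f n < 11) → (∀ {n} → n < 11 → g n < 11) →
                     (∀ {n} → n < 11 → f (g n) ≡ n) → ∀ {n} → n < 11 → g (f n) ≡ n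
section⇒retraction f g f< g< fg {n} n< with g (f n) ≟ n
... | yes eq = eq
... | no neq = contradiction (injective⇒≤ {f = h} h-injective) 1+n≰n
  where
  missed : ∀ (i : Fin 11) → fromℕ< n< ≢ fromℕ< (g< (toℕ<n i))
  missed i eq = neq (trans (cong (g ∘ f) n≡) (trans (cong g (fg (toℕ<n i))) (sym n≡)))
    where
    n≡ : n ≡ g (toℕ i)
    n≡ = trans (sym (toℕ-fromℕ< n<)) (trans (cong toℕ eq) (toℕ-fromℕ< _))

  h : Fin 11 → Fin 10
  h i = punchOut (missed i)

  h-injective : ∀ {i j} → h i ≡ h j → i ≡ j
  h-injective {i} {j} eq = toℕ-injective (trans (sym (fg (toℕ<n i)))
    (trans (cong f (trans (sym (toℕ-fromℕ< _)) (trans (cong toℕ (punchOut-injective (missed i) (missed j) eq)) (toℕ-fromℕ< _))))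
           (fg (toℕ<n j))))

-- Eleven entries that hit all eleven numbers cannot repeat: `index vs` is a right inverse of
-- `nth vs`, and `section⇒retraction` makes it a left inverse.
enumeration : (vs : List ℕ) → length vs ≡ 11 → All (_< 11) vs → (∀ {n} → n < 11 → n ∈ vs) → Perm
enumeration vs len vs< complete = record
  { to = nth vs ; from = index vs ; to< = nth< ; from< = ind<
  ; to-from = nth-index vs ∘ complete
  ; from-to = section⇒retraction (nth vs) (index vs) nth< ind< (nth-index vs ∘ complete) }
  where
  nth< : ∀ {n} → n < 11 → nth vs n < 11
  nth< {n} n< = All.lookup vs< (nth∈ vs (subst (n <_) (sym len) n<))
  ind< : ∀ {n} → n < 11 → index vs n < 11
  ind< {n} n< = subst (index vs n <_) len (index< vs (complete n<))

all-upTo : ∀ (p : ℕ → Bool) {n} → T (all p (upTo n)) → ∀ {x} → x < n → T (p x)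
all-upTo p {n} t x< = All.lookup (all⁺ p (upTo n) t) (∈-upTo⁺ x<)

isEnumeration : List ℕ → Bool
isEnumeration vs = (length vs ≡ᵇ 11) ∧ all (_<ᵇ 11) vs ∧ all (λ n → any (n ≡ᵇ_) vs) (upTo 11)

enumerated : ∀ vs → T (isEnumeration vs) → Perm
enumerated vs t with t₁ , t₂ ← Equivalence.to (T-∧ {length vs ≡ᵇ 11}) t
  with t₃ , t₄ ← Equivalence.to (T-∧ {all (_<ᵇ 11) vs}) t₂ =
  enumeration vs (≡ᵇ⇒≡ _ 11 t₁) (All.map (<ᵇ⇒< _ 11) (all⁺ _ vs t₃))
    (λ n< → Any.map (≡ᵇ⇒≡ _ _) (any⁻ _ vs (all-upTo (λ n → any (n ≡ᵇ_) vs) t₄ n<)))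

-- Shared blocks and triangles

-- Two enumerations of one set without repetition are permutations of each other. This allows one
-- intersection to be counted from different presentations of the designs.
cardinality-unique : ∀ {A : Set} {P : Pred A 0ℓ} {m n} → HasCardinality P m → HasCardinality P n → m ≡ n
cardinality-unique (xs , xs! , xs⇔ , refl) (ys , ys! , ys⇔ , refl) =
  ↭-length (∼bag⇒↭ (unique∧set⇒bag xs! ys! λ {x} → mk⇔
    (Equivalence.from (ys⇔ x) ∘ Equivalence.to (xs⇔ x))
    (Equivalence.from (xs⇔ x) ∘ Equivalence.to (ys⇔ x))))

bit : Bool → ℕ
bit b = if b then 1 else 0

length-filterᵇ-∷ : ∀ {A : Set} (p : A → Bool) x xs → length (filterᵇ p (x ∷ xs)) ≡ bit (p x) + length (filterᵇ p xs)
length-filterᵇ-∷ p x xs with p x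
... | true  = refl
... | false = refl

occurs : List Quad → Quad → Bool
occurs qs r = any (λ q → same q r) qs

shared : List Quad → List Quad → List Quad
shared qs rs = filterᵇ (occurs qs) rs

Triple : Set
Triple = ℕ × ℕ × ℕ

triangles : Quad → List Triple
triangles (quad a b c d) = (a , b , c) ∷ (a , b , d) ∷ []

-- The roles of three distinct vertices sum to 5 just when they are both centres and an end.
spans : Quad → Triple → Bool
spans q (x , y , z) = role q x + role q y + role q z ≡ᵇ 5

spanned : List Quad → Triple → Bool
spanned qs t = any (λ q → spans q t) qs

sharedTriangles : List Quad → List Quad → List Triple
sharedTriangles qs rs = filterᵇ (spanned qs) (concatMap triangles rs)

-- Stated for all representing lists, so that it applies both to the blocks as given and to the
-- renamed cyclic lists.
blocks-intersect : ∀ {qs rs D₁ D₂} → Decomposition qs → Decomposition rs →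
                   Represents qs D₁ → Represents rs D₂ →
                   IntersectInBlocks D₁ D₂ (length (shared qs rs))
blocks-intersect {qs} {rs} {D₁} {D₂} Q R repQ repR =
  map block (shared qs rs) ,
  AllPairsₚ.map⁺ (AllPairsₚ.filter⁺ (T? ∘ occurs qs) (AllPairsₚ.map⁻ (distinct (design R)))) ,
  (λ G → mk⇔ forwards backwards) , length-map block (shared qs rs)
  where
  forwards : ∀ {G} → G ∈ map block (shared qs rs) → G ∈ blocks D₁ × G ∈ blocks D₂
  forwards G∈ with r , r∈ , refl ← ∈-map⁻ block G∈
        with r∈rs , occ ← ∈-filter⁻ (T? ∘ occurs qs) {xs = rs} r∈
        with q , q∈ , s ← find (any⁻ (λ q → same q r) qs occ) =
    Equivalence.to repQ (subst (_∈ map block qs)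
      (same⇒block≡ (All.lookup (Q .Decomposition.proper) q∈) (All.lookup (R .Decomposition.proper) r∈rs) s)
      (∈-map⁺ block q∈)) ,
    Equivalence.to repR (∈-map⁺ block r∈rs)
  backwards : ∀ {G} → G ∈ blocks D₁ × G ∈ blocks D₂ → G ∈ map block (shared qs rs)
  backwards (G∈₁ , G∈₂) with q , q∈ , refl ← ∈-map⁻ block (Equivalence.from repQ G∈₁)
                   with r , r∈ , eq ← ∈-map⁻ block (Equivalence.from repR G∈₂) =
    subst (_∈ map block (shared qs rs)) (sym eq) (∈-map⁺ block (∈-filter⁺ (T? ∘ occurs qs) r∈
      (any⁺ (λ q → same q r) (lose q∈
        (block≡⇒same (All.lookup (Q .Decomposition.proper) q∈) (All.lookup (R .Decomposition.proper) r∈) eq)))))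

vertices : Triple → List ℕ
vertices (x , y , z) = x ∷ y ∷ z ∷ []

ProperTriple : Triple → Set
ProperTriple t = All (_< 11) (vertices t) × Unique (vertices t)

subset : Triple → Subset 11
subset (x , y , z) = ⁅ vertex x ⁆ ∪ (⁅ vertex y ⁆ ∪ ⁅ vertex z ⁆)

∈-subset⁻ : ∀ t {i} → All (_< 11) (vertices t) → i Subset.∈ subset t → toℕ i ∈ vertices t
∈-subset⁻ (x , y , z) (x< ∷ y< ∷ z< ∷ []) i∈ with Subsetₚ.x∈p∪q⁻ ⁅ vertex x ⁆ _ i∈
... | inj₁ p = here (trans (cong toℕ (Subsetₚ.x∈⁅y⁆⇒x≡y _ p)) (toℕ-vertex x<))
... | inj₂ p with Subsetₚ.x∈p∪q⁻ ⁅ vertex y ⁆ _ p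
...   | inj₁ p = there (here (trans (cong toℕ (Subsetₚ.x∈⁅y⁆⇒x≡y _ p)) (toℕ-vertex y<)))
...   | inj₂ p = there (there (here (trans (cong toℕ (Subsetₚ.x∈⁅y⁆⇒x≡y _ p)) (toℕ-vertex z<))))

∈-subset⁺ : ∀ t {i} → toℕ i ∈ vertices t → i Subset.∈ subset t
∈-subset⁺ (x , y , z) {i} i∈ = subst (Subset._∈ subset (x , y , z)) (vertex-toℕ i) (go i∈)
  where
  go : ∀ {n} → n ∈ x ∷ y ∷ z ∷ [] → vertex n Subset.∈ subset (x , y , z)
  go (here refl) = Subsetₚ.x∈p∪q⁺ (inj₁ (Subsetₚ.x∈⁅x⁆ (vertex x)))
  go (there (here refl)) = Subsetₚ.x∈p∪q⁺ {p = ⁅ vertex x ⁆} (inj₂ (Subsetₚ.x∈p∪q⁺ (inj₁ (Subsetₚ.x∈⁅x⁆ (vertex y)))))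
  go (there (there (here refl))) = Subsetₚ.x∈p∪q⁺ {p = ⁅ vertex x ⁆} (inj₂ (Subsetₚ.x∈p∪q⁺ {p = ⁅ vertex y ⁆} (inj₂ (Subsetₚ.x∈⁅x⁆ (vertex z)))))

∈-subset⁺′ : ∀ t {n} → All (_< 11) (vertices t) → n ∈ vertices t → vertex n Subset.∈ subset t
∈-subset⁺′ t ts< n∈ = ∈-subset⁺ t (subst (_∈ vertices t) (sym (toℕ-vertex (All.lookup ts< n∈))) n∈)

private
  sized : ℕ → ℕ → ℕ → Bool
  sized x y z = (x ≡ᵇ y) ∨ (x ≡ᵇ z) ∨ (y ≡ᵇ z) ∨ (∣ subset (x , y , z) ∣ ≡ᵇ 3)

  -- All 11³ triples are evaluated; those with a repeated entry are exempt.
  sized-all : all (λ x → all (λ y → all (sized x y) (upTo 11)) (upTo 11)) (upTo 11) ≡ true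
  sized-all = refl

-- The tests decided by evaluation encode an implication as a disjunction with the negated
-- hypotheses on the left; this discharges one of them.
∨-elimˡ : ∀ {x y} → ¬ T x → T (x ∨ y) → T y
∨-elimˡ {x} ¬x t = [ (λ p → contradiction p ¬x) , id ]′ (Equivalence.to (T-∨ {x}) t)

∣subset∣ : ∀ t → ProperTriple t → ∣ subset t ∣ ≡ 3
∣subset∣ (x , y , z) ((x< ∷ y< ∷ z< ∷ []) , ((x≢y ∷ x≢z ∷ []) ∷ (y≢z ∷ []) ∷ _)) =
  ≡ᵇ⇒≡ _ 3 (∨-elimˡ {y ≡ᵇ z} (y≢z ∘ ≡ᵇ⇒≡ y z) (∨-elimˡ {x ≡ᵇ z} (x≢z ∘ ≡ᵇ⇒≡ x z) (∨-elimˡ {x ≡ᵇ y} (x≢y ∘ ≡ᵇ⇒≡ x y)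
    (all-upTo (sized x y) (all-upTo (λ y → all (sized x y) (upTo 11))
      (all-upTo (λ x → all (λ y → all (sized x y) (upTo 11)) (upTo 11))
        (Equivalence.from T-≡ sized-all) x<) y<) z<))))

3≤-pair : ∀ m n {k} → k ≤ 2 → m + n + k ≡ 5 → 3 ≤ m + n
3≤-pair m n k≤2 eq = +-cancelʳ-≤ 2 3 (m + n) (≤-trans (≤-reflexive (sym eq)) (+-monoʳ-≤ (m + n) k≤2))

module _ (q : Quad) {x y z : ℕ} where
  spans⇒3≤ : T (spans q (x , y , z)) →
    3 ≤ role q x + role q y × 3 ≤ role q x + role q z × 3 ≤ role q y + role q z
  spans⇒3≤ t = 3≤-pair (role q x) (role q y) (role≤2 q z) eq ,
    3≤-pair (role q x) (role q z) (role≤2 q y) (trans (+-assoc (role q x) _ _) (trans (cong (role q x +_) (+-comm (role q z) _)) (trans (sym (+-assoc (role q x) _ _)) eq))) ,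
    3≤-pair (role q y) (role q z) (role≤2 q x) (trans (+-comm _ (role q x)) (trans (sym (+-assoc (role q x) _ _)) eq))
    where
    eq = ≡ᵇ⇒≡ (role q x + role q y + role q z) 5 t

spans⇒triangle : ∀ {q t} → Proper q → ProperTriple t → T (spans q t) → IsTriangle (block q) (subset t)
spans⇒triangle {q} {t@(x , y , z)} p pt@(t< , ((x≢y ∷ x≢z ∷ []) ∷ (y≢z ∷ []) ∷ _)) s
  with xy , xz , yz ← spans⇒3≤ q {x} {y} {z} s =
  ∣subset∣ t pt , λ i∈ j∈ i≢j → block⁺ q (i≢j ∘ toℕ-injective ,
    go (∈-subset⁻ t t< i∈) (∈-subset⁻ t t< j∈) (i≢j ∘ toℕ-injective))
  where
  comm : ∀ {m n} → 3 ≤ m + n → 3 ≤ n + m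
  comm {m} {n} = subst (3 ≤_) (+-comm m n)
  go : ∀ {m n} → m ∈ x ∷ y ∷ z ∷ [] → n ∈ x ∷ y ∷ z ∷ [] → m ≢ n → 3 ≤ role q m + role q n
  go (here refl) (here refl) m≢n = contradiction refl m≢n
  go (here refl) (there (here refl)) _ = xy
  go (here refl) (there (there (here refl))) _ = xz
  go (there (here refl)) (here refl) _ = comm {role q x} xy
  go (there (here refl)) (there (here refl)) m≢n = contradiction refl m≢n
  go (there (here refl)) (there (there (here refl))) _ = yz
  go (there (there (here refl))) (here refl) _ = comm {role q x} xz
  go (there (there (here refl))) (there (here refl)) _ = comm {role q y} yz
  go (there (there (here refl))) (there (there (here refl))) m≢n = contradiction refl m≢n

at-most-two-centres : ∀ q {x y z} → Unique (x ∷ y ∷ z ∷ []) → role q x ≡ 2 → role q y ≡ 2 → role q z ≢ 2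
at-most-two-centres (quad a b c d) ((x≢y ∷ x≢z ∷ []) ∷ (y≢z ∷ []) ∷ _) rx ry rz
  with centre-injective x≢y (viewAs {a} {b} {c} {d} rx) (viewAs {a} {b} {c} {d} ry) | viewAs {a} {b} {c} {d} rz
... | inj₁ (refl , refl) | centre₁ z≡a = x≢z (sym z≡a)
... | inj₁ (refl , refl) | centre₂ z≡b = y≢z (sym z≡b)
... | inj₂ (refl , refl) | centre₁ z≡a = y≢z (sym z≡a)
... | inj₂ (refl , refl) | centre₂ z≡b = x≢z (sym z≡b)

-- Roles at most 2 with pairwise sums at least 3 are 2, 2, 1 in some order or 2, 2, 2, and a block
-- has only two centres.
adjacent⇒spans : ∀ q {x y z} → Adj q x y → Adj q x z → Adj q y z → T (spans q (x , y , z))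
adjacent⇒spans q {x} {y} {z} (x≢y , xy) (x≢z , xz) (y≢z , yz) =
  ≡⇒≡ᵇ _ 5 (go (role≤2 q x) (role≤2 q y) (role≤2 q z) xy xz yz
    (at-most-two-centres q ((x≢y ∷ x≢z ∷ []) ∷ (y≢z ∷ []) ∷ [] ∷ [])))
  where
  go : ∀ {k l m} → k ≤ 2 → l ≤ 2 → m ≤ 2 → 3 ≤ k + l → 3 ≤ k + m → 3 ≤ l + m →
       (k ≡ 2 → l ≡ 2 → m ≢ 2) → k + l + m ≡ 5
  go {2} {2} {2} _ _ _ _ _ _ h = contradiction refl (h refl refl)
  go {2} {2} {1} _ _ _ _ _ _ _ = refl
  go {2} {1} {2} _ _ _ _ _ _ _ = refl
  go {1} {2} {2} _ _ _ _ _ _ _ = refl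
  go {0} {l} _ l≤2 _ 3≤ _ _ _ = contradiction (≤-trans 3≤ l≤2) λ { (s≤s (s≤s ())) }
  go {1} {1} _ _ _ (s≤s (s≤s ())) _ _ _
  go {1} {0} _ _ _ (s≤s ()) _ _ _
  go {2} {0} _ _ _ (s≤s (s≤s ())) _ _ _
  go {2} {1} {1} _ _ _ _ _ (s≤s (s≤s ())) _
  go {2} {1} {0} _ _ _ _ _ (s≤s ()) _
  go {2} {2} {0} _ _ _ _ _ (s≤s (s≤s ())) _
  go {1} {2} {1} _ _ _ _ (s≤s (s≤s ())) _ _
  go {1} {2} {0} _ _ _ _ (s≤s ()) _ _
  go {suc (suc (suc _))} (s≤s (s≤s ()))
  go {l = suc (suc (suc _))} _ (s≤s (s≤s ()))
  go {m = suc (suc (suc _))} _ _ (s≤s (s≤s ()))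

triangle-Adj : ∀ {q t m n} → Proper q → All (_< 11) (vertices t) → IsTriangle (block q) (subset t) →
               m ∈ vertices t → n ∈ vertices t → m ≢ n → Adj q m n
triangle-Adj {q} {t} p t< (_ , adj) m∈ n∈ m≢n =
  subst₂ (Adj q) (toℕ-vertex m<) (toℕ-vertex n<)
    (block⁻ q p (adj (∈-subset⁺′ t t< m∈) (∈-subset⁺′ t t< n∈)
      (λ eq → m≢n (trans (sym (toℕ-vertex m<)) (trans (cong toℕ eq) (toℕ-vertex n<))))))
  where
  m< = All.lookup t< m∈
  n< = All.lookup t< n∈

triangle⇒spans : ∀ {q t} → Proper q → ProperTriple t → IsTriangle (block q) (subset t) → T (spans q t)
triangle⇒spans {q} {t@(x , y , z)} p (t< , ((x≢y ∷ x≢z ∷ []) ∷ (y≢z ∷ []) ∷ _)) tri =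
  adjacent⇒spans q (adj (here refl) (there (here refl)) x≢y) (adj (here refl) (there (there (here refl))) x≢z)
    (adj (there (here refl)) (there (there (here refl))) y≢z)
  where
  adj : ∀ {m n} → m ∈ vertices t → n ∈ vertices t → m ≢ n → Adj q m n
  adj = triangle-Adj {q} {t} p t< tri

triangles-proper : ∀ {q} → Proper q → All ProperTriple (triangles q)
triangles-proper {quad a b c d} p@((a< ∷ b< ∷ c< ∷ d< ∷ []) , _) =
  ((a< ∷ b< ∷ c< ∷ []) , ((a≢b p ∷ a≢c p ∷ []) ∷ (b≢c p ∷ []) ∷ [] ∷ [])) ∷
  ((a< ∷ b< ∷ d< ∷ []) , ((a≢b p ∷ a≢d p ∷ []) ∷ (b≢d p ∷ []) ∷ [] ∷ [])) ∷ []

triangles-spanned : ∀ {q} → Proper q → All (T ∘ spans q) (triangles q)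
triangles-spanned {q@(quad a b c d)} p = adjacent⇒spans q (a-b p) (a-c p) (b-c p) ∷ adjacent⇒spans q (a-b p) (a-d p) (b-d p) ∷ []

⊆∧∣∣≡⇒≡ : ∀ {n} {p q : Subset n} → p ⊆ q → ∣ p ∣ ≡ ∣ q ∣ → p ≡ q
⊆∧∣∣≡⇒≡ {p = p} {q} p⊆q eq with Fin.any? (λ x → (x Subsetₚ.∈? q) ×-dec ¬? (x Subsetₚ.∈? p))
... | yes (x , x∈q , x∉p) = contradiction eq (<⇒≢ (Subsetₚ.p⊂q⇒∣p∣<∣q∣ (p⊆q , x , x∈q , x∉p)))
... | no ¬x = Subsetₚ.⊆-antisym p⊆q λ {x} x∈q → go x x∈q
  where
  go : ∀ x → x Subset.∈ q → x Subset.∈ p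
  go x x∈q with x Subsetₚ.∈? p
  ... | yes x∈p = x∈p
  ... | no x∉p = contradiction (x , x∈q , x∉p) ¬x

another : ∀ {S : Subset 11} {x} → ∣ S ∣ ≡ 3 → ∃ λ y → y Subset.∈ S × x ≢ y
another {S} {x} size with Fin.any? (λ y → (y Subsetₚ.∈? S) ×-dec ¬? (x Fin.≟ y))
... | yes p = p
... | no ¬p = contradiction (subst₂ _≤_ size (Subsetₚ.∣⁅x⁆∣≡1 x) (Subsetₚ.p⊆q⇒∣p∣≤∣q∣ S⊆)) λ { (s≤s ()) }
  where
  S⊆ : S ⊆ ⁅ x ⁆
  S⊆ {y} y∈ with x Fin.≟ y
  ... | yes refl = Subsetₚ.x∈⁅x⁆ x
  ... | no x≢y = contradiction (y , y∈ , x≢y) ¬p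

Adj⇒corner : ∀ {a b c d x y} → Adj (quad a b c d) x y → x ∈ a ∷ b ∷ c ∷ d ∷ []
Adj⇒corner adj with Adj⇒Edge adj
... | inj₁ ab = here refl
... | inj₁ ac = here refl
... | inj₁ ad = here refl
... | inj₁ bc = there (here refl)
... | inj₁ bd = there (here refl)
... | inj₂ ab = there (here refl)
... | inj₂ ac = there (there (here refl))
... | inj₂ ad = there (there (there (here refl)))
... | inj₂ bc = there (there (here refl))
... | inj₂ bd = there (there (there (here refl)))

-- A triangle lies on the four corners and cannot contain both ends, which are not adjacent. Whether
-- it contains `d` decides in which listed triple it lies, and inclusion between sets of size 3 is
-- equality.
triangle-of-block : ∀ q {S} → Proper q → IsTriangle (block q) S → ∃ λ t → t ∈ triangles q × S ≡ subset t
triangle-of-block q@(quad a b c d) {S} p@((a< ∷ b< ∷ c< ∷ d< ∷ []) , _) (size , adj) = go (vertex d Subsetₚ.∈? S)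
  where
  proper : All ProperTriple (triangles q)
  proper = triangles-proper {q} p
  corner : ∀ {i} → i Subset.∈ S → toℕ i ∈ a ∷ b ∷ c ∷ d ∷ []
  corner i∈ = let j , j∈ , i≢j = another size in Adj⇒corner (block⁻ q p (adj i∈ j∈ i≢j))
  drop-d : ∀ {i} → ¬ vertex d Subset.∈ S → i Subset.∈ S → toℕ i ∈ a ∷ b ∷ c ∷ d ∷ [] → toℕ i ∈ a ∷ b ∷ c ∷ []
  drop-d d∉ i∈ (here e) = here e
  drop-d d∉ i∈ (there (here e)) = there (here e)
  drop-d d∉ i∈ (there (there (here e))) = there (there (here e))
  drop-d d∉ i∈ (there (there (there (here e)))) =
    contradiction (subst (Subset._∈ S) (trans (sym (vertex-toℕ _)) (cong vertex e)) i∈) d∉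
  drop-c : ∀ {i} → vertex d Subset.∈ S → i Subset.∈ S → toℕ i ∈ a ∷ b ∷ c ∷ d ∷ [] → toℕ i ∈ a ∷ b ∷ d ∷ []
  drop-c d∈ i∈ (here e) = here e
  drop-c d∈ i∈ (there (here e)) = there (here e)
  drop-c d∈ i∈ (there (there (here e))) = contradiction
    (subst₂ (Adj q) e (toℕ-vertex d<) (block⁻ q p (adj i∈ d∈
      (λ i≡d → c≢d p (trans (sym e) (trans (cong toℕ i≡d) (toℕ-vertex d<))))))) (¬c-d p)
  drop-c d∈ i∈ (there (there (there (here e)))) = there (there (here e))
  S≡ : ∀ {t} → ProperTriple t → (∀ {i} → i Subset.∈ S → toℕ i ∈ vertices t) → S ≡ subset t
  S≡ {t} pt S⊆ = ⊆∧∣∣≡⇒≡ (λ i∈ → ∈-subset⁺ t (S⊆ i∈)) (trans size (sym (∣subset∣ t pt)))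
  go : Dec (vertex d Subset.∈ S) → ∃ λ t → t ∈ triangles q × S ≡ subset t
  go (no d∉) = (a , b , c) , here refl ,
    S≡ (All.lookup proper (here refl)) (λ i∈ → drop-d d∉ i∈ (corner i∈))
  go (yes d∈) = (a , b , d) , there (here refl) ,
    S≡ (All.lookup proper (there (here refl))) (λ i∈ → drop-c d∈ i∈ (corner i∈))

module _ {rs} (R : Decomposition rs) where
  open Decomposition R

  -- The two triangles of one block differ in their ends; a triangle common to two blocks would give
  -- them a common edge.
  triangles-distinct : AllPairs (λ t u → subset t ≢ subset u) (concatMap triangles rs)
  triangles-distinct = AllPairsₚ.concat⁺ (Allₚ.map⁺ (All.map within proper))
    (AllPairsₚ.map⁺ (AllPairs-map (λ {q} {r} → across {q} {r}) proper disjoint))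
    where
    within : ∀ {q} → Proper q → AllPairs (λ t u → subset t ≢ subset u) (triangles q)
    within {q@(quad a b c d)} p with ((c< , _) ∷ (d< , _) ∷ []) ← triangles-proper {q} p = (differ ∷ []) ∷ [] ∷ []
      where
      differ : subset (a , b , c) ≢ subset (a , b , d)
      differ eq with ∈-subset⁻ (a , b , d) d< (subst (vertex c Subset.∈_) eq (∈-subset⁺′ (a , b , c) c< (there (there (here refl)))))
      ... | c∈ with subst (_∈ a ∷ b ∷ d ∷ []) (toℕ-vertex (All.lookup c< (there (there (here refl))))) c∈
      ...   | here c≡a = a≢c p (sym c≡a)
      ...   | there (here c≡b) = b≢c p (sym c≡b)
      ...   | there (there (here c≡d)) = c≢d p c≡d
    across : ∀ {q r} → Proper q → Proper r → Disjoint q r →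
             All (λ t → All (λ u → subset t ≢ subset u) (triangles r)) (triangles q)
    across {q@(quad a b c d)} {r} p p′ dis =
      All.zipWith (λ { {t} (pt , sp) → All.zipWith (λ { {u} (pu , sp′) eq → clashes {t} {u} pt sp pu sp′ eq })
        (triangles-proper p′ , triangles-spanned p′) }) (triangles-proper p , triangles-spanned p)
      where
      clashes : ∀ {t u} → ProperTriple t → T (spans q t) → ProperTriple u → T (spans r u) → subset t ≢ subset u
      clashes {t@(x , y , z)} {u} pt@(t< , ((x≢y ∷ _) ∷ _)) sp pu sp′ eq = dis x y
        (triangle-Adj {q} {t} p t< (spans⇒triangle {q} {t} p pt sp) (here refl) (there (here refl)) x≢y)
        (triangle-Adj {r} {t} p′ t< (subst (IsTriangle (block r)) (sym eq) (spans⇒triangle {r} {u} p′ pu sp′)) (here refl) (there (here refl)) x≢y)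

triangles-intersect : ∀ {qs rs D₁ D₂} → Decomposition qs → Decomposition rs →
                      Represents qs D₁ → Represents rs D₂ →
                      IntersectInTriangles D₁ D₂ (length (sharedTriangles qs rs))
triangles-intersect {qs} {rs} {D₁} {D₂} Q R repQ repR =
  map subset (sharedTriangles qs rs) ,
  AllPairsₚ.map⁺ (AllPairsₚ.filter⁺ (T? ∘ spanned qs) (triangles-distinct R)) ,
  (λ S → mk⇔ forwards backwards) , length-map subset (sharedTriangles qs rs)
  where
  properQ = All.lookup (Q .Decomposition.proper)
  properR = All.lookup (R .Decomposition.proper)
  forwards : ∀ {S} → S ∈ map subset (sharedTriangles qs rs) → Triangles D₁ S × Triangles D₂ S
  forwards S∈ with t , t∈ , refl ← ∈-map⁻ subset S∈
        with t∈rs , sp ← ∈-filter⁻ (T? ∘ spanned qs) {xs = concatMap triangles rs} t∈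
        with r , r∈ , t∈r ← find (∈-concatMap⁻ triangles {xs = rs} t∈rs)
        with q , q∈ , sq ← find (any⁻ (λ q → spans q t) qs sp) =
    (block q , Equivalence.to repQ (∈-map⁺ block q∈) ,
      spans⇒triangle {q} {t} (properQ q∈) (All.lookup (triangles-proper (properR r∈)) t∈r) sq) ,
    (block r , Equivalence.to repR (∈-map⁺ block r∈) ,
      spans⇒triangle {r} {t} (properR r∈) (All.lookup (triangles-proper (properR r∈)) t∈r)
        (All.lookup (triangles-spanned (properR r∈)) t∈r))
  backwards : ∀ {S} → Triangles D₁ S × Triangles D₂ S → S ∈ map subset (sharedTriangles qs rs)
  backwards ((G , G∈ , triG) , (H , H∈ , triH))
    with q , q∈ , refl ← ∈-map⁻ block (Equivalence.from repQ G∈)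
    with r , r∈ , refl ← ∈-map⁻ block (Equivalence.from repR H∈)
    with t , t∈ , refl ← triangle-of-block r (properR r∈) triH =
    ∈-map⁺ subset (∈-filter⁺ (T? ∘ spanned qs) (∈-concatMap⁺ triangles {xs = rs} (lose r∈ t∈))
      (any⁺ (λ q → spans q t) (lose q∈
        (triangle⇒spans {q} {t} (properQ q∈) (All.lookup (triangles-proper (properR r∈)) t∈) triG))))

module _ {qs} (Q : Decomposition qs) where
  -- Both triangles of r contain its central edge, so they lie in the same block of qs, which is then r.
  spanned-twice : ∀ {a b c d} → Proper (quad a b c d) → T (spanned qs (a , b , c)) → T (spanned qs (a , b , d)) →
                  T (occurs qs (quad a b c d))
  spanned-twice {a} {b} {c} {d} p s s′
    with q , q∈ , t ← find (any⁻ (λ q → spans q (a , b , c)) qs s)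
    with r , r∈ , t′ ← find (any⁻ (λ q → spans q (a , b , d)) qs s′)
    with 3≤ , _ ← spans⇒3≤ q {a} {b} {c} t | 3≤′ , _ ← spans⇒3≤ r {a} {b} {d} t′
    with refl ← unique-cover Q {x = a} {b} q∈ r∈ (a≢b p , 3≤) (a≢b p , 3≤′) =
    any⁺ (λ q → same q (quad a b c d)) (lose q∈ (same⁺ q {a} {b} {c} {d}
      (let ra , rb , rc , rd = roles (role≤2 q a) (role≤2 q b) (role≤2 q c)
             (+-cancelˡ-≡ (role q a + role q b) _ _ (trans eq (sym eq′))) eq
             (at-most-two-centres q acd) (at-most-two-centres q bcd)
       in mkSame ra rb rc rd)))
    where
    eq = ≡ᵇ⇒≡ (role q a + role q b + role q c) 5 t
    eq′ = ≡ᵇ⇒≡ (role q a + role q b + role q d) 5 t′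
    acd : Unique (a ∷ c ∷ d ∷ [])
    acd = (a≢c p ∷ a≢d p ∷ []) ∷ (c≢d p ∷ []) ∷ [] ∷ []
    bcd : Unique (b ∷ c ∷ d ∷ [])
    bcd = (b≢c p ∷ b≢d p ∷ []) ∷ (c≢d p ∷ []) ∷ [] ∷ []
    roles : ∀ {k l m n} → k ≤ 2 → l ≤ 2 → m ≤ 2 → m ≡ n → k + l + m ≡ 5 →
            (k ≡ 2 → m ≡ 2 → n ≢ 2) → (l ≡ 2 → m ≡ 2 → n ≢ 2) → k ≡ 2 × l ≡ 2 × m ≡ 1 × n ≡ 1
    roles {2} {2} {1} _ _ _ refl _ _ _ = refl , refl , refl , refl
    roles {2} {1} {2} _ _ _ refl _ h _ = contradiction refl (h refl refl)
    roles {1} {2} {2} _ _ _ refl _ _ h = contradiction refl (h refl refl)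
    roles {0} {1} {suc (suc (suc _))} _ _ (s≤s (s≤s ()))
    roles {0} {2} {suc (suc (suc _))} _ _ (s≤s (s≤s ()))
    roles {1} {0} {suc (suc (suc _))} _ _ (s≤s (s≤s ()))
    roles {1} {1} {suc (suc (suc _))} _ _ (s≤s (s≤s ()))
    roles {2} {0} {suc (suc (suc _))} _ _ (s≤s (s≤s ()))
    roles {0} {0} {suc (suc (suc _))} _ _ (s≤s (s≤s ()))
    roles {l = suc (suc (suc _))} _ (s≤s (s≤s ()))
    roles {suc (suc (suc _))} (s≤s (s≤s ()))

  private
    combine : ∀ s s′ o r {t n} → (T s → T s′ → T o) → t ≤ r + n → bit s + (bit s′ + t) ≤ suc r + (bit o + n)
    combine true  true  true  r {t} {n} _ ih = s≤s (subst (suc t ≤_) (sym (+-suc r n)) (s≤s ih))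
    combine true  true  false r h _  = contradiction (h _ _) λ ()
    combine true  false true  r _ ih = s≤s (≤-trans ih (+-monoʳ-≤ r (n≤1+n _)))
    combine true  false false r _ ih = s≤s ih
    combine false true  true  r _ ih = s≤s (≤-trans ih (+-monoʳ-≤ r (n≤1+n _)))
    combine false true  false r _ ih = s≤s ih
    combine false false true  r _ ih = ≤-trans ih (≤-trans (+-monoʳ-≤ r (n≤1+n _)) (n≤1+n _))
    combine false false false r _ ih = ≤-trans ih (n≤1+n _)

  -- A block of `rs` contributes at most one triangle, or two if it is shared, by `spanned-twice`.
  -- With 11 blocks and t + 2 s triangles this reads s + t ≤ 11.
  triangles-bound : ∀ {rs} → All Proper rs → length (sharedTriangles qs rs) ≤ length rs + length (shared qs rs)
  triangles-bound [] = z≤n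
  triangles-bound {r@(quad a b c d) ∷ rs} (p ∷ ps) = begin
    length (sharedTriangles qs (r ∷ rs))
      ≡⟨ length-filterᵇ-∷ (spanned qs) _ _ ⟩
    bit (spanned qs (a , b , c)) + length (filterᵇ (spanned qs) ((a , b , d) ∷ concatMap triangles rs))
      ≡⟨ cong (bit (spanned qs (a , b , c)) +_) (length-filterᵇ-∷ (spanned qs) _ _) ⟩
    bit (spanned qs (a , b , c)) + (bit (spanned qs (a , b , d)) + length (sharedTriangles qs rs))
      ≤⟨ combine (spanned qs (a , b , c)) (spanned qs (a , b , d)) (occurs qs r) (length rs) (spanned-twice p) (triangles-bound ps) ⟩
    suc (length rs) + (bit (occurs qs r) + length (shared qs rs))
      ≡⟨ cong (suc (length rs) +_) (length-filterᵇ-∷ (occurs qs) _ _) ⟨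
    length (r ∷ rs) + length (shared qs (r ∷ rs)) ∎
    where open ≤-Reasoning

-- Degrees

pairs : List (ℕ × ℕ)
pairs = filterᵇ (λ (i , j) → i <ᵇ j) (cartesianProduct (upTo 11) (upTo 11))

separate : (ℕ × ℕ) × (ℕ × ℕ) → Bool
separate ((a , b) , (c , d)) = not ((a ≡ᵇ c) ∨ (a ≡ᵇ d) ∨ (b ≡ᵇ c) ∨ (b ≡ᵇ d))

-- The 1980 canonical names: 55 pairs of centres, each with the 36 pairs of ends that avoid them.
quads : List Quad
quads = map (λ ((a , b) , (c , d)) → quad a b c d) (filterᵇ separate (cartesianProduct pairs pairs))

∈-pairs : ∀ {i j} → i < j → i < 11 → j < 11 → (i , j) ∈ pairs
∈-pairs i<j i< j< = ∈-filter⁺ (T? ∘ λ (i , j) → i <ᵇ j) (∈-cartesianProduct⁺ (∈-upTo⁺ i<) (∈-upTo⁺ j<)) (<⇒<ᵇ i<j)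

∈-quads : ∀ {a b c d} → Proper (quad a b c d) → a < b → c < d → quad a b c d ∈ quads
∈-quads {a} {b} {c} {d} p@((a< ∷ b< ∷ c< ∷ d< ∷ []) , _) a<b c<d =
  ∈-map⁺ (λ ((a , b) , (c , d)) → quad a b c d) (∈-filter⁺ (T? ∘ separate)
    (∈-cartesianProduct⁺ (∈-pairs a<b a< b<) (∈-pairs c<d c< d<)) sep)
  where
  sep : T (separate ((a , b) , (c , d)))
  sep with a ≡ᵇ c | ≡ᵇ-view a c | a ≡ᵇ d | ≡ᵇ-view a d | b ≡ᵇ c | ≡ᵇ-view b c | b ≡ᵇ d | ≡ᵇ-view b d
  ... | false | _ | false | _ | false | _ | false | _ = _
  ... | true | equal e | _ | _ | _ | _ | _ | _ = a≢c p e
  ... | false | _ | true | equal e | _ | _ | _ | _ = a≢d p e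
  ... | false | _ | false | _ | true | equal e | _ | _ = b≢c p e
  ... | false | _ | false | _ | false | _ | true | equal e = b≢d p e

⊓<⊔ : ∀ {m n} → m ≢ n → m ⊓ n < m ⊔ n
⊓<⊔ {m} {n} m≢n with <-cmp m n
... | tri< m<n _ _ rewrite m≤n⇒m⊓n≡m (<⇒≤ m<n) | m≤n⇒m⊔n≡n (<⇒≤ m<n) = m<n
... | tri≈ _ m≡n _ = contradiction m≡n m≢n
... | tri> _ _ n<m rewrite m≥n⇒m⊓n≡n (<⇒≤ n<m) | m≥n⇒m⊔n≡m (<⇒≤ n<m) = n<m

canonical∈quads : ∀ {q} → Proper q → canonical q ∈ quads
canonical∈quads {q@(quad a b c d)} p = ∈-quads (canonical-proper q p) (⊓<⊔ (a≢b p)) (⊓<⊔ (c≢d p))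

adjacent : Quad → ℕ → ℕ → Bool
adjacent q x y = not (x ≡ᵇ y) ∧ (3 ≤ᵇ role q x + role q y)

adjacent⁻ : ∀ q {x y} → T (adjacent q x y) → Adj q x y
adjacent⁻ q {x} {y} t with x ≡ᵇ y | ≡ᵇ-view x y
... | false | unequal x≢y = x≢y , ≤ᵇ⇒≤ 3 _ t

adjacent⁺ : ∀ q {x y} → Adj q x y → T (adjacent q x y)
adjacent⁺ q {x} {y} (x≢y , 3≤) with x ≡ᵇ y | ≡ᵇ-view x y
... | false | _ = ≤⇒≤ᵇ 3≤
... | true  | equal x≡y = x≢y x≡y

neighbours : Quad → ℕ → List ℕ
neighbours q x = filterᵇ (adjacent q x) (upTo 11)

degree : ℕ → ℕ → List Quad → ℕ
degree k x qs = length (filterᵇ (λ q → role q x ≡ᵇ k) qs)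

degree-∷ : ∀ k x q qs → degree k x (q ∷ qs) ≡ bit (role q x ≡ᵇ k) + degree k x qs
degree-∷ k x = length-filterᵇ-∷ (λ q → role q x ≡ᵇ k)

-- The degree of `x` within the block: 3 at a centre, 2 at an end.
weight : ℕ → Quad → ℕ
weight x q = 3 * bit (role q x ≡ᵇ 2) + 2 * bit (role q x ≡ᵇ 1)

count : ℕ → Quad → ℕ
count k q = sum (map (λ x → bit (role q x ≡ᵇ k)) (upTo 11))

all-lookup : ∀ {A : Set} (p : A → Bool) xs → all p xs ≡ true → ∀ {x} → x ∈ xs → T (p x)
all-lookup p xs eq = All.lookup (all⁺ p xs (Equivalence.from T-≡ eq))

private
  weighted : Quad → Bool
  weighted q = all (λ x → length (neighbours q x) ≡ᵇ weight x q) (upTo 11)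

  all-weighted : all weighted quads ≡ true
  all-weighted = refl

  counted : Quad → Bool
  counted q = (count 1 q ≡ᵇ 2) ∧ (count 2 q ≡ᵇ 2)

  all-counted : all counted quads ≡ true
  all-counted = refl

length-neighbours : ∀ {q x} → q ∈ quads → x < 11 → length (neighbours q x) ≡ weight x q
length-neighbours {q} {x} q∈ x< = ≡ᵇ⇒≡ _ _ (all-upTo (λ x → length (neighbours q x) ≡ᵇ weight x q)
  (all-lookup weighted quads all-weighted q∈) x<)

count≡2 : ∀ {q} → q ∈ quads → count 1 q ≡ 2 × count 2 q ≡ 2
count≡2 {q} q∈ = let t₁ , t₂ = Equivalence.to (T-∧ {count 1 q ≡ᵇ 2}) (all-lookup counted quads all-counted q∈)
                 in ≡ᵇ⇒≡ _ 2 t₁ , ≡ᵇ⇒≡ _ 2 t₂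

sum-map-+ : ∀ (f g : ℕ → ℕ) xs → sum (map (λ x → f x + g x) xs) ≡ sum (map f xs) + sum (map g xs)
sum-map-+ f g [] = refl
sum-map-+ f g (x ∷ xs) rewrite sum-map-+ f g xs =
  solve 4 (λ a b c d → (a :+ b) :+ (c :+ d) := (a :+ c) :+ (b :+ d)) refl (f x) (g x) _ _
  where open +-*-Solver

sum-map-* : ∀ k (f : ℕ → ℕ) xs → sum (map (λ x → k * f x) xs) ≡ k * sum (map f xs)
sum-map-* k f [] = sym (*-zeroʳ k)
sum-map-* k f (x ∷ xs) rewrite sum-map-* k f xs = sym (*-distribˡ-+ k (f x) _)

sum-map-cong : ∀ {f g : ℕ → ℕ} {xs} → (∀ {x} → x ∈ xs → f x ≡ g x) → sum (map f xs) ≡ sum (map g xs)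
sum-map-cong {xs = []} h = refl
sum-map-cong {xs = x ∷ xs} h = cong₂ _+_ (h (here refl)) (sum-map-cong (h ∘ there))

-- A total that reaches the maximum allowed by the bound 2 leaves no term any slack.
tight : ∀ {f : ℕ → ℕ} {xs} → (∀ {x} → x ∈ xs → f x ≤ 2) → length xs * 2 ≤ sum (map f xs) → ∀ {x} → x ∈ xs → f x ≡ 2
tight {f} {x ∷ xs} f≤ total (here refl) = ≤-antisym (f≤ (here refl))
  (+-cancelʳ-≤ (length xs * 2) 2 (f x) (≤-trans total (+-monoʳ-≤ (f x) (bounded (f≤ ∘ there)))))
  where
  bounded : ∀ {xs} → (∀ {x} → x ∈ xs → f x ≤ 2) → sum (map f xs) ≤ length xs * 2
  bounded {[]} _ = z≤n
  bounded {x ∷ xs} f≤ = +-mono-≤ (f≤ (here refl)) (bounded (f≤ ∘ there))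
tight {f} {x ∷ xs} f≤ total (there x∈) = tight (f≤ ∘ there)
  (+-cancelˡ-≤ 2 _ _ (≤-trans total (+-monoˡ-≤ _ (f≤ (here refl))))) x∈

-- Double counting of the incidences of role `k`: two in each block.
sum-degree : ∀ k {qs} → All (λ q → count k q ≡ 2) qs → sum (map (λ x → degree k x qs) (upTo 11)) ≡ 2 * length qs
sum-degree k [] = refl
sum-degree k {q ∷ qs} (c ∷ cs) = begin
  sum (map (λ x → degree k x (q ∷ qs)) (upTo 11))
    ≡⟨ sum-map-cong {xs = upTo 11} (λ {x} _ → degree-∷ k x q qs) ⟩
  sum (map (λ x → bit (role q x ≡ᵇ k) + degree k x qs) (upTo 11))
    ≡⟨ sum-map-+ (λ x → bit (role q x ≡ᵇ k)) (λ x → degree k x qs) (upTo 11) ⟩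
  count k q + sum (map (λ x → degree k x qs) (upTo 11))
    ≡⟨ cong₂ _+_ c (sum-degree k cs) ⟩
  2 + 2 * length qs
    ≡⟨ *-suc 2 (length qs) ⟨
  2 * length (q ∷ qs) ∎
  where open ≡-Reasoning

-- Parity rules out p = 3 and size rules out p ≥ 4. The solution p = 0 obeys the bound and is
-- removed later by the total of the degrees, so that p = 2 and r = 2 remain.
even-part : ∀ {p r} → 3 * p + 2 * r ≡ 10 → p ≤ 2 × (p ≡ 2 → r ≡ 2)
even-part {0} _ = z≤n , λ ()
even-part {1} {r} eq = s≤s z≤n , λ ()
even-part {2} {r} eq = ≤-refl , λ _ → *-cancelˡ-≡ r 2 2 (+-cancelˡ-≡ 6 _ _ eq)
even-part {3} {r} eq with r
... | zero = contradiction eq λ ()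
... | suc r rewrite *-suc 2 r = contradiction eq λ ()
even-part {suc (suc (suc (suc p)))} {r} eq = contradiction (subst (12 ≤_) eq
  (≤-trans (*-monoʳ-≤ 3 {4} {4 + p} (m≤m+n 4 p)) (m≤m+n _ (2 * r)))) (<⇒≱ (m≤m+n 11 1))

module _ {qs} (D : Decomposition qs) (qs⊆ : All (_∈ quads) qs) where
  open Decomposition D

  private
    Other : ℕ → Pred ℕ 0ℓ
    Other x y = y < 11 × x ≢ y

    unequalᵇ : ∀ x → (λ y → T (not (x ≡ᵇ y))) ≐ (x ≢_)
    unequalᵇ x = (λ {y} → forwards y) , (λ {y} → backwards y)
      where
      forwards : ∀ y → T (not (x ≡ᵇ y)) → x ≢ y
      forwards y t with x ≡ᵇ y | ≡ᵇ-view x y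
      ... | false | unequal x≢y = x≢y
      backwards : ∀ y → x ≢ y → T (not (x ≡ᵇ y))
      backwards y x≢y with x ≡ᵇ y | ≡ᵇ-view x y
      ... | false | _ = _
      ... | true | equal x≡y = x≢y x≡y

    others : ℕ → List ℕ
    others x = filterᵇ (λ y → not (x ≡ᵇ y)) (upTo 11)

    ten-others : ∀ {x} → x < 11 → length (others x) ≡ 10
    ten-others {x} x< = ≡ᵇ⇒≡ _ 10 (all-upTo (λ x → length (others x) ≡ᵇ 10) {11} _ x<)

    others-card : ∀ x → HasCardinality (Other x) (length (others x))
    others-card x = others x , AllPairsₚ.filter⁺ (T? ∘ λ y → not (x ≡ᵇ y)) (Uniqueₚ.upTo⁺ 11) ,
      (λ y → mk⇔
        (λ y∈ → let y∈′ , t = ∈-filter⁻ (T? ∘ λ y → not (x ≡ᵇ y)) {xs = upTo 11} y∈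
                in ∈-upTo⁻ y∈′ , proj₁ (unequalᵇ x) t)
        (λ (y< , x≢y) → ∈-filter⁺ (T? ∘ λ y → not (x ≡ᵇ y)) (∈-upTo⁺ y<) (proj₂ (unequalᵇ x) x≢y))) ,
      refl

    neighbours-card : ∀ {x} → x < 11 → HasCardinality (Other x) (length (concatMap (λ q → neighbours q x) qs))
    neighbours-card {x} x< = concatMap (λ q → neighbours q x) qs ,
      AllPairsₚ.concat⁺
        (Allₚ.map⁺ (All.universal (λ q → AllPairsₚ.filter⁺ (T? ∘ adjacent q x) (Uniqueₚ.upTo⁺ 11)) qs))
        (AllPairsₚ.map⁺ (AllPairs.map (λ {q} {r} dis → All.tabulate λ {y} y∈ → All.tabulate λ { y∈′ refl →
            dis x y (adjacent⁻ q (proj₂ (∈-filter⁻ (T? ∘ adjacent q x) {xs = upTo 11} y∈)))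
                    (adjacent⁻ r (proj₂ (∈-filter⁻ (T? ∘ adjacent r x) {xs = upTo 11} y∈′))) }) disjoint)) ,
      (λ y → mk⇔
        (λ y∈ → let q , q∈ , y∈q = find (∈-concatMap⁻ (λ q → neighbours q x) {xs = qs} y∈)
                    y∈′ , adj = ∈-filter⁻ (T? ∘ adjacent q x) {xs = upTo 11} y∈q
                in ∈-upTo⁻ y∈′ , proj₁ (adjacent⁻ q adj))
        (λ (y< , x≢y) → let q , q∈ , adj = find (covers x< y< x≢y)
          in ∈-concatMap⁺ (λ q → neighbours q x) {xs = qs} (lose q∈ (∈-filter⁺ (T? ∘ adjacent q x) (∈-upTo⁺ y<) (adjacent⁺ q adj))))) ,
      refl

    length-concatMap-neighbours : ∀ {x} → x < 11 → ∀ {qs} → All (_∈ quads) qs →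
      length (concatMap (λ q → neighbours q x) qs) ≡ 3 * degree 2 x qs + 2 * degree 1 x qs
    length-concatMap-neighbours x< [] = refl
    length-concatMap-neighbours {x} x< {q ∷ qs} (q∈ ∷ qs∈) = begin
      length (neighbours q x ++ concatMap (λ q → neighbours q x) qs)
        ≡⟨ length-++ (neighbours q x) ⟩
      length (neighbours q x) + length (concatMap (λ q → neighbours q x) qs)
        ≡⟨ cong₂ _+_ (length-neighbours q∈ x<) (length-concatMap-neighbours x< qs∈) ⟩
      weight x q + (3 * degree 2 x qs + 2 * degree 1 x qs)
        ≡⟨ solve 4 (λ a b c d → (con 3 :* a :+ con 2 :* b) :+ (con 3 :* c :+ con 2 :* d)
                    := con 3 :* (a :+ c) :+ con 2 :* (b :+ d)) refl
             (bit (role q x ≡ᵇ 2)) (bit (role q x ≡ᵇ 1)) (degree 2 x qs) (degree 1 x qs) ⟩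
      3 * (bit (role q x ≡ᵇ 2) + degree 2 x qs) + 2 * (bit (role q x ≡ᵇ 1) + degree 1 x qs)
        ≡⟨ cong₂ (λ m n → 3 * m + 2 * n) (degree-∷ 2 x q qs) (degree-∷ 1 x q qs) ⟨
      3 * degree 2 x (q ∷ qs) + 2 * degree 1 x (q ∷ qs) ∎
      where
      open ≡-Reasoning
      open +-*-Solver

  -- The neighbours of `x`, collected over the blocks, list the ten other vertices once each,
  -- because the blocks partition the edges.
  valency : ∀ {x} → x < 11 → 3 * degree 2 x qs + 2 * degree 1 x qs ≡ 10
  valency {x} x< = trans (sym (length-concatMap-neighbours x< qs⊆))
    (trans (cardinality-unique (neighbours-card x<) (others-card x)) (ten-others x<))

  private
    ends-total : sum (map (λ x → degree 1 x qs) (upTo 11)) ≡ 2 * length qs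
    ends-total = sum-degree 1 (All.map (proj₁ ∘ count≡2) qs⊆)

    centres-total : sum (map (λ x → degree 2 x qs) (upTo 11)) ≡ 2 * length qs
    centres-total = sum-degree 2 (All.map (proj₂ ∘ count≡2) qs⊆)

  -- Summed over the vertices, `valency` gives 110; each of the n blocks adds 3 * 2 + 2 * 2 = 10 to
  -- that sum.
  length≡11 : length qs ≡ 11
  length≡11 = *-cancelˡ-≡ (length qs) 11 10 (begin
    10 * length qs
      ≡⟨ solve 1 (λ n → con 10 :* n := con 3 :* (con 2 :* n) :+ con 2 :* (con 2 :* n)) refl (length qs) ⟩
    3 * (2 * length qs) + 2 * (2 * length qs)
      ≡⟨ cong₂ (λ m n → 3 * m + 2 * n) centres-total ends-total ⟨
    3 * sum (map (λ x → degree 2 x qs) (upTo 11)) + 2 * sum (map (λ x → degree 1 x qs) (upTo 11))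
      ≡⟨ cong₂ _+_ (sum-map-* 3 (λ x → degree 2 x qs) (upTo 11)) (sum-map-* 2 (λ x → degree 1 x qs) (upTo 11)) ⟨
    sum (map (λ x → 3 * degree 2 x qs) (upTo 11)) + sum (map (λ x → 2 * degree 1 x qs) (upTo 11))
      ≡⟨ sum-map-+ (λ x → 3 * degree 2 x qs) (λ x → 2 * degree 1 x qs) (upTo 11) ⟨
    sum (map (λ x → 3 * degree 2 x qs + 2 * degree 1 x qs) (upTo 11))
      ≡⟨ sum-map-cong {xs = upTo 11} (valency ∘ ∈-upTo⁻) ⟩
    sum (map (λ _ → 10) (upTo 11)) ∎)
    where
    open ≡-Reasoning
    open +-*-Solver

  -- The eleven values are at most 2 by `even-part` and add up to 22.
  centre-degree : ∀ {x} → x < 11 → degree 2 x qs ≡ 2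
  centre-degree x< = tight {λ x → degree 2 x qs} {upTo 11}
    (λ {x} x∈ → proj₁ (even-part {degree 2 x qs} {degree 1 x qs} (valency (∈-upTo⁻ x∈))))
    (≤-reflexive (sym (trans centres-total (cong (2 *_) length≡11)))) (∈-upTo⁺ x<)

  end-degree : ∀ {x} → x < 11 → degree 1 x qs ≡ 2
  end-degree {x} x< = proj₂ (even-part {degree 2 x qs} {degree 1 x qs} (valency x<)) (centre-degree x<)

-- Exact cover

heavy : ℕ → ℕ → ℕ → ℕ → Bool
heavy k l m n = (2 <ᵇ k + l) ∨ (2 <ᵇ k + m) ∨ (2 <ᵇ k + n) ∨ (2 <ᵇ l + m) ∨ (2 <ᵇ l + n)

-- The five sums in `heavy` run over the edges of the second block; a sum above 2 marks an edge that
-- also belongs to the first.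
clash : Quad → Quad → Bool
clash q (quad a b c d) = heavy (role q a) (role q b) (role q c) (role q d)

clash⇒¬Disjoint : ∀ q r → Proper r → T (clash q r) → ¬ Disjoint q r
clash⇒¬Disjoint q (quad a b c d) p t dis =
  [ h (a≢b p) (a-b p) , [ h (a≢c p) (a-c p) , [ h (a≢d p) (a-d p) , [ h (b≢c p) (b-c p) , h (b≢d p) (b-d p) ]′
    ∘ Equivalence.to (T-∨ {2 <ᵇ role q b + role q c}) ]′
    ∘ Equivalence.to (T-∨ {2 <ᵇ role q a + role q d}) ]′
    ∘ Equivalence.to (T-∨ {2 <ᵇ role q a + role q c}) ]′
    (Equivalence.to (T-∨ {2 <ᵇ role q a + role q b}) t)
  where
  h : ∀ {x y} → x ≢ y → Adj (quad a b c d) x y → ¬ T (2 <ᵇ role q x + role q y)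
  h x≢y adj t = dis _ _ (x≢y , <ᵇ⇒< 2 _ t) adj

-- Every vertex is a centre twice and an end twice, so two chosen blocks exhaust a role of a vertex.
-- Only the corners of the block just added can newly reach this state.
saturated : Quad → List Quad → List (ℕ × ℕ)
saturated q qs = filterᵇ (λ (x , k) → 2 ≤ᵇ degree k x qs) (map (λ x → x , role q x) (corners q))

plays : Quad → ℕ × ℕ → Bool
plays q (x , k) = role q x ≡ᵇ k

compatible : Quad → List (ℕ × ℕ) → Quad → Bool
compatible q xs r = not (clash q r ∨ any (plays r) xs)

survivors : Quad → List Quad → List Quad → List Quad
survivors q qs = filterᵇ (compatible q (saturated q qs))

-- The list chosen holds the blocks fixed so far, available those that may still occur.
-- Each goal is a property which some block of the decomposition must have.
search : (List Quad → Bool) → List (Quad → Bool) → List Quad → List Quad → Bool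
search leaf []           chosen available = leaf chosen
search leaf (goal ∷ goals) chosen available =
  if any goal chosen then search leaf goals chosen available
  else all (λ q → search leaf goals (q ∷ chosen) (survivors q (q ∷ chosen) available)) (filterᵇ goal available)

degree-++ : ∀ k x qs rs → degree k x (qs ++ rs) ≡ degree k x qs + degree k x rs
degree-++ k x qs rs = trans (cong length (filter-++ (T? ∘ λ q → role q x ≡ᵇ k) qs rs))
                            (length-++ (filterᵇ (λ q → role q x ≡ᵇ k) qs))

degree-↭ : ∀ k x {qs rs} → qs ↭ rs → degree k x qs ≡ degree k x rs
degree-↭ k x p = ↭-length (filter-↭ (T? ∘ λ q → role q x ≡ᵇ k) p)

degree-∈ : ∀ k x {q qs} → q ∈ qs → role q x ≡ k → 1 ≤ degree k x qs
degree-∈ k x {q} {qs} q∈ eq with filterᵇ (λ q → role q x ≡ᵇ k) qs | ∈-filter⁺ (T? ∘ λ q → role q x ≡ᵇ k) q∈ (≡⇒≡ᵇ _ k eq)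
... | _ ∷ _ | _ = s≤s z≤n

corner-role : ∀ q {x} → Proper q → x ∈ corners q → role q x ≡ 1 ⊎ role q x ≡ 2
corner-role (quad a b c d) p (here refl) = inj₂ (role-centre₁ p)
corner-role (quad a b c d) p (there (here refl)) = inj₂ (role-centre₂ p)
corner-role (quad a b c d) p (there (there (here refl))) = inj₁ (role-end₁ p)
corner-role (quad a b c d) p (there (there (there (here refl)))) = inj₁ (role-end₂ p)

module _ {qs} (D : Decomposition qs) (qs⊆ : All (_∈ quads) qs) (leaf : List Quad → Bool) where
  open Decomposition D

  -- The invariant that ties the search to a decomposition which the search does not see: the chosen
  -- blocks belong to it, and its other blocks are all still available.
  record State (chosen available : List Quad) : Set where
    constructor state
    field
      rest    : List Quad
      split   : qs ↭ chosen ++ rest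
      allowed : All (_∈ available) rest

  private
    initial : State [] quads
    initial = state qs ↭-refl qs⊆

    degree≡2 : ∀ {q x} → Proper q → x ∈ corners q → degree (role q x) x qs ≡ 2
    degree≡2 {q} {x} p@(p< , _) x∈ with role q x | corner-role q p x∈
    ... | _ | inj₁ refl = end-degree D qs⊆ (All.lookup p< x∈)
    ... | _ | inj₂ refl = centre-degree D qs⊆ (All.lookup p< x∈)

    -- No other block of the decomposition is filtered out: it has no edge in common with `q`, and
    -- it cannot use a role of a vertex that two chosen blocks have exhausted.
    choose : ∀ {q chosen available} → State chosen available → q ∈ qs → ¬ q ∈ chosen →
             State (q ∷ chosen) (survivors q (q ∷ chosen) available) × q ∈ available
    choose {q} {chosen} {available} (state rest split allowed) q∈ q∉ with ∈-++⁻ chosen (∈-resp-↭ split q∈)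
    ... | inj₁ q∈chosen = contradiction q∈chosen q∉
    ... | inj₂ q∈rest with ys , zs , refl ← ∈-∃++ q∈rest =
      state (ys ++ zs) split′ (All.tabulate survives) , All.lookup allowed q∈rest
      where
      split′ : qs ↭ q ∷ chosen ++ (ys ++ zs)
      split′ = ↭-trans split (↭-trans (++⁺ˡ chosen (shift q ys zs)) (shift q chosen (ys ++ zs)))
      separated : AllPairs Disjoint (q ∷ chosen ++ (ys ++ zs))
      separated = SetoidPerm.AllPairs-resp-↭ (setoid Quad) (λ dis x y aq ar → dis x y ar aq)
        ((λ { refl → id }) , (λ { refl → id })) (↭⇒↭ₛ split′) disjoint
      survives : ∀ {r} → r ∈ ys ++ zs → r ∈ survivors q (q ∷ chosen) available
      survives {r} r∈ = ∈-filter⁺ (T? ∘ compatible q (saturated q (q ∷ chosen))) (All.lookup allowed r∈rest)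
        (compat (compatible q (saturated q (q ∷ chosen)) r) refl)
        where
        r∈rest : r ∈ ys ++ q ∷ zs
        r∈rest = [ ∈-++⁺ˡ , ∈-++⁺ʳ ys ∘ there ]′ (∈-++⁻ ys r∈)
        r∈qs : r ∈ qs
        r∈qs = ∈-resp-↭ (↭-sym split) (∈-++⁺ʳ chosen r∈rest)
        disjoint-r : Disjoint q r
        disjoint-r with dis ∷ _ ← separated = All.lookup dis (∈-++⁺ʳ chosen r∈)
        unsaturated : ¬ T (any (plays r) (saturated q (q ∷ chosen)))
        unsaturated t
          with (x , k) , xk∈ , rk ← find (any⁻ (plays r) (saturated q (q ∷ chosen)) t)
          with xk∈′ , 2≤ ← ∈-filter⁻ (T? ∘ λ (x , k) → 2 ≤ᵇ degree k x (q ∷ chosen)) {xs = map (λ x → x , role q x) (corners q)} xk∈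
          with x , x∈ , refl ← ∈-map⁻ (λ x → x , role q x) xk∈′ =
          -- Two chosen blocks and `r` would give `x` the same role three times.
          contradiction (begin
            3
              ≤⟨ +-mono-≤ (≤ᵇ⇒≤ 2 _ 2≤) (degree-∈ (role q x) x r∈ (≡ᵇ⇒≡ _ _ rk)) ⟩
            degree (role q x) x (q ∷ chosen) + degree (role q x) x (ys ++ zs)
              ≡⟨ degree-++ (role q x) x (q ∷ chosen) (ys ++ zs) ⟨
            degree (role q x) x (q ∷ chosen ++ (ys ++ zs))
              ≡⟨ degree-↭ (role q x) x split′ ⟨
            degree (role q x) x qs
              ≡⟨ degree≡2 (All.lookup proper q∈) x∈ ⟩
            2 ∎) λ { (s≤s (s≤s ())) }
          where open ≤-Reasoning
        compat : ∀ b → compatible q (saturated q (q ∷ chosen)) r ≡ b → T b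
        compat true _ = _
        compat false eq with Equivalence.to (T-∨ {clash q r}) (notfalse eq)
          where
          notfalse : ∀ {b} → not b ≡ false → T b
          notfalse {true} _ = _
        ... | inj₁ t = clash⇒¬Disjoint q r (All.lookup proper r∈qs) t disjoint-r
        ... | inj₂ t = unsaturated t

  private
    -- The search succeeds on all branches; the decomposition selects one. Where no chosen block
    -- meets the goal, one of its own blocks does, and by the invariant that block is among the
    -- branches.
    run : ∀ goals {chosen available} → State chosen available →
          (∀ {goal} → goal ∈ goals → ∃ λ q → q ∈ qs × T (goal q)) →
          T (search leaf goals chosen available) → ∃ λ chosen → (∀ {q} → q ∈ chosen → q ∈ qs) × T (leaf chosen)
    run [] {chosen} (state rest split _) _ t = chosen , ∈-resp-↭ (↭-sym split) ∘ ∈-++⁺ˡ , t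
    run (goal ∷ goals) {chosen} {available} st met t with any goal chosen in eq
    ... | true = run goals st (met ∘ there) t
    ... | false with q , q∈ , g ← met (here refl)
      with st′ , q∈av ← choose st q∈ (λ q∈ → subst T eq (any⁺ goal (lose q∈ g))) =
      run goals st′ (met ∘ there) (All.lookup (all⁺ _ (filterᵇ goal available) t) (∈-filter⁺ (T? ∘ goal) q∈av g))

  search-sound : ∀ goals → (∀ {goal} → goal ∈ goals → ∃ λ q → q ∈ qs × T (goal q)) →
                 search leaf goals [] quads ≡ true → ∃ λ chosen → (∀ {q} → q ∈ chosen → q ∈ qs) × T (leaf chosen)
  search-sound goals met eq = run goals initial met (Equivalence.from T-≡ eq)

-- Classification

cyclic : ℕ → List Quad
cyclic k = map (λ i → quad (i % 11) ((1 + i) % 11) ((3 + i) % 11) ((k + i) % 11)) (upTo 11)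

plays-all : List (ℕ × ℕ) → Quad → Bool
plays-all xs q = all (plays q) xs

-- The vertices are named after the blocks [ 0 , 1 , 6 - 7 ], [ 0 , 2 , 8 - 9 ], [ 3 , 5 , 0 - _ ] and
-- [ 4 , 10 , 0 - _ ] at the vertex 0; this order of the names keeps the search small.
goals : List (Quad → Bool)
goals =
  plays-all ((0 , 2) ∷ (1 , 2) ∷ (6 , 1) ∷ (7 , 1) ∷ []) ∷
  plays-all ((0 , 2) ∷ (2 , 2) ∷ (8 , 1) ∷ (9 , 1) ∷ []) ∷
  plays-all ((3 , 2) ∷ (5 , 2) ∷ (0 , 1) ∷ []) ∷
  plays-all ((4 , 2) ∷ (10 , 2) ∷ (0 , 1) ∷ []) ∷
  map (λ (i , j) q → adjacent q i j) pairs

otherCentre : Quad → ℕ → ℕ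
otherCentre (quad a b _ _) x = if x ≡ᵇ a then b else a

-- The next vertex along the central edges, without turning back. The default 0 is already on the
-- walk, so a candidate containing it fails `isEnumeration`.
next : List Quad → ℕ → ℕ → ℕ
next []       _    _   = 0
next (q ∷ qs) prev cur =
  if plays q (cur , 2) ∧ not (plays q (prev , 2)) then otherCentre q cur else next qs prev cur

walk : ℕ → List Quad → ℕ → ℕ → List ℕ
walk zero    qs prev cur = []
walk (suc n) qs prev cur = cur ∷ walk n qs cur (next qs prev cur)

reproduces : List Quad → List ℕ → Quad → Bool
reproduces qs vs x = occurs qs (rename (nth vs) x)

-- The last conjunct asks that the block at i = 0 go to the block from which the naming started; it
-- is what later aligns two designs along a shared block.
matches : List Quad → ℕ → List ℕ → Bool
matches qs k vs = isEnumeration vs ∧ all (reproduces qs vs) (cyclic k)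
                ∧ same (quad 0 1 6 7) (rename (nth vs) (quad 0 1 3 k))

-- In cyclic k the central edges form an 11-cycle, so an isomorphism is found by following central edges.
candidates : List Quad → List (List ℕ)
candidates qs = (0 ∷ walk 10 qs 0 1) ∷ (1 ∷ walk 10 qs 1 0) ∷ []

resembles : List Quad → ℕ → Bool
resembles qs k = any (matches qs k) (candidates qs)

isCyclic : List Quad → Bool
isCyclic qs = any (resembles qs) (5 ∷ 7 ∷ [])

-- Since `goals` ends with one goal for each of the 55 edges, every leaf that is reached covers all
-- of them.
exhaustion : search isCyclic goals [] quads ≡ true
exhaustion = refl

module _ {A : Set} where
  pair-of : ∀ {xs : List A} {x} → length xs ≡ 2 → x ∈ xs → ∃ λ y → y ∈ xs × (∀ {z} → z ∈ xs → z ≡ x ⊎ z ≡ y)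
  pair-of {x ∷ y ∷ []} refl (here refl) = y , there (here refl) ,
    λ { (here refl) → inj₁ refl ; (there (here refl)) → inj₂ refl }
  pair-of {x ∷ y ∷ []} refl (there (here refl)) = x , here refl ,
    λ { (here refl) → inj₂ refl ; (there (here refl)) → inj₁ refl }

  both-of : ∀ {xs : List A} → length xs ≡ 2 → ∃₂ λ x y → x ∈ xs × y ∈ xs × (∀ {z} → z ∈ xs → z ≡ x ⊎ z ≡ y)
  both-of {x ∷ y ∷ []} refl = x , y , here refl , there (here refl) ,
    λ { (here refl) → inj₁ refl ; (there (here refl)) → inj₂ refl }

role-of-neighbour : ∀ q {x y} → Adj q x y → role q x ≡ 2 ⊎ (role q x ≡ 1 × role q y ≡ 2)
role-of-neighbour q {x} {y} (_ , 3≤) = go (role≤2 q x) (role≤2 q y) 3≤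
  where
  go : ∀ {m n} → m ≤ 2 → n ≤ 2 → 3 ≤ m + n → m ≡ 2 ⊎ (m ≡ 1 × n ≡ 2)
  go {0} _ n≤2 3≤ = contradiction (≤-trans 3≤ n≤2) λ { (s≤s (s≤s ())) }
  go {1} {0} _ _ (s≤s ())
  go {1} {1} _ _ (s≤s (s≤s ()))
  go {1} {2} _ _ _ = inj₂ (refl , refl)
  go {1} {suc (suc (suc _))} _ (s≤s (s≤s ()))
  go {2} _ _ _ = inj₁ refl
  go {suc (suc (suc _))} (s≤s (s≤s ()))

record Centred (q : Quad) (x : ℕ) : Set where
  field
    {y e f} : ℕ
    y< : y < 11
    e< : e < 11
    f< : f < 11
    roles : Same q x y e f
    reach : ∀ {z} → Adj q x z → z ∈ y ∷ e ∷ f ∷ []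

centred : ∀ q {x} → Proper q → role q x ≡ 2 → Centred q x
centred (quad a b c d) {x} p@((a< ∷ b< ∷ c< ∷ d< ∷ []) , _) r with viewAs {a} {b} {c} {d} {x} r
... | centre₁ refl = record
  { y< = b< ; e< = c< ; f< = d<
  ; roles = mkSame r (role-centre₂ p) (role-end₁ p) (role-end₂ p)
  ; reach = λ adj → go adj (Adj⇒corner (Adj-sym (quad a b c d) adj)) }
  where
  go : ∀ {z} → Adj (quad a b c d) a z → z ∈ a ∷ b ∷ c ∷ d ∷ [] → z ∈ b ∷ c ∷ d ∷ []
  go (a≢z , _) (here refl) = contradiction refl a≢z
  go _ (there z∈) = z∈
... | centre₂ refl = record
  { y< = a< ; e< = c< ; f< = d<
  ; roles = mkSame r (role-centre₁ p) (role-end₁ p) (role-end₂ p)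
  ; reach = λ adj → go adj (Adj⇒corner (Adj-sym (quad a b c d) adj)) }
  where
  go : ∀ {z} → Adj (quad a b c d) b z → z ∈ a ∷ b ∷ c ∷ d ∷ [] → z ∈ a ∷ c ∷ d ∷ []
  go _ (here z≡a) = here z≡a
  go (b≢z , _) (there (here refl)) = contradiction refl b≢z
  go _ (there (there z∈)) = there z∈

record Ended (q : Quad) (x : ℕ) : Set where
  field
    {g h} : ℕ
    g< : g < 11
    h< : h < 11
    rg : role q g ≡ 2
    rh : role q h ≡ 2
    reach : ∀ {z} → Adj q x z → z ∈ g ∷ h ∷ []

ended : ∀ q {x} → Proper q → role q x ≡ 1 → Ended q x
ended q@(quad a b c d) {x} p@((a< ∷ b< ∷ c< ∷ d< ∷ []) , _) r = record
  { g< = a< ; h< = b< ; rg = role-centre₁ p ; rh = role-centre₂ p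
  ; reach = λ {z} adj → go (viewAs {a} {b} {c} {d} {z} (centre adj)) }
  where
  centre : ∀ {z} → Adj q x z → role q z ≡ 2
  centre adj = [ (λ r′ → contradiction (trans (sym r) r′) λ ()) , proj₂ ]′ (role-of-neighbour q adj)
  go : ∀ {z} → Role a b c d z 2 → z ∈ a ∷ b ∷ []
  go (centre₁ z≡a) = here z≡a
  go (centre₂ z≡b) = there (here z≡b)

plays-all⁺ : ∀ q xs → All (λ (x , k) → role q x ≡ k) xs → T (plays-all xs q)
plays-all⁺ q xs h = Allₚ.all⁻ (plays q) (All.map (λ {(x , k)} → ≡⇒≡ᵇ (role q x) k) h)

properᵇ : Quad → Bool
properᵇ (quad a b c d) = all (_<ᵇ 11) (corners (quad a b c d)) ∧
  not ((a ≡ᵇ b) ∨ (a ≡ᵇ c) ∨ (a ≡ᵇ d) ∨ (b ≡ᵇ c) ∨ (b ≡ᵇ d) ∨ (c ≡ᵇ d))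

properᵇ⁻ : ∀ {q} → T (properᵇ q) → Proper q
properᵇ⁻ {q@(quad a b c d)} t =
  All.map (λ {n} → <ᵇ⇒< n 11) (all⁺ (_<ᵇ 11) (corners q) (proj₁ t′)) , apart (proj₂ t′)
  where
  t′ = Equivalence.to (T-∧ {all (_<ᵇ 11) (corners q)}) t
  apart : T (not ((a ≡ᵇ b) ∨ (a ≡ᵇ c) ∨ (a ≡ᵇ d) ∨ (b ≡ᵇ c) ∨ (b ≡ᵇ d) ∨ (c ≡ᵇ d))) → Unique (corners q)
  apart t with a ≡ᵇ b | ≡ᵇ-view a b | a ≡ᵇ c | ≡ᵇ-view a c | a ≡ᵇ d | ≡ᵇ-view a d
             | b ≡ᵇ c | ≡ᵇ-view b c | b ≡ᵇ d | ≡ᵇ-view b d | c ≡ᵇ d | ≡ᵇ-view c d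
  ... | false | unequal ≢₁ | false | unequal ≢₂ | false | unequal ≢₃ | false | unequal ≢₄ | false | unequal ≢₅ | false | unequal ≢₆ =
    (≢₁ ∷ ≢₂ ∷ ≢₃ ∷ []) ∷ (≢₄ ∷ ≢₅ ∷ []) ∷ (≢₆ ∷ []) ∷ [] ∷ []

cyclic-proper : ∀ {k x} → k ∈ 5 ∷ 7 ∷ [] → x ∈ cyclic k → Proper x
cyclic-proper (here refl) x∈ = properᵇ⁻ (all-lookup properᵇ (cyclic 5) refl x∈)
cyclic-proper (there (here refl)) x∈ = properᵇ⁻ (all-lookup properᵇ (cyclic 7) refl x∈)

head∈ : ∀ {k} → k ∈ 5 ∷ 7 ∷ [] → quad 0 1 3 k ∈ cyclic k
head∈ (here refl) = here refl
head∈ (there (here refl)) = here refl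

isCyclic⁻ : ∀ qs → T (isCyclic qs) → ∃₂ λ k vs → k ∈ 5 ∷ 7 ∷ [] × T (isEnumeration vs) ×
            (∀ {x} → x ∈ cyclic k → T (reproduces qs vs x)) ×
            T (same (quad 0 1 6 7) (rename (nth vs) (quad 0 1 3 k)))
isCyclic⁻ qs t =
  let k , k∈ , t₁ = find (any⁻ (resembles qs) (5 ∷ 7 ∷ []) t)
      vs , _ , t₂ = find (any⁻ (matches qs k) (candidates qs) t₁)
      enum , t₃ = Equivalence.to (T-∧ {isEnumeration vs}) t₂
      occ , thr = Equivalence.to (T-∧ {all (reproduces qs vs) (cyclic k)}) t₃
  in k , vs , k∈ , enum , All.lookup (all⁺ (reproduces qs vs) (cyclic k) occ) , thr

-- Only one inclusion between the sets of blocks is recorded; `cyclic-represents` derives the other.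
record CyclicThrough (qs : List Quad) (q : Quad) : Set where
  field
    k   : ℕ
    k∈  : k ∈ 5 ∷ 7 ∷ []
    σ   : Perm
    occ : ∀ {x} → x ∈ cyclic k → T (occurs qs (rename (σ .to) x))
    thr : T (same q (rename (σ .to) (quad 0 1 3 k)))

module Star {qs} (D : Decomposition qs) (qs⊆ : All (_∈ quads) qs) {a b c d u v w}
  (q∈ : quad a b c d ∈ qs)
  (u∈ : u ∈ qs) (U : Centred u a)
  (v∈ : v ∈ qs) (rv : role v a ≡ 1) (V : Ended v a)
  (w∈ : w ∈ qs) (rw : role w a ≡ 1) (W : Ended w a)
  (only : ∀ {r n} → r ∈ qs → Adj r a n → r ∈ quad a b c d ∷ u ∷ v ∷ w ∷ [])
  where
  open Decomposition D
  private
    module U = Centred U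
    module V = Ended V
    module W = Ended W
    q = quad a b c d
    p = All.lookup proper q∈
    a<′ : a < 11
    a<′ = All.lookup (proj₁ p) (here refl)

    -- The vertex `a` has degrees 3, 3, 2, 2 in its four blocks, which accounts for the ten other
    -- vertices. The positions are those prescribed by the first four members of `goals`.
    names : List ℕ
    names = a ∷ b ∷ U.y ∷ V.g ∷ W.g ∷ V.h ∷ c ∷ d ∷ U.e ∷ U.f ∷ W.h ∷ []

    names< : All (_< 11) names
    names< with a< ∷ b< ∷ c< ∷ d< ∷ [] ← proj₁ p =
      a< ∷ b< ∷ U.y< ∷ V.g< ∷ W.g< ∷ V.h< ∷ c< ∷ d< ∷ U.e< ∷ U.f< ∷ W.h< ∷ []

    inQ : ∀ {n} → n ∈ b ∷ c ∷ d ∷ [] → n ∈ names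
    inQ (here e) = there (here e)
    inQ (there (here e)) = there (there (there (there (there (there (here e))))))
    inQ (there (there (here e))) = there (there (there (there (there (there (there (here e)))))))
    inU : ∀ {n} → n ∈ U.y ∷ U.e ∷ U.f ∷ [] → n ∈ names
    inU (here e) = there (there (here e))
    inU (there (here e)) = there (there (there (there (there (there (there (there (here e))))))))
    inU (there (there (here e))) = there (there (there (there (there (there (there (there (there (here e)))))))))
    inV : ∀ {n} → n ∈ V.g ∷ V.h ∷ [] → n ∈ names
    inV (here e) = there (there (there (here e)))
    inV (there (here e)) = there (there (there (there (there (here e)))))
    inW : ∀ {n} → n ∈ W.g ∷ W.h ∷ [] → n ∈ names
    inW (here e) = there (there (there (there (here e))))
    inW (there (here e)) = there (there (there (there (there (there (there (there (there (there (here e))))))))))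
    q-reach : ∀ {n} → Adj q a n → n ∈ b ∷ c ∷ d ∷ []
    q-reach adj@(a≢n , _) with Adj⇒corner (Adj-sym q adj)
    ... | here refl = contradiction refl a≢n
    ... | there n∈ = n∈

    complete : ∀ {n} → n < 11 → n ∈ names
    complete {n} n< with a ≟ n
    ... | yes refl = here refl
    ... | no a≢n with r , r∈ , adj ← find (covers a<′ n< a≢n) with only r∈ adj
    ... | here refl = inQ (q-reach adj)
    ... | there (here refl) = inU (U.reach adj)
    ... | there (there (here refl)) = inV (V.reach adj)
    ... | there (there (there (here refl))) = inW (W.reach adj)

    ν : Perm
    ν = enumeration names refl names< complete

    image : Quad → Quad
    image r = canonical (rename (ν .from) r)

    -- Renaming may disturb the order of centres and ends, hence the second passage to canonical
    -- names, over which the search runs.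
    qs′ : List Quad
    qs′ = map canonical (map (rename (ν .from)) qs)

    D′ : Decomposition qs′
    D′ = canonical-decomposition (rename-decomposition (inverse ν) D)

    qs′⊆ : All (_∈ quads) qs′
    qs′⊆ = Allₚ.map⁺ (All.map canonical∈quads (Decomposition.proper (rename-decomposition (inverse ν) D)))

    image∈ : ∀ {r} → r ∈ qs → image r ∈ qs′
    image∈ r∈ = ∈-map⁺ canonical (∈-map⁺ (rename (ν .from)) r∈)

    image-role : ∀ {r n} → r ∈ qs → n < 11 → role (image r) n ≡ role r (nth names n)
    image-role {r} {n} r∈ n< = trans (canonical-role (rename (ν .from) r) n) (rename-role′ (inverse ν) (All.lookup proper r∈) n<)

    assign : ∀ {r} → r ∈ qs → ∀ xs → All (λ (n , k) → n < 11 × role r (nth names n) ≡ k) xs →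
             ∃ λ s → s ∈ qs′ × T (plays-all xs s)
    assign {r} r∈ xs h = image r , image∈ r∈ , plays-all⁺ (image r) xs (All.map (λ (n< , eq) → trans (image-role r∈ n<) eq) h)

    lt : ∀ {m} → {t : T (m <ᵇ 11)} → m < 11
    lt {m} {t} = <ᵇ⇒< m 11 t

    met : ∀ {goal} → goal ∈ goals → ∃ λ s → s ∈ qs′ × T (goal s)
    met (here refl) = assign q∈ _
      ((lt , role-centre₁ p) ∷ (lt , role-centre₂ p) ∷ (lt , role-end₁ p) ∷ (lt , role-end₂ p) ∷ [])
    met (there (here refl)) = assign u∈ _
      ((lt , Same.ca U.roles) ∷ (lt , Same.cb U.roles) ∷ (lt , Same.ec U.roles) ∷ (lt , Same.ed U.roles) ∷ [])
    met (there (there (here refl))) = assign v∈ _ ((lt , V.rg) ∷ (lt , V.rh) ∷ (lt , rv) ∷ [])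
    met (there (there (there (here refl)))) = assign w∈ _ ((lt , W.rg) ∷ (lt , W.rh) ∷ (lt , rw) ∷ [])
    met (there (there (there (there goal∈)))) with (i , j) , ij∈ , refl ← ∈-map⁻ (λ (i , j) q → adjacent q i j) {xs = pairs} goal∈
      with ij∈′ , i<j ← ∈-filter⁻ (T? ∘ λ (i , j) → i <ᵇ j) {xs = cartesianProduct (upTo 11) (upTo 11)} ij∈
      with i∈ , j∈ ← ∈-cartesianProduct⁻ (upTo 11) (upTo 11) ij∈′
      with s , s∈ , adj ← find (Decomposition.covers D′ (∈-upTo⁻ i∈) (∈-upTo⁻ j∈) (<⇒≢ (<ᵇ⇒< i j i<j))) =
      s , s∈ , adjacent⁺ s adj

    -- Undoes the naming: `s` is the block `r` seen through `names`, so an isomorphism onto named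
    -- blocks is composed with `ν`.
    pull : ∀ {r s x} → r ∈ qs → (∀ {n} → n < 11 → role s n ≡ role r (nth names n)) → Proper x →
           (τ : Perm) → T (same s (rename (τ .to) x)) → T (same r (rename ((ν ⊙ τ) .to) x))
    pull {r} {s} {quad a b c d} r∈ eq ((a< ∷ b< ∷ c< ∷ d< ∷ []) , _) τ t
      with mkSame ra rb rc rd ← same⁻ s {τ .to a} {τ .to b} {τ .to c} {τ .to d} t =
      same⁺ r (mkSame (trans (sym (eq (τ .to< a<))) ra) (trans (sym (eq (τ .to< b<))) rb)
                      (trans (sym (eq (τ .to< c<))) rc) (trans (sym (eq (τ .to< d<))) rd))

    unimage : ∀ {s} → s ∈ qs′ → ∃ λ r → r ∈ qs × s ≡ image r
    unimage s∈ with r′ , r′∈ , refl ← ∈-map⁻ canonical s∈ with r , r∈ , refl ← ∈-map⁻ (rename (ν .from)) r′∈ = r , r∈ , refl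

    -- The leaf test mentions the literal block `quad 0 1 6 7`, which `ν` takes to `q` by the choice
    -- of `names`.
    q-roles : ∀ {n} → n < 11 → role (quad 0 1 6 7) n ≡ role q (nth names n)
    q-roles n< = sym (rename-role ν {quad 0 1 6 7} (properᵇ⁻ _) n<)

    extract : (∃ λ chosen → (∀ {s} → s ∈ chosen → s ∈ qs′) × T (isCyclic chosen)) → CyclicThrough qs q
    extract (chosen , chosen⊆ , t) = let k , vs , k∈ , enum , occ , thr = isCyclic⁻ chosen t in record
      { k = k ; k∈ = k∈ ; σ = ν ⊙ enumerated vs enum
      ; occ = λ {x} x∈ → pulled k∈ x∈ vs enum (occ x∈)
      ; thr = pull q∈ q-roles (cyclic-proper k∈ (head∈ k∈)) (enumerated vs enum) thr
      }
      where
      pulled : ∀ {k x} → k ∈ 5 ∷ 7 ∷ [] → x ∈ cyclic k → ∀ vs (enum : T (isEnumeration vs)) →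
               T (reproduces chosen vs x) → T (occurs qs (rename (nth names ∘ nth vs) x))
      pulled {k} {x} k∈ x∈ vs enum t =
        let s , s∈ , t′ = find (any⁻ (λ s → same s (rename (nth vs) x)) chosen t)
            r , r∈ , s≡ = unimage (chosen⊆ s∈)
        in any⁺ (λ r → same r (rename (nth names ∘ nth vs) x))
             (lose r∈ (pull {r} {image r} {x} r∈ (image-role r∈) (cyclic-proper k∈ x∈) (enumerated vs enum)
               (subst (λ s → T (same s (rename (nth vs) x))) s≡ t′)))

  classified : CyclicThrough qs q
  classified = extract (search-sound D′ qs′⊆ isCyclic goals met exhaustion)

module _ {qs} (D : Decomposition qs) (qs⊆ : All (_∈ quads) qs) {a b c d} (q∈ : quad a b c d ∈ qs) where
  open Decomposition D

  private
    q = quad a b c d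
    p = All.lookup proper q∈
    a<′ : a < 11
    a<′ = All.lookup (proj₁ p) (here refl)

    playing : ℕ → List Quad
    playing k = filterᵇ (λ q → role q a ≡ᵇ k) qs

    ∈-playing : ∀ {k r} → r ∈ qs → role r a ≡ k → r ∈ playing k
    ∈-playing {k} r∈ eq = ∈-filter⁺ (T? ∘ λ q → role q a ≡ᵇ k) r∈ (≡⇒≡ᵇ _ k eq)

    playing-∈ : ∀ {k r} → r ∈ playing k → r ∈ qs × role r a ≡ k
    playing-∈ {k} r∈ = let r∈qs , t = ∈-filter⁻ (T? ∘ λ q → role q a ≡ᵇ k) {xs = qs} r∈ in r∈qs , ≡ᵇ⇒≡ _ k t

    second : ∃ λ u → u ∈ playing 2 × (∀ {r} → r ∈ playing 2 → r ≡ q ⊎ r ≡ u)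
    second = pair-of (centre-degree D qs⊆ a<′) (∈-playing q∈ (role-centre₁ p))

    as-end : ∃₂ λ v w → v ∈ playing 1 × w ∈ playing 1 × (∀ {r} → r ∈ playing 1 → r ≡ v ⊎ r ≡ w)
    as-end = both-of (end-degree D qs⊆ a<′)

    u v w : Quad
    u = proj₁ second
    v = proj₁ as-end
    w = proj₁ (proj₂ as-end)

    u∈ : u ∈ qs × role u a ≡ 2
    u∈ = playing-∈ (proj₁ (proj₂ second))

    v∈ : v ∈ qs × role v a ≡ 1
    v∈ = playing-∈ (proj₁ (proj₂ (proj₂ as-end)))

    w∈ : w ∈ qs × role w a ≡ 1
    w∈ = playing-∈ (proj₁ (proj₂ (proj₂ (proj₂ as-end))))

    only : ∀ {r n} → r ∈ qs → Adj r a n → r ∈ q ∷ u ∷ v ∷ w ∷ []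
    only {r} r∈ adj =
      [ (λ eq → [ here , there ∘ here ]′ (proj₂ (proj₂ second) (∈-playing r∈ eq)))
      , (λ (eq , _) → [ there ∘ there ∘ here , there ∘ there ∘ there ∘ here ]′
          (proj₂ (proj₂ (proj₂ (proj₂ as-end))) (∈-playing r∈ eq))) ]′ (role-of-neighbour r adj)

  -- By the degrees, exactly four blocks meet `a`: `q` and `u` have it as a centre, `v` and `w` as
  -- an end.
  cyclic-through : CyclicThrough qs q
  cyclic-through = Star.classified D qs⊆ q∈
    (proj₁ u∈) (centred u {a} (All.lookup proper (proj₁ u∈)) (proj₂ u∈))
    (proj₁ v∈) (proj₂ v∈) (ended v {a} (All.lookup proper (proj₁ v∈)) (proj₂ v∈))
    (proj₁ w∈) (proj₂ w∈) (ended w {a} (All.lookup proper (proj₁ w∈)) (proj₂ w∈))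
    only

uncanonical : ∀ {qs q} → CyclicThrough (map canonical qs) (canonical q) → CyclicThrough qs q
uncanonical {qs} {q} through = record
  { k = k ; k∈ = k∈ ; σ = σ
  ; occ = λ {x} x∈ →
      let s , s∈ , t = find (any⁻ (λ s → same s (rename (σ .to) x)) (map canonical qs) (occ x∈))
          r , r∈ , s≡ = ∈-map⁻ canonical s∈
      in any⁺ (λ r → same r (rename (σ .to) x))
           (lose r∈ (same-canonical r (rename (σ .to) x) (subst (λ s → T (same s (rename (σ .to) x))) s≡ t)))
  ; thr = same-canonical q (rename (σ .to) (quad 0 1 3 k)) thr
  }
  where
  open CyclicThrough through
  same-canonical : ∀ r s → T (same (canonical r) s) → T (same r s)
  same-canonical r (quad a b c d) t with mkSame ra rb rc rd ← same⁻ (canonical r) {a} {b} {c} {d} t =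
    same⁺ r (mkSame (trans (sym (canonical-role r a)) ra) (trans (sym (canonical-role r b)) rb)
                    (trans (sym (canonical-role r c)) rc) (trans (sym (canonical-role r d)) rd))

classification : ∀ {qs q} → Decomposition qs → q ∈ qs → CyclicThrough qs q
classification {q = quad a b c d} D q∈ = uncanonical (cyclic-through (canonical-decomposition D)
  (Allₚ.map⁺ (All.map canonical∈quads (Decomposition.proper D))) (∈-map⁺ canonical q∈))

-- The cyclic lists as decompositions

coverage : List Quad → ℕ → ℕ → Bool
coverage qs x y = (x ≡ᵇ y) ∨ (length (filterᵇ (λ q → adjacent q x y) qs) ≡ᵇ 1)

private
  covered-once : all (λ k → all (λ x → all (coverage (cyclic k) x) (upTo 11)) (upTo 11)) (5 ∷ 7 ∷ []) ≡ true
  covered-once = refl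

-- A count of exactly 1 for each edge yields both conditions: at least 1 is covering, at most 1 is
-- disjointness.
covered-once⇒decomposition : ∀ {qs} → All Proper qs →
  (∀ {x y} → x < 11 → y < 11 → T (coverage qs x y)) → Decomposition qs
covered-once⇒decomposition {qs} proper once = record
  { proper = proper
  ; disjoint = disjoint proper λ x< y< x≢y → ≤-reflexive (once′ x< y< x≢y)
  ; covers = λ {x} {y} x< y< x≢y → nonempty (λ q → adjacent⁻ q) qs (once′ x< y< x≢y)
  }
  where
  once′ : ∀ {x y} → x < 11 → y < 11 → x ≢ y → length (filterᵇ (λ q → adjacent q x y) qs) ≡ 1
  once′ {x} {y} x< y< x≢y = ≡ᵇ⇒≡ _ 1 (∨-elimˡ {x ≡ᵇ y} (x≢y ∘ ≡ᵇ⇒≡ x y) (once x< y<))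
  nonempty : ∀ {x y} → (∀ q → T (adjacent q x y) → Adj q x y) → ∀ qs →
             length (filterᵇ (λ q → adjacent q x y) qs) ≡ 1 → Any (λ q → Adj q x y) qs
  nonempty {x} {y} f qs eq with filterᵇ (λ q → adjacent q x y) qs in feq
  ... | q ∷ _ = let q∈ , t = ∈-filter⁻ (T? ∘ λ q → adjacent q x y) {xs = qs} (subst (q ∈_) (sym feq) (here refl))
                in lose q∈ (f q t)
  disjoint : ∀ {qs} → All Proper qs →
    (∀ {x y} → x < 11 → y < 11 → x ≢ y → length (filterᵇ (λ q → adjacent q x y) qs) ≤ 1) → AllPairs Disjoint qs
  disjoint [] _ = []
  disjoint {q ∷ qs} (p ∷ ps) ≤1 = All.tabulate (λ r∈ x y aq ar →
      let x< , y< = Adj< q p aq in clash′ r∈ aq ar (≤1 x< y< (proj₁ aq))) ∷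
    disjoint ps (λ {x} {y} x< y< x≢y → ≤-trans (subst (length (filterᵇ (λ q → adjacent q x y) qs) ≤_)
      (sym (length-filterᵇ-∷ (λ q → adjacent q x y) q qs)) (m≤n+m _ (bit (adjacent q x y)))) (≤1 x< y< x≢y))
    where
    clash′ : ∀ {r x y} → r ∈ qs → Adj q x y → Adj r x y → ¬ length (filterᵇ (λ q → adjacent q x y) (q ∷ qs)) ≤ 1
    clash′ {r} {x} {y} r∈ aq ar ≤1 = contradiction (≤-trans 2≤ ≤1) λ { (s≤s ()) }
      where
      one : ∀ {xs} → r ∈ xs → 1 ≤ length xs
      one {_ ∷ _} _ = s≤s z≤n
      2≤ : 2 ≤ length (filterᵇ (λ q → adjacent q x y) (q ∷ qs))
      2≤ = subst (2 ≤_) (sym (trans (length-filterᵇ-∷ (λ q → adjacent q x y) q qs)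
             (cong (λ b → bit b + length (filterᵇ (λ q → adjacent q x y) qs)) (Equivalence.to T-≡ (adjacent⁺ q aq)))))
             (s≤s (one (∈-filter⁺ (T? ∘ λ q → adjacent q x y) r∈ (adjacent⁺ r ar))))

cyclic-decomposition : ∀ {k} → k ∈ 5 ∷ 7 ∷ [] → Decomposition (cyclic k)
cyclic-decomposition {k} k∈ = covered-once⇒decomposition (All.tabulate (cyclic-proper k∈)) λ {x} x< y< →
  all-upTo (coverage (cyclic k) x) (all-upTo (λ x → all (coverage (cyclic k) x) (upTo 11))
    (all-lookup (λ k → all (λ x → all (coverage (cyclic k) x) (upTo 11)) (upTo 11)) (5 ∷ 7 ∷ []) covered-once k∈) x<) y<

-- For the inclusion not contained in `occ`: the central edge of a block of `qs` is covered by an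
-- image of a cyclic block; that image occurs in `qs`, and by `unique-cover` it is the given block.
cyclic-represents : ∀ {qs D q} → Decomposition qs → Represents qs D → (c : CyclicThrough qs q) →
  Represents (map (rename (c .CyclicThrough.σ .to)) (cyclic (c .CyclicThrough.k))) D
cyclic-represents {qs} {D} Q rep c = mk⇔ (Equivalence.to rep ∘ ⊆) (⊇ ∘ Equivalence.from rep)
  where
  open CyclicThrough c
  X = map (rename (σ .to)) (cyclic k)
  XD : Decomposition X
  XD = rename-decomposition σ (cyclic-decomposition k∈)
  partner : ∀ {x} → x ∈ X → ∃ λ r → r ∈ qs × T (same r x)
  partner x∈ with x , x∈′ , refl ← ∈-map⁻ (rename (σ .to)) x∈ = find (any⁻ (λ r → same r (rename (σ .to) x)) qs (occ x∈′))
  properX = All.lookup (Decomposition.proper XD)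
  properQ = All.lookup (Decomposition.proper Q)
  ⊆ : ∀ {G} → G ∈ map block X → G ∈ map block qs
  ⊆ G∈ = let x , x∈ , G≡ = ∈-map⁻ block G∈
             r , r∈ , s = partner x∈
         in subst (_∈ map block qs) (trans (same⇒block≡ (properQ r∈) (properX x∈) s) (sym G≡)) (∈-map⁺ block r∈)
  reached : ∀ {r} → r ∈ qs → block r ∈ map block X
  reached {r@(quad a b _ _)} r∈ =
    let p = properQ r∈
        a< , b< = Adj< r p (a-b p)
        x , x∈ , adj = find (Decomposition.covers XD a< b< (a≢b p))
        r′ , r′∈ , s = partner x∈
        r′≡r = unique-cover Q r′∈ r∈ (Adj-cong x r′ (sym ∘ same⇒role r′ x (properX x∈) s) adj) (a-b p)
    in subst (_∈ map block X) (sym (trans (cong block (sym r′≡r)) (same⇒block≡ (properQ r′∈) (properX x∈) s))) (∈-map⁺ block x∈)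
  ⊇ : ∀ {G} → G ∈ map block qs → G ∈ map block X
  ⊇ G∈ = let r , r∈ , G≡ = ∈-map⁻ block G∈ in subst (_∈ map block X) (sym G≡) (reached r∈)

-- Pairs of designs sharing three blocks

any-map-cong : ∀ {A B : Set} {p : B → Bool} {p′ : A → Bool} {f : A → B} {xs} →
               (∀ {x} → x ∈ xs → p (f x) ≡ p′ x) → any p (map f xs) ≡ any p′ xs
any-map-cong {xs = []} h = refl
any-map-cong {xs = x ∷ xs} h = cong₂ _∨_ (h (here refl)) (any-map-cong (h ∘ there))

same-rename : ∀ σ τ {x y} → Proper x → Proper y →
  same (rename (σ .to) x) (rename (τ .to) y) ≡ same x (rename (σ .from ∘ τ .to) y)
same-rename σ τ {x} {quad a b c d} px ((a< ∷ b< ∷ c< ∷ d< ∷ []) , _)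
  rewrite rename-role′ σ px (τ .to< a<) | rename-role′ σ px (τ .to< b<)
        | rename-role′ σ px (τ .to< c<) | rename-role′ σ px (τ .to< d<) = refl

renameTriple : (ℕ → ℕ) → Triple → Triple
renameTriple f (x , y , z) = f x , f y , f z

spans-rename : ∀ σ τ {q t} → Proper q → ProperTriple t →
  spans (rename (σ .to) q) (renameTriple (τ .to) t) ≡ spans q (renameTriple (σ .from ∘ τ .to) t)
spans-rename σ τ pq ((x< ∷ y< ∷ z< ∷ []) , _)
  rewrite rename-role′ σ pq (τ .to< x<) | rename-role′ σ pq (τ .to< y<) | rename-role′ σ pq (τ .to< z<) = refl

count-cong : ∀ {A : Set} {B C : Set} {p : B → Bool} {p′ : C → Bool} {f : A → B} {g : A → C} {xs} →
  (∀ {x} → x ∈ xs → p (f x) ≡ p′ (g x)) → length (filterᵇ p (map f xs)) ≡ length (filterᵇ p′ (map g xs))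
count-cong {xs = []} h = refl
count-cong {p = p} {p′} {f} {g} {x ∷ xs} h = trans (length-filterᵇ-∷ p (f x) (map f xs))
  (trans (cong₂ (λ b n → bit b + n) (h (here refl)) (count-cong (h ∘ there))) (sym (length-filterᵇ-∷ p′ (g x) (map g xs))))

triangles-rename : ∀ f qs → concatMap triangles (map (rename f) qs) ≡ map (renameTriple f) (concatMap triangles qs)
triangles-rename f [] = refl
triangles-rename f (quad a b c d ∷ qs) = cong (λ ts → _ ∷ _ ∷ ts) (triangles-rename f qs)

module _ (σ τ : Perm) {xs ys} (X : All Proper xs) (Y : All Proper ys) where
  -- Renaming both designs by one bijection changes no count, so only the composite of `τ` with the
  -- inverse of `σ` matters.
  shared-rename : length (shared (map (rename (σ .to)) xs) (map (rename (τ .to)) ys)) ≡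
                  length (shared xs (map (rename (σ .from ∘ τ .to)) ys))
  shared-rename = count-cong {xs = ys} λ {y} y∈ → any-map-cong {xs = xs} λ {x} x∈ →
    same-rename σ τ {x} {y} (All.lookup X x∈) (All.lookup Y y∈)

  sharedTriangles-rename : length (sharedTriangles (map (rename (σ .to)) xs) (map (rename (τ .to)) ys)) ≡
                           length (sharedTriangles xs (map (rename (σ .from ∘ τ .to)) ys))
  sharedTriangles-rename
    rewrite triangles-rename (τ .to) ys | triangles-rename (σ .from ∘ τ .to) ys =
    count-cong {xs = concatMap triangles ys} λ {t} t∈ → any-map-cong {xs = xs} λ {x} x∈ →
      let y , y∈ , t∈y = find (∈-concatMap⁻ triangles {xs = ys} t∈)
      in spans-rename σ τ {x} {t} (All.lookup X x∈) (All.lookup (triangles-proper {y} (All.lookup Y y∈)) t∈y)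

count-mono : ∀ {A B : Set} {p : A → Bool} {p′ : B → Bool} {f : A → B} {xs} →
  (∀ {x} → x ∈ xs → T (p x) → T (p′ (f x))) → length (filterᵇ p xs) ≤ length (filterᵇ p′ (map f xs))
count-mono {xs = []} h = z≤n
count-mono {p = p} {p′} {f} {x ∷ xs} h
  with p x | p′ (f x) | h (here refl) | count-mono {p = p} {p′} {f} {xs} (h ∘ there)
... | true  | true  | _ | ih = s≤s ih
... | true  | false | t | _  = contradiction (t tt) λ ()
... | false | true  | _ | ih = m≤n⇒m≤1+n ih
... | false | false | _ | ih = ih

-- Enumeration of the bijections that align two cyclic designs

Option : Set
Option = Quad × List Quad

-- If τ takes i to v and the block y to x, then v has in x the role that i has in y.
refine : ℕ → ℕ → Option → Option
refine i v (y , xs) = y , filterᵇ (λ x → role x v ≡ᵇ role y i) xs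

hasChoice : Option → Bool
hasChoice (_ , xs) = not (null xs)

-- Runs through the bijections τ taking y₀ to x₀, given by their values at 0, 1, …, so far.  An option
-- (y , xs) lists the blocks xs that τ may still take y to; at least three such lists must be non-empty.
module Explore (final : List ℕ → Bool) (x₀ y₀ : Quad) where
  explore : ℕ → ℕ → List ℕ → List Option → Bool
  explore′ : ℕ → ℕ → List ℕ → List Option → Bool

  explore zero    i vs os = final vs
  explore (suc n) i vs os = all (λ v →
    any (v ≡ᵇ_) vs ∨ not (role x₀ v ≡ᵇ role y₀ i) ∨ explore′ n (suc i) (vs ∷ʳ v) (map (refine i v) os)) (upTo 11)

  explore′ n i vs os = (length (filterᵇ hasChoice os) <ᵇ 3) ∨ explore n i vs os

  start : List Option → Bool
  start os = explore 11 0 [] os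

  module _ (τ : Perm) (y₀-proper : Proper y₀) (x₀∼y₀ : T (same x₀ (rename (τ .to) y₀))) where
    private
      -- The number of blocks which τ really takes to one of their remaining options. It never drops
      -- along the path of τ, and it bounds from below the number of non-empty options, which is all
      -- that the search can see.
      live : List Option → ℕ
      live os = length (filterᵇ (λ (y , xs) → occurs xs (rename (τ .to) y)) os)

      tracks : ∀ {x y} → Proper y → T (same x (rename (τ .to) y)) → ∀ {i} → i < 11 → role x (τ .to i) ≡ role y i
      tracks {x} {y} p s {i} i< = trans (same⇒role x (rename (τ .to) y) (rename-proper τ p) s (τ .to i)) (rename-role τ p i<)

      refine-live : ∀ {i os} → i < 11 → All (Proper ∘ proj₁) os → live os ≤ live (map (refine i (τ .to i)) os)
      refine-live {i} {os} i< ps = count-mono {xs = os} λ { {y , xs} o∈ t →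
        let x , x∈ , s = find (any⁻ (λ x → same x (rename (τ .to) y)) xs t)
        in any⁺ (λ x → same x (rename (τ .to) y)) (lose (∈-filter⁺ (T? ∘ λ x → role x (τ .to i) ≡ᵇ role y i) x∈
             (≡⇒≡ᵇ _ _ (tracks {x} {y} (All.lookup ps o∈) s i<))) s) }

      live-open : ∀ os → live os ≤ length (filterᵇ hasChoice os)
      live-open os = subst (λ os′ → live os ≤ length (filterᵇ hasChoice os′)) (map-id os)
        (count-mono {p = λ (y , xs) → occurs xs (rename (τ .to) y)} {p′ = hasChoice} {f = id} {xs = os}
          λ { {y , _ ∷ _} _ _ → tt })

    -- Follows the branch given by the values of τ: they are distinct, they respect the roles in
    -- `x₀` and `y₀`, and at least three options stay open, so the branch is never pruned.
    explore-sound : ∀ n i os → n + i ≡ 11 → All (Proper ∘ proj₁) os → 3 ≤ live os →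
                    T (explore n i (applyUpTo (τ .to) i) os) → T (final (applyUpTo (τ .to) 11))
    explore-sound zero i os refl _ _ t = t
    explore-sound (suc n) i os eq ps 3≤ t =
      explore-sound n (suc i) (map (refine i v) os) (trans (+-suc n i) eq) (Allₚ.map⁺ ps) 3≤′
        (subst (λ vs → T (explore n (suc i) vs (map (refine i v) os))) (applyUpTo-∷ʳ (τ .to) i) t₄)
      where
      v = τ .to i
      i< : i < 11
      i< = subst (suc i ≤_) eq (s≤s (m≤n+m i n))
      3≤′ : 3 ≤ live (map (refine i v) os)
      3≤′ = ≤-trans 3≤ (refine-live i< ps)
      t₁ : T (any (v ≡ᵇ_) (applyUpTo (τ .to) i) ∨ not (role x₀ v ≡ᵇ role y₀ i) ∨
              explore′ n (suc i) (applyUpTo (τ .to) i ∷ʳ v) (map (refine i v) os))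
      t₁ = all-upTo (λ v → any (v ≡ᵇ_) (applyUpTo (τ .to) i) ∨ not (role x₀ v ≡ᵇ role y₀ i) ∨
             explore′ n (suc i) (applyUpTo (τ .to) i ∷ʳ v) (map (refine i v) os)) t (τ .to< i<)
      fresh : ¬ T (any (v ≡ᵇ_) (applyUpTo (τ .to) i))
      fresh h with w , w∈ , vw ← find (any⁻ (v ≡ᵇ_) (applyUpTo (τ .to) i) h)
              with j , j<i , refl ← ∈-applyUpTo⁻ (τ .to) w∈ =
        <⇒≢ j<i (sym (to-injective τ i< (<-trans j<i i<) (≡ᵇ⇒≡ v _ vw)))
      t₂ = ∨-elimˡ {any (v ≡ᵇ_) (applyUpTo (τ .to) i)} fresh t₁
      agree : ¬ T (not (role x₀ v ≡ᵇ role y₀ i))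
      agree h = subst (T ∘ not) (Equivalence.to T-≡ (≡⇒≡ᵇ _ _ (tracks {x₀} {y₀} y₀-proper x₀∼y₀ i<))) h
      t₃ = ∨-elimˡ {not (role x₀ v ≡ᵇ role y₀ i)} agree t₂
      t₄ = ∨-elimˡ {length (filterᵇ hasChoice (map (refine i v) os)) <ᵇ 3}
             (λ h → <⇒≱ (<ᵇ⇒< _ 3 h) (≤-trans 3≤′ (live-open (map (refine i v) os)))) t₃

    start-sound : ∀ os → All (Proper ∘ proj₁) os → 3 ≤ live os → T (start os) → T (final (applyUpTo (τ .to) 11))
    start-sound os = explore-sound 11 0 os refl

nth-applyUpTo : ∀ f {n j} → j < n → nth (applyUpTo f n) j ≡ f j
nth-applyUpTo f {suc n} {zero}  _         = refl
nth-applyUpTo f {suc n} {suc j} (s≤s j<) = nth-applyUpTo (f ∘ suc) j<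

-- The spectrum

-- ((s , t) , k , l , vs): cyclic k and the image of cyclic l under i ↦ nth vs i share s blocks and t + 2 s triangles.
Witness : Set
Witness = (ℕ × ℕ) × ℕ × ℕ × List ℕ

witnesses : List Witness
witnesses =
  ((0 , 0) , 7 , 7 , 2 ∷ 3 ∷ 4 ∷ 8 ∷ 9 ∷ 1 ∷ 6 ∷ 7 ∷ 0 ∷ 5 ∷ 10 ∷ []) ∷
  ((0 , 1) , 7 , 7 , 2 ∷ 3 ∷ 10 ∷ 6 ∷ 1 ∷ 4 ∷ 9 ∷ 7 ∷ 0 ∷ 5 ∷ 8 ∷ []) ∷
  ((0 , 2) , 7 , 7 , 2 ∷ 3 ∷ 4 ∷ 6 ∷ 9 ∷ 1 ∷ 5 ∷ 7 ∷ 0 ∷ 8 ∷ 10 ∷ []) ∷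
  ((0 , 3) , 7 , 7 , 2 ∷ 3 ∷ 4 ∷ 5 ∷ 9 ∷ 1 ∷ 6 ∷ 7 ∷ 0 ∷ 8 ∷ 10 ∷ []) ∷
  ((0 , 4) , 7 , 7 , 2 ∷ 3 ∷ 10 ∷ 9 ∷ 1 ∷ 4 ∷ 6 ∷ 7 ∷ 0 ∷ 5 ∷ 8 ∷ []) ∷
  ((0 , 5) , 7 , 7 , 1 ∷ 3 ∷ 10 ∷ 9 ∷ 4 ∷ 2 ∷ 6 ∷ 7 ∷ 0 ∷ 5 ∷ 8 ∷ []) ∷
  ((0 , 6) , 7 , 7 , 5 ∷ 3 ∷ 10 ∷ 9 ∷ 4 ∷ 1 ∷ 6 ∷ 7 ∷ 0 ∷ 2 ∷ 8 ∷ []) ∷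
  ((0 , 7) , 7 , 7 , 2 ∷ 3 ∷ 10 ∷ 9 ∷ 4 ∷ 6 ∷ 1 ∷ 7 ∷ 0 ∷ 5 ∷ 8 ∷ []) ∷
  ((0 , 8) , 7 , 7 , 10 ∷ 4 ∷ 3 ∷ 8 ∷ 0 ∷ 7 ∷ 5 ∷ 1 ∷ 2 ∷ 6 ∷ 9 ∷ []) ∷
  ((0 , 9) , 7 , 7 , 7 ∷ 6 ∷ 3 ∷ 1 ∷ 4 ∷ 0 ∷ 2 ∷ 9 ∷ 10 ∷ 5 ∷ 8 ∷ []) ∷
  ((0 , 10) , 5 , 5 , 5 ∷ 6 ∷ 0 ∷ 9 ∷ 10 ∷ 8 ∷ 7 ∷ 4 ∷ 3 ∷ 2 ∷ 1 ∷ []) ∷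
  ((0 , 11) , 5 , 5 , 6 ∷ 0 ∷ 10 ∷ 7 ∷ 4 ∷ 2 ∷ 5 ∷ 8 ∷ 9 ∷ 1 ∷ 3 ∷ []) ∷
  ((1 , 0) , 5 , 7 , 1 ∷ 9 ∷ 5 ∷ 6 ∷ 10 ∷ 4 ∷ 2 ∷ 3 ∷ 0 ∷ 7 ∷ 8 ∷ []) ∷
  ((1 , 1) , 7 , 7 , 8 ∷ 10 ∷ 7 ∷ 0 ∷ 1 ∷ 3 ∷ 2 ∷ 4 ∷ 6 ∷ 5 ∷ 9 ∷ []) ∷
  ((1 , 2) , 7 , 7 , 4 ∷ 3 ∷ 10 ∷ 9 ∷ 2 ∷ 1 ∷ 6 ∷ 7 ∷ 0 ∷ 5 ∷ 8 ∷ []) ∷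
  ((1 , 3) , 7 , 7 , 8 ∷ 10 ∷ 7 ∷ 3 ∷ 1 ∷ 0 ∷ 2 ∷ 4 ∷ 6 ∷ 5 ∷ 9 ∷ []) ∷
  ((1 , 4) , 7 , 7 , 8 ∷ 7 ∷ 0 ∷ 3 ∷ 1 ∷ 9 ∷ 2 ∷ 4 ∷ 6 ∷ 5 ∷ 10 ∷ []) ∷
  ((1 , 5) , 7 , 7 , 2 ∷ 3 ∷ 10 ∷ 9 ∷ 4 ∷ 1 ∷ 6 ∷ 7 ∷ 0 ∷ 5 ∷ 8 ∷ []) ∷
  ((1 , 6) , 7 , 7 , 8 ∷ 10 ∷ 0 ∷ 3 ∷ 2 ∷ 5 ∷ 1 ∷ 7 ∷ 6 ∷ 4 ∷ 9 ∷ []) ∷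
  ((1 , 7) , 5 , 7 , 7 ∷ 8 ∷ 2 ∷ 1 ∷ 9 ∷ 6 ∷ 5 ∷ 3 ∷ 0 ∷ 4 ∷ 10 ∷ []) ∷
  ((1 , 8) , 7 , 7 , 1 ∷ 0 ∷ 10 ∷ 9 ∷ 4 ∷ 3 ∷ 8 ∷ 7 ∷ 6 ∷ 5 ∷ 2 ∷ []) ∷
  ((1 , 9) , 7 , 7 , 1 ∷ 10 ∷ 0 ∷ 9 ∷ 4 ∷ 5 ∷ 8 ∷ 7 ∷ 6 ∷ 3 ∷ 2 ∷ []) ∷
  ((1 , 10) , 5 , 5 , 5 ∷ 6 ∷ 0 ∷ 10 ∷ 9 ∷ 8 ∷ 7 ∷ 4 ∷ 3 ∷ 2 ∷ 1 ∷ []) ∷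
  ((2 , 0) , 5 , 7 , 9 ∷ 8 ∷ 1 ∷ 2 ∷ 10 ∷ 6 ∷ 7 ∷ 0 ∷ 3 ∷ 4 ∷ 5 ∷ []) ∷
  ((2 , 1) , 7 , 7 , 3 ∷ 10 ∷ 6 ∷ 5 ∷ 4 ∷ 1 ∷ 7 ∷ 9 ∷ 2 ∷ 8 ∷ 0 ∷ []) ∷
  ((2 , 2) , 7 , 7 , 8 ∷ 2 ∷ 7 ∷ 3 ∷ 1 ∷ 0 ∷ 10 ∷ 4 ∷ 6 ∷ 5 ∷ 9 ∷ []) ∷
  ((2 , 3) , 7 , 7 , 8 ∷ 10 ∷ 0 ∷ 3 ∷ 2 ∷ 7 ∷ 4 ∷ 1 ∷ 6 ∷ 5 ∷ 9 ∷ []) ∷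
  ((2 , 4) , 7 , 7 , 7 ∷ 3 ∷ 10 ∷ 9 ∷ 0 ∷ 1 ∷ 6 ∷ 2 ∷ 4 ∷ 5 ∷ 8 ∷ []) ∷
  ((2 , 5) , 7 , 7 , 0 ∷ 10 ∷ 3 ∷ 2 ∷ 4 ∷ 7 ∷ 1 ∷ 6 ∷ 8 ∷ 9 ∷ 5 ∷ []) ∷
  ((2 , 6) , 5 , 7 , 7 ∷ 8 ∷ 2 ∷ 1 ∷ 6 ∷ 9 ∷ 0 ∷ 10 ∷ 5 ∷ 4 ∷ 3 ∷ []) ∷
  ((2 , 7) , 5 , 7 , 4 ∷ 3 ∷ 2 ∷ 8 ∷ 7 ∷ 1 ∷ 0 ∷ 5 ∷ 6 ∷ 9 ∷ 10 ∷ []) ∷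
  ((2 , 8) , 5 , 7 , 2 ∷ 7 ∷ 0 ∷ 3 ∷ 6 ∷ 5 ∷ 4 ∷ 10 ∷ 9 ∷ 8 ∷ 1 ∷ []) ∷
  ((2 , 9) , 5 , 5 , 5 ∷ 0 ∷ 10 ∷ 1 ∷ 2 ∷ 3 ∷ 4 ∷ 9 ∷ 8 ∷ 7 ∷ 6 ∷ []) ∷
  ((3 , 1) , 5 , 7 , 1 ∷ 0 ∷ 5 ∷ 6 ∷ 10 ∷ 9 ∷ 2 ∷ 3 ∷ 4 ∷ 7 ∷ 8 ∷ []) ∷
  ((3 , 2) , 5 , 7 , 2 ∷ 3 ∷ 4 ∷ 8 ∷ 7 ∷ 1 ∷ 0 ∷ 6 ∷ 5 ∷ 9 ∷ 10 ∷ []) ∷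
  ((3 , 3) , 5 , 7 , 7 ∷ 8 ∷ 1 ∷ 2 ∷ 9 ∷ 6 ∷ 0 ∷ 10 ∷ 5 ∷ 4 ∷ 3 ∷ []) ∷
  ((3 , 4) , 5 , 7 , 7 ∷ 8 ∷ 2 ∷ 1 ∷ 9 ∷ 6 ∷ 5 ∷ 10 ∷ 0 ∷ 4 ∷ 3 ∷ []) ∷
  ((3 , 5) , 5 , 7 , 4 ∷ 3 ∷ 8 ∷ 7 ∷ 2 ∷ 1 ∷ 0 ∷ 6 ∷ 5 ∷ 9 ∷ 10 ∷ []) ∷
  ((3 , 6) , 5 , 7 , 6 ∷ 5 ∷ 7 ∷ 8 ∷ 2 ∷ 1 ∷ 0 ∷ 4 ∷ 3 ∷ 10 ∷ 9 ∷ []) ∷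
  ((3 , 7) , 5 , 7 , 4 ∷ 3 ∷ 7 ∷ 6 ∷ 2 ∷ 1 ∷ 0 ∷ 8 ∷ 5 ∷ 9 ∷ 10 ∷ []) ∷
  ((3 , 8) , 7 , 7 , 4 ∷ 7 ∷ 10 ∷ 5 ∷ 8 ∷ 9 ∷ 6 ∷ 0 ∷ 1 ∷ 2 ∷ 3 ∷ []) ∷
  ((4 , 1) , 5 , 7 , 4 ∷ 3 ∷ 2 ∷ 8 ∷ 7 ∷ 1 ∷ 0 ∷ 6 ∷ 5 ∷ 10 ∷ 9 ∷ []) ∷
  ((4 , 2) , 7 , 5 , 2 ∷ 4 ∷ 3 ∷ 0 ∷ 10 ∷ 5 ∷ 6 ∷ 7 ∷ 1 ∷ 9 ∷ 8 ∷ []) ∷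
  ((4 , 3) , 7 , 5 , 1 ∷ 9 ∷ 5 ∷ 4 ∷ 3 ∷ 0 ∷ 10 ∷ 7 ∷ 6 ∷ 8 ∷ 2 ∷ []) ∷
  ((4 , 4) , 5 , 5 , 5 ∷ 0 ∷ 10 ∷ 9 ∷ 2 ∷ 3 ∷ 4 ∷ 1 ∷ 8 ∷ 7 ∷ 6 ∷ []) ∷
  ((4 , 5) , 5 , 5 , 0 ∷ 1 ∷ 9 ∷ 10 ∷ 2 ∷ 3 ∷ 4 ∷ 5 ∷ 6 ∷ 7 ∷ 8 ∷ []) ∷
  ((4 , 7) , 5 , 7 , 2 ∷ 10 ∷ 7 ∷ 0 ∷ 1 ∷ 6 ∷ 5 ∷ 4 ∷ 8 ∷ 9 ∷ 3 ∷ []) ∷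
  ((5 , 3) , 5 , 7 , 7 ∷ 8 ∷ 2 ∷ 1 ∷ 9 ∷ 6 ∷ 0 ∷ 10 ∷ 5 ∷ 4 ∷ 3 ∷ []) ∷
  ((5 , 4) , 5 , 7 , 4 ∷ 3 ∷ 2 ∷ 8 ∷ 7 ∷ 1 ∷ 0 ∷ 6 ∷ 5 ∷ 9 ∷ 10 ∷ []) ∷
  ((5 , 5) , 5 , 7 , 4 ∷ 3 ∷ 7 ∷ 8 ∷ 2 ∷ 1 ∷ 0 ∷ 6 ∷ 5 ∷ 9 ∷ 10 ∷ []) ∷
  ((5 , 6) , 5 , 5 , 7 ∷ 6 ∷ 5 ∷ 4 ∷ 8 ∷ 9 ∷ 10 ∷ 0 ∷ 3 ∷ 2 ∷ 1 ∷ []) ∷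
  -- Translation by 1, which preserves `cyclic 5`, followed by the exchange of 6 and 8. The exchange
  -- fixes [ 3 , 4 , 6 - 8 ] and the five blocks that avoid both vertices.
  ((6 , 2) , 5 , 5 , 1 ∷ 2 ∷ 3 ∷ 4 ∷ 5 ∷ 8 ∷ 7 ∷ 6 ∷ 9 ∷ 10 ∷ 0 ∷ []) ∷
  -- Translation by 2 is an automorphism of `cyclic 5`.
  ((11 , 0) , 5 , 5 , 2 ∷ 3 ∷ 4 ∷ 5 ∷ 6 ∷ 7 ∷ 8 ∷ 9 ∷ 10 ∷ 0 ∷ 1 ∷ []) ∷
  []

isOrder : ℕ → Bool
isOrder k = any (k ≡ᵇ_) (5 ∷ 7 ∷ [])

isOrder⁻ : ∀ {k} → T (isOrder k) → k ∈ 5 ∷ 7 ∷ []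
isOrder⁻ {k} t = Any.map (λ {l} → ≡ᵇ⇒≡ k l) (any⁻ (k ≡ᵇ_) (5 ∷ 7 ∷ []) t)

blockCount triangleCount : ℕ → ℕ → List ℕ → ℕ
blockCount    k l vs = length (shared (cyclic k) (map (rename (nth vs)) (cyclic l)))
triangleCount k l vs = length (sharedTriangles (cyclic k) (map (rename (nth vs)) (cyclic l)))

valid : Witness → Bool
valid ((s , t) , k , l , vs) = isEnumeration vs ∧ isOrder k ∧ isOrder l ∧
  (blockCount k l vs ≡ᵇ s) ∧ (triangleCount k l vs ≡ᵇ t + 2 * s)

all-valid : all valid witnesses ≡ true
all-valid = refl

-- Phrased with the number of triangles n = t + 2 s, so that t need not be obtained by subtraction.
attained : ℕ → ℕ → Bool
attained s n = any (λ ((s′ , t′) , _) → (s ≡ᵇ s′) ∧ (n ≡ᵇ t′ + 2 * s′)) witnesses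

final : ℕ → ℕ → List ℕ → Bool
final k l vs = attained (blockCount k l vs) (triangleCount k l vs)

options : ℕ → ℕ → List Option
options k l = map (λ y → y , cyclic k) (cyclic l)

exploration : all (λ k → all (λ l → Explore.start (final k l) (quad 0 1 3 k) (quad 0 1 3 l) (options k l))
                (5 ∷ 7 ∷ [])) (5 ∷ 7 ∷ []) ≡ true
exploration = refl

spectrum : List (ℕ × ℕ)
spectrum = map proj₁ witnesses

realised : ∀ {s t k l vs} → T (valid ((s , t) , k , l , vs)) → Fine 11 (s , t)
realised {s} {t} {k} {l} {vs} v =
  let enum , v₁ = Equivalence.to (T-∧ {isEnumeration vs}) v
      k-ok , v₂ = Equivalence.to (T-∧ {isOrder k}) v₁
      l-ok , v₃ = Equivalence.to (T-∧ {isOrder l}) v₂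
      s≡ , t≡   = Equivalence.to (T-∧ {blockCount k l vs ≡ᵇ s}) v₃
      X = cyclic-decomposition (isOrder⁻ {k} k-ok)
      Y = rename-decomposition (enumerated vs enum) (cyclic-decomposition (isOrder⁻ {l} l-ok))
  in design X , design Y ,
     subst (IntersectInBlocks (design X) (design Y)) (≡ᵇ⇒≡ (blockCount k l vs) s s≡)
       (blocks-intersect {D₁ = design X} {design Y} X Y (mk⇔ id id) (mk⇔ id id)) ,
     subst (IntersectInTriangles (design X) (design Y)) (≡ᵇ⇒≡ (triangleCount k l vs) (t + 2 * s) t≡)
       (triangles-intersect {D₁ = design X} {design Y} X Y (mk⇔ id id) (mk⇔ id id))

spectrum⊆Fine : ∀ {p} → p ∈ spectrum → Fine 11 p
spectrum⊆Fine p∈ with ((s , t) , k , l , vs) , w∈ , refl ← ∈-map⁻ proj₁ {xs = witnesses} p∈ =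
  realised {s} {t} {k} {l} {vs} (all-lookup valid witnesses all-valid w∈)

rename-cong : ∀ {f g q} → Proper q → (∀ {n} → n < 11 → f n ≡ g n) → rename f q ≡ rename g q
rename-cong {q = quad a b c d} ((a< ∷ b< ∷ c< ∷ d< ∷ []) , _) h
  rewrite h a< | h b< | h c< | h d< = refl

module _ {k l} (k∈ : k ∈ 5 ∷ 7 ∷ []) (l∈ : l ∈ 5 ∷ 7 ∷ []) (τ : Perm)
  (τ-through : T (same (quad 0 1 3 k) (rename (τ .to) (quad 0 1 3 l)))) where
  private
    Y = map (rename (τ .to)) (cyclic l)

  attained-by : 3 ≤ length (shared (cyclic k) Y) →
                T (attained (length (shared (cyclic k) Y)) (length (sharedTriangles (cyclic k) Y)))
  attained-by 3≤ = subst (λ ys → T (attained (length (shared (cyclic k) ys)) (length (sharedTriangles (cyclic k) ys)))) Y≡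
    (Explore.start-sound (final k l) (quad 0 1 3 k) (quad 0 1 3 l) τ (cyclic-proper l∈ (head∈ l∈)) τ-through
      (options k l) (Allₚ.map⁺ {f = λ y → y , cyclic k} (All.tabulate (cyclic-proper l∈)))
      (subst (3 ≤_) (count-cong {p = occurs (cyclic k)} {p′ = λ (y , xs) → occurs xs (rename (τ .to) y)}
        {f = rename (τ .to)} {g = λ y → y , cyclic k} {xs = cyclic l} λ _ → refl) 3≤)
      (all-lookup (λ l → Explore.start (final k l) (quad 0 1 3 k) (quad 0 1 3 l) (options k l)) (5 ∷ 7 ∷ [])
        (Equivalence.to T-≡ (all-lookup
          (λ k → all (λ l → Explore.start (final k l) (quad 0 1 3 k) (quad 0 1 3 l) (options k l)) (5 ∷ 7 ∷ []))
          (5 ∷ 7 ∷ []) exploration k∈)) l∈))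
    where
    -- The search knows τ only by its values at 0, ..., 10, which determine the renamed blocks.
    Y≡ : map (rename (nth (applyUpTo (τ .to) 11))) (cyclic l) ≡ Y
    Y≡ = map-cong-local (All.tabulate λ {y} y∈ → rename-cong {q = y} (cyclic-proper l∈ y∈) (nth-applyUpTo (τ .to)))

module _ {D₁ D₂ : Design 11} {qs rs q r} (Q : Decomposition qs) (R : Decomposition rs)
  (repQ : Represents qs D₁) (repR : Represents rs D₂) (q∼r : T (same q r))
  (c : CyclicThrough qs q) (e : CyclicThrough rs r) where
  private
    module C = CyclicThrough c
    module E = CyclicThrough e
    X = cyclic-decomposition C.k∈
    Y = cyclic-decomposition E.k∈
    X′ = rename-decomposition C.σ X
    Y′ = rename-decomposition E.σ Y
    properX = Decomposition.proper X
    properY = Decomposition.proper Y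
    x₀ = quad 0 1 3 C.k
    y₀ = quad 0 1 3 E.k
    px₀ = cyclic-proper C.k∈ (head∈ C.k∈)
    py₀ = cyclic-proper E.k∈ (head∈ E.k∈)
    τ = inverse C.σ ⊙ E.σ

    s≡ : length (shared qs rs) ≡ length (shared (cyclic C.k) (map (rename (τ .to)) (cyclic E.k)))
    s≡ = trans (cardinality-unique (blocks-intersect {D₁ = D₁} {D₂} Q R repQ repR)
                 (blocks-intersect {D₁ = D₁} {D₂} X′ Y′ (cyclic-represents {D = D₁} Q repQ c) (cyclic-represents {D = D₂} R repR e)))
               (shared-rename C.σ E.σ properX properY)

    t≡ : length (sharedTriangles qs rs) ≡ length (sharedTriangles (cyclic C.k) (map (rename (τ .to)) (cyclic E.k)))
    t≡ = trans (cardinality-unique (triangles-intersect {D₁ = D₁} {D₂} Q R repQ repR)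
                 (triangles-intersect {D₁ = D₁} {D₂} X′ Y′ (cyclic-represents {D = D₁} Q repQ c) (cyclic-represents {D = D₂} R repR e)))
               (sharedTriangles-rename C.σ E.σ properX properY)

  -- Both isomorphisms take the block at i = 0 to the shared block, so `τ` takes one such block to
  -- the other and is among the bijections enumerated by `exploration`.
  common-block⇒attained : Proper r → 3 ≤ length (shared qs rs) →
                          T (attained (length (shared qs rs)) (length (sharedTriangles qs rs)))
  common-block⇒attained pr 3≤ = subst₂ (λ m n → T (attained m n)) (sym s≡) (sym t≡)
    (attained-by C.k∈ E.k∈ τ (subst T (same-rename C.σ E.σ px₀ py₀) aligned) (subst (3 ≤_) s≡ 3≤))
    where
    aligned : T (same (rename (C.σ .to) x₀) (rename (E.σ .to) y₀))
    aligned = role⇒same (rename (C.σ .to) x₀) (rename (E.σ .to) y₀) (rename-proper E.σ py₀) λ z →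
      trans (sym (same⇒role q (rename (C.σ .to) x₀) (rename-proper C.σ px₀) C.thr z))
        (trans (same⇒role q r pr q∼r z) (same⇒role r (rename (E.σ .to) y₀) (rename-proper E.σ py₀) E.thr z))

-- The dichotomy: at most two shared blocks, or at least three

Outcome : ℕ → ℕ → Set
Outcome s n = (s ≤ 2 × n ≤ 11 + s) ⊎ T (attained s n)

nonempty⇒∈ : ∀ {A : Set} {xs : List A} → 1 ≤ length xs → ∃ λ x → x ∈ xs
nonempty⇒∈ {xs = x ∷ _} _ = x , here refl

decomposition-length : ∀ {qs} → Decomposition qs → length qs ≡ 11
decomposition-length {qs} Q = trans (sym (length-map canonical qs))
  (length≡11 (canonical-decomposition Q) (Allₚ.map⁺ (All.map canonical∈quads (Decomposition.proper Q))))

shared-outcome : ∀ {D₁ D₂ qs rs} → Decomposition qs → Decomposition rs → Represents qs D₁ → Represents rs D₂ →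
                 Outcome (length (shared qs rs)) (length (sharedTriangles qs rs))
shared-outcome {D₁} {D₂} {qs} {rs} Q R repQ repR = decide (3 ≤? length (shared qs rs))
  where
  decide : Dec (3 ≤ length (shared qs rs)) → Outcome (length (shared qs rs)) (length (sharedTriangles qs rs))
  decide (yes 3≤) =
    let r , r∈ = nonempty⇒∈ (≤-trans (s≤s z≤n) 3≤)
        r∈rs , occ = ∈-filter⁻ (T? ∘ occurs qs) {xs = rs} r∈
        q , q∈ , q∼r = find (any⁻ (λ q → same q r) qs occ)
    in inj₂ (common-block⇒attained {D₁} {D₂} Q R repQ repR q∼r (classification Q q∈) (classification R r∈rs)
         (All.lookup (Decomposition.proper R) r∈rs) 3≤)
  decide (no 3≰) = inj₁ (s≤s⁻¹ (≰⇒> 3≰) , subst (λ n → length (sharedTriangles qs rs) ≤ n + length (shared qs rs))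
    (decomposition-length R) (triangles-bound Q (Decomposition.proper R)))

outcome : ∀ D₁ D₂ {s n} → IntersectInBlocks D₁ D₂ s → IntersectInTriangles D₁ D₂ n → Outcome s n
outcome D₁ D₂ {s} {n} inBlocks inTriangles =
  let qs , Q , repQ = quads-of-design D₁
      rs , R , repR = quads-of-design D₂
  in subst₂ Outcome (cardinality-unique (blocks-intersect {D₁ = D₁} {D₂} Q R repQ repR) inBlocks)
       (cardinality-unique (triangles-intersect {D₁ = D₁} {D₂} Q R repQ repR) inTriangles) (shared-outcome {D₁} {D₂} Q R repQ repR)

intersections : ∀ D₁ D₂ → ∃₂ λ s n → IntersectInBlocks D₁ D₂ s × IntersectInTriangles D₁ D₂ n
intersections D₁ D₂ =
  let qs , Q , repQ = quads-of-design D₁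
      rs , R , repR = quads-of-design D₂
  in length (shared qs rs) , length (sharedTriangles qs rs) ,
     blocks-intersect {D₁ = D₁} {D₂} Q R repQ repR , triangles-intersect {D₁ = D₁} {D₂} Q R repQ repR

-- Comparison with the admissible pairs

member : List (ℕ × ℕ) → ℕ → ℕ → Bool
member ps s t = any (λ (s′ , t′) → (s ≡ᵇ s′) ∧ (t ≡ᵇ t′)) ps

∈⇒member : ∀ {ps s t} → (s , t) ∈ ps → T (member ps s t)
∈⇒member {s = s} {t} p∈ = any⁺ _ (Any.map (λ { refl → Equivalence.from (T-∧ {s ≡ᵇ s}) (≡⇒≡ᵇ s s refl , ≡⇒≡ᵇ t t refl) }) p∈)

member⇒∈ : ∀ ps s t → T (member ps s t) → (s , t) ∈ ps
member⇒∈ ps s t m = Any.map (λ { {s′ , t′} h →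
  let h₁ , h₂ = Equivalence.to (T-∧ {s ≡ᵇ s′}) h in cong₂ _,_ (≡ᵇ⇒≡ s s′ h₁) (≡ᵇ⇒≡ t t′ h₂) })
  (any⁻ (λ (s′ , t′) → (s ≡ᵇ s′) ∧ (t ≡ᵇ t′)) ps m)

attained⁻ : ∀ s n → T (attained s n) → ∃ λ t → (s , t) ∈ spectrum × n ≡ t + 2 * s
attained⁻ s n a =
  let ((s′ , t′) , w) , w∈ , h = find (any⁻ (λ ((s′ , t′) , _) → (s ≡ᵇ s′) ∧ (n ≡ᵇ t′ + 2 * s′)) witnesses a)
      h₁ , h₂ = Equivalence.to (T-∧ {s ≡ᵇ s′}) h
      s≡s′ = ≡ᵇ⇒≡ s s′ h₁
  in t′ , subst (λ s → (s , t′) ∈ spectrum) (sym s≡s′) (∈-map⁺ proj₁ w∈) ,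
     subst (λ s → n ≡ t′ + 2 * s) (sym s≡s′) (≡ᵇ⇒≡ n (t′ + 2 * s′) h₂)

excluded : List (ℕ × ℕ)
excluded = (3 , 0) ∷ (4 , 0) ∷ (4 , 6) ∷ (5 , 0) ∷ (5 , 1) ∷ (5 , 2) ∷ (6 , 0) ∷ (6 , 1) ∷ (6 , 3) ∷ (6 , 4) ∷ []

private
  smallMember : ℕ → ℕ → Bool
  smallMember s t = not (t + s ≤ᵇ 11) ∨ member spectrum s t

  -- With at most two shared blocks the bound s + t ≤ 11 is exact: no exception has s ≤ 2.
  small-members : all (λ s → all (smallMember s) (upTo 12)) (upTo 3) ≡ true
  small-members = refl

  admissible : ℕ × ℕ → Bool
  admissible (s , t) = (s + t ≤ᵇ 11) ∧ not (member excluded s t)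

  all-admissible : all admissible spectrum ≡ true
  all-admissible = refl

  blocksPossible : ℕ → Bool
  blocksPossible s = any (λ (s′ , _) → s ≡ᵇ s′) spectrum

  -- Designs sharing at most two blocks share at most 11 + 2 triangles.
  trianglesPossible : ℕ → Bool
  trianglesPossible n = (n ≤ᵇ 13) ∨ any (λ (s′ , t′) → n ≡ᵇ t′ + 2 * s′) spectrum

  decided : ℕ → ℕ → Bool
  decided s t = not (s + t ≤ᵇ 11) ∨ not (blocksPossible s) ∨ not (trianglesPossible (t + 2 * s)) ∨
                member excluded s t ∨ member spectrum s t

  -- Once s is known to be one of 0, ..., 6, 11, the condition on triangles removes only (6 , 5),
  -- which would require 17 common triangles.
  all-decided : all (λ s → all (decided s) (upTo 12)) (upTo 12) ≡ true
  all-decided = refl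

¬T-not : ∀ {b} → T b → ¬ T (not b)
¬T-not {true} _ ()

T-not⇒¬T : ∀ {b} → T (not b) → ¬ T b
T-not⇒¬T {false} _ ()

small⇒∈ : ∀ {s t} → s ≤ 2 → t + s ≤ 11 → (s , t) ∈ spectrum
small⇒∈ {s} {t} s≤2 t+s≤ = member⇒∈ spectrum s t (∨-elimˡ {not (t + s ≤ᵇ 11)} (¬T-not (≤⇒≤ᵇ t+s≤))
  (all-upTo (smallMember s) (all-upTo (λ s → all (smallMember s) (upTo 12)) {3} (Equivalence.from T-≡ small-members) (s≤s s≤2))
    (s≤s (≤-trans (m≤m+n t s) t+s≤))))

Fine⊆spectrum : ∀ {p} → Fine 11 p → p ∈ spectrum
Fine⊆spectrum {s , t} (D₁ , D₂ , inBlocks , inTriangles) = cases (outcome D₁ D₂ inBlocks inTriangles)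
  where
  cases : Outcome s (t + 2 * s) → (s , t) ∈ spectrum
  -- Cancelling one s in t + 2 s ≤ 11 + s gives t + s ≤ 11.
  cases (inj₁ (s≤2 , n≤)) = small⇒∈ s≤2 (+-cancelʳ-≤ s (t + s) 11
    (≤-trans (≤-reflexive (trans (+-assoc t s s) (cong (λ m → t + (s + m)) (sym (+-identityʳ s))))) n≤))
  cases (inj₂ a) = let t′ , p∈ , eq = attained⁻ s (t + 2 * s) a
                   in subst (λ t → (s , t) ∈ spectrum) (sym (+-cancelʳ-≡ (2 * s) t t′ eq)) p∈

J⇒possible : ∀ {s} → J 11 s → T (blocksPossible s)
J⇒possible {s} (D₁ , D₂ , inBlocks) =
  let _ , n , _ , inTriangles = intersections D₁ D₂ in cases (outcome D₁ D₂ inBlocks inTriangles)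
  where
  via : ∀ {t} → (s , t) ∈ spectrum → T (blocksPossible s)
  via p∈ = any⁺ (λ (s′ , _) → s ≡ᵇ s′) (Any.map (λ { refl → ≡⇒≡ᵇ s s refl }) p∈)
  cases : ∀ {n} → Outcome s n → T (blocksPossible s)
  -- Any t attained together with s would do; (s , 0) is attained for every s ≤ 2.
  cases (inj₁ (s≤2 , _)) = via (small⇒∈ {t = 0} s≤2 (≤-trans s≤2 (s≤s (s≤s z≤n))))
  cases {n} (inj₂ a) = let t , p∈ , _ = attained⁻ s n a in via p∈

J-T⇒possible : ∀ {n} → J-T 11 n → T (trianglesPossible n)
J-T⇒possible {n} (D₁ , D₂ , inTriangles) =
  let s , _ , inBlocks , _ = intersections D₁ D₂ in cases (outcome D₁ D₂ inBlocks inTriangles)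
  where
  cases : ∀ {s} → Outcome s n → T (trianglesPossible n)
  cases (inj₁ (s≤2 , n≤)) = Equivalence.from (T-∨ {n ≤ᵇ 13}) (inj₁ (≤⇒≤ᵇ (≤-trans n≤ (+-monoʳ-≤ 11 s≤2))))
  cases {s} (inj₂ a) = let t , p∈ , eq = attained⁻ s n a in
    Equivalence.from (T-∨ {n ≤ᵇ 13}) (inj₂ (any⁺ (λ (s′ , t′) → n ≡ᵇ t′ + 2 * s′)
      (Any.map (λ { refl → ≡⇒≡ᵇ n (t + 2 * s) eq }) p∈)))

theorem4p5 : Fine 11 ≐ Adm 11 ∖ (_∈ (3 , 0) ∷ (4 , 0) ∷ (4 , 6) ∷ (5 , 0) ∷ (5 , 1) ∷ (5 , 2) ∷ (6 , 0) ∷ (6 , 1) ∷ (6 , 3) ∷ (6 , 4) ∷ [])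
theorem4p5 = to′ , from′
  where
  to′ : ∀ {p} → Fine 11 p → (Adm 11 ∖ (_∈ excluded)) p
  to′ {s , t} fine@(D₁ , D₂ , inBlocks , inTriangles) =
    let sum≤ , allowed = Equivalence.to (T-∧ {s + t ≤ᵇ 11}) (all-lookup admissible spectrum all-admissible (Fine⊆spectrum fine))
    -- The given pair of designs itself shows s ∈ `J 11` and t + 2 s ∈ `J-T 11`.
    in (≤ᵇ⇒≤ (s + t) 11 sum≤ , (D₁ , D₂ , inBlocks) , (D₁ , D₂ , inTriangles)) ,
       T-not⇒¬T allowed ∘ ∈⇒member
  from′ : ∀ {p} → (Adm 11 ∖ (_∈ excluded)) p → Fine 11 p
  from′ {s , t} ((sum≤ , s∈J , t∈J-T) , allowed) = spectrum⊆Fine (member⇒∈ spectrum s t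
    (∨-elimˡ {member excluded s t} (allowed ∘ member⇒∈ excluded s t)
    (∨-elimˡ {not (trianglesPossible (t + 2 * s))} (¬T-not (J-T⇒possible t∈J-T))
    (∨-elimˡ {not (blocksPossible s)} (¬T-not (J⇒possible s∈J))
    (∨-elimˡ {not (s + t ≤ᵇ 11)} (¬T-not (≤⇒≤ᵇ sum≤))
      (all-upTo (decided s) (all-upTo (λ s → all (decided s) (upTo 12)) (Equivalence.from T-≡ all-decided)
        (s≤s (≤-trans (m≤m+n s t) sum≤))) (s≤s (≤-trans (m≤n+m t s) sum≤))))))))
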